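{- There exist absolute constants $c_0>0$ and $c>0$ such that for all sufficiently large integers $R$, the class \[ \mathcal{H}_R(c_0)=\{f:X_R'\to\{ -1,1\} : \operatorname{FR}(f)\ge c_0\} \] satisfies $\operatorname{VC}(\mathcal{H}_R(c_0))\ge cR$.
   Context: For an integer $R\ge1$ let $X_R=\{1,2,\dots,R\}$ and let $X_R'$ be the set of squarefree integers in $X_R$ (equivalently, those $n\le R$ with $\mu(n)\neq 0$, where $\mu$ is the Möbius function). A function $f:X_R'\to\{ -1,1\}$ is extended to $X_R$ by setting $f(n)=0$ for $n\notin X_R'$. Its Fourier transform is $\widehat f(x)=\sum_{n=1}^R f(n)e^{ -2\pi i n x}$, $x\in[0,1]$, and its Fourier Ratio is \[ \operatorname{FR}(f)=\frac{\|\widehat f\|_{L^1([0,1])}}{\|\widehat f\|_{L^2([0,1])}}, \] with norms taken with respect to Lebesgue measure on $[0,1]$. A subset $S\subset X_R'$ is shattered by a class $\mathcal F$ of functions $X_R'\to\{ -1,1\}$ if for every $\sigma:S\to\{ -1,1\}$ there exists $f\in\mathcal F$ with $f(n)=\sigma(n)$ for all $n\in S$. The Vapnik–Chervonenkis dimension $\operatorname{VC}(\mathcal F)$ is the maximal cardinality of a subset of $X_R'$ shattered by $\mathcal F$. -}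

module Defs where

open import Algebra.Definitions.RawMonoid using (sum)
open import Algebra.Bundles.Raw using (RawMonoid)
open import Data.Bool.Base using (if_then_else_)
open import Data.Fin.Base using (Fin; zero; suc; toℕ)
open import Data.Fin.Subset using (Subset; _∈_; _⊆_; ∣_∣)
open import Data.Fin.Subset.Properties using (_∈?_)
open import Data.Integer.Base as ℤ using (ℤ; +_; -[1+_])
import Data.Integer.Properties as ℤₚ
open import Data.Nat.Base as ℕ using (ℕ; zero; suc)
open import Data.Nat.Coprimality using (1-coprimeTo)
import Data.Nat.Coprimality as Coprimality
open import Data.Nat.Divisibility using (_∣_; ∣⇒≤; _∣?_)
import Data.Nat.Properties as ℕₚ
open import Data.Product.Base using (∃-syntax; Σ-syntax; _×_; _,_; proj₁; proj₂)
open import Data.Rational.Base as ℚ using (ℚ; mkℚ; 0ℚ; 1ℚ; ½; *≤*)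
import Data.Rational.Properties as ℚₚ
open import Data.Rational.Solver using (module +-*-Solver)
open import Data.Sign.Base using (Sign)
open import Data.Sum.Base using (inj₁; inj₂)
open import Data.Vec.Base using (tabulate)
open import Relation.Binary.PropositionalEquality
  using (_≡_; refl; sym; trans; cong; cong₂; subst; subst₂; module ≡-Reasoning)
open import Relation.Nullary.Decidable using (Dec; yes; no; does; map′; _→-dec_)

private
  module Q = +-*-Solver

ι : ℕ → ℚ
ι n = + n ℚ./ 1

recip : ℕ → ℚ
recip n = + 1 ℚ./ suc n

module Rational where

  open import Data.Rational.Base using (_+_; _*_; _-_; -_; _≤_; _<_) renaming (∣_∣ to abs)

  ι-mk : ∀ n → ι n ≡ mkℚ (+ n) 0 (Coprimality.sym (1-coprimeTo n))
  ι-mk n = ℚₚ.normalize-coprime (Coprimality.sym (1-coprimeTo n))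

  recip-mk : ∀ n → recip n ≡ mkℚ (+ 1) n (1-coprimeTo (suc n))
  recip-mk n = ℚₚ.normalize-coprime (1-coprimeTo (suc n))

  ι-+ : ∀ a b → ι (a ℕ.+ b) ≡ ι a + ι b
  ι-+ a b rewrite ι-mk a | ι-mk b =
    cong₂ (λ x y → (x ℤ.+ y) ℚ./ 1) (sym (ℤₚ.*-identityʳ (+ a))) (sym (ℤₚ.*-identityʳ (+ b)))

  ι-* : ∀ a b → ι (a ℕ.* b) ≡ ι a * ι b
  ι-* a b rewrite ι-mk a | ι-mk b = cong (ℚ._/ 1) (ℤₚ.pos-* a b)

  ι*recip : ∀ n → ι (suc n) * recip n ≡ 1ℚ
  ι*recip n rewrite ι-mk (suc n) | recip-mk n =
    ℚₚ.*-inverseʳ (mkℚ (+ suc n) 0 (Coprimality.sym (1-coprimeTo (suc n))))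

  ι-mono : ∀ {a b} → a ℕ.≤ b → ι a ≤ ι b
  ι-mono {a} {b} a≤b rewrite ι-mk a | ι-mk b =
    *≤* (ℤₚ.*-monoʳ-≤-nonNeg (+ 1) (ℤ.+≤+ a≤b))

  0<recip : ∀ n → 0ℚ < recip n
  0<recip n = ℚₚ.positive⁻¹ (recip n) {{ℚₚ.normalize-pos 1 (suc n)}}

  0≤ι : ∀ n → 0ℚ ≤ ι n
  0≤ι n = ι-mono {0} {n} ℕ.z≤n

  *-mono : ∀ {a b c d} → 0ℚ ≤ c → 0ℚ ≤ b → a ≤ b → c ≤ d → a * c ≤ b * d
  *-mono {a} {b} {c} {d} 0≤c 0≤b a≤b c≤d = ℚₚ.≤-trans
    (ℚₚ.*-monoʳ-≤-nonNeg c {{ℚ.nonNegative 0≤c}} a≤b)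
    (ℚₚ.*-monoˡ-≤-nonNeg b {{ℚ.nonNegative 0≤b}} c≤d)

  0≤* : ∀ {a b} → 0ℚ ≤ a → 0ℚ ≤ b → 0ℚ ≤ a * b
  0≤* {a} {b} 0≤a 0≤b =
    subst (_≤ a * b) (ℚₚ.*-zeroˡ 0ℚ) (*-mono ℚₚ.≤-refl 0≤a 0≤a 0≤b)

  0<* : ∀ {a b} → 0ℚ < a → 0ℚ < b → 0ℚ < a * b
  0<* {a} {b} 0<a 0<b =
    ℚₚ.positive⁻¹ (a * b) {{ℚₚ.pos*pos⇒pos a {{ℚ.positive 0<a}} b {{ℚ.positive 0<b}}}}

  0≤+ : ∀ {a b} → 0ℚ ≤ a → 0ℚ ≤ b → 0ℚ ≤ a + b
  0≤+ {a} {b} 0≤a 0≤b = subst (_≤ a + b) (ℚₚ.+-identityʳ 0ℚ) (ℚₚ.+-mono-≤ 0≤a 0≤b)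

  0<+ : ∀ {a b} → 0ℚ ≤ a → 0ℚ < b → 0ℚ < a + b
  0<+ {a} {b} 0≤a 0<b = subst (_< a + b) (ℚₚ.+-identityʳ 0ℚ) (ℚₚ.+-mono-≤-< 0≤a 0<b)

  0<½ : 0ℚ < ½
  0<½ = 0<recip 1

  half+half : ∀ ε → ε * ½ + ε * ½ ≡ ε
  half+half ε = trans (sym (ℚₚ.*-distribˡ-+ ε ½ ½)) (ℚₚ.*-identityʳ ε)

  0<half : ∀ {ε} → 0ℚ < ε → 0ℚ < ε * ½
  0<half 0<ε = 0<* 0<ε 0<½

  recip-anti : ∀ {m n} → m ℕ.≤ n → recip n ≤ recip m
  recip-anti {m} {n} m≤n = subst₂ _≤_ lhs rhs
    (*-mono (0≤ι (suc m)) (0≤* 0≤rm 0≤rn) ℚₚ.≤-refl (ι-mono (ℕ.s≤s m≤n)))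
    where
    0≤rm = ℚₚ.<⇒≤ (0<recip m)
    0≤rn = ℚₚ.<⇒≤ (0<recip n)
    lhs : recip m * recip n * ι (suc m) ≡ recip n
    lhs = trans (Q.solve 3 (λ a b c → a Q.:* b Q.:* c Q.:= b Q.:* (c Q.:* a)) refl
                   (recip m) (recip n) (ι (suc m)))
                (trans (cong (recip n *_) (ι*recip m)) (ℚₚ.*-identityʳ (recip n)))
    rhs : recip m * recip n * ι (suc n) ≡ recip m
    rhs = trans (Q.solve 3 (λ a b c → a Q.:* b Q.:* c Q.:= a Q.:* (c Q.:* b)) refl
                   (recip m) (recip n) (ι (suc n)))
                (trans (cong (recip m *_) (ι*recip n)) (ℚₚ.*-identityʳ (recip m)))

  archimedean : ∀ p → ∃[ n ] p ≤ ι n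
  archimedean p@(mkℚ (+ k) d c) = k , subst (p ≤_) (sym (ι-mk k))
    (*≤* (ℤₚ.*-monoˡ-≤-nonNeg (+ k) (ℤ.+≤+ (ℕ.s≤s ℕ.z≤n))))
  archimedean p@(mkℚ -[1+ k ] d c) = 0 , *≤* ℤ.-≤+

  recip≤ : ∀ ε → 0ℚ < ε → ∃[ n ] recip n ≤ ε
  recip≤ ε@(mkℚ (+ suc k) d c) _ = d , subst (_≤ ε) (sym (recip-mk d))
    (*≤* (ℤₚ.*-monoʳ-≤-nonNeg (+ suc d) (ℤ.+≤+ (ℕ.s≤s (ℕ.z≤n {k})))))
  recip≤ (mkℚ (+ zero) d c) (ℚ.*<* (ℤ.+<+ ()))
  recip≤ (mkℚ -[1+ k ] d c) (ℚ.*<* ())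

  abs-≤ : ∀ {p q} → p ≤ q → - p ≤ q → abs p ≤ q
  abs-≤ {p} p≤q -p≤q with ℚₚ.∣p∣≡p∨∣p∣≡-p p
  ... | inj₁ e = subst (_≤ _) (sym e) p≤q
  ... | inj₂ e = subst (_≤ _) (sym e) -p≤q

  p≤abs : ∀ p → p ≤ abs p
  p≤abs p with ℚₚ.≤-total 0ℚ p
  ... | inj₁ 0≤p = ℚₚ.≤-reflexive (sym (ℚₚ.0≤p⇒∣p∣≡p 0≤p))
  ... | inj₂ p≤0 = ℚₚ.≤-trans p≤0 (ℚₚ.0≤∣p∣ p)

  neg-sub : ∀ p q → - (p - q) ≡ q - p
  neg-sub = Q.solve 2 (λ p q → Q.:- (p Q.:- q) Q.:= q Q.:- p) refl

  abs-sym : ∀ p q → abs (p - q) ≡ abs (q - p)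
  abs-sym p q = trans (sym (ℚₚ.∣-p∣≡∣p∣ (p - q))) (cong abs (neg-sub p q))

  triangle : ∀ p q r → abs (p - r) ≤ abs (p - q) + abs (q - r)
  triangle p q r = subst (λ t → abs t ≤ abs (p - q) + abs (q - r))
    (Q.solve 3 (λ p q r → (p Q.:- q) Q.:+ (q Q.:- r) Q.:= p Q.:- r) refl p q r)
    (ℚₚ.∣p+q∣≤∣p∣+∣q∣ (p - q) (q - r))

  ≤⇒sub : ∀ {p q e} → p ≤ q + e → p - q ≤ e
  ≤⇒sub {p} {q} {e} h = subst (p - q ≤_)
    (Q.solve 2 (λ q e → q Q.:+ e Q.:- q Q.:= e) refl q e) (ℚₚ.+-monoˡ-≤ (- q) h)

  sub⇒≤ : ∀ {p q e} → p - q ≤ e → p ≤ q + e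
  sub⇒≤ {p} {q} {e} h = subst₂ _≤_
    (Q.solve 2 (λ p q → p Q.:- q Q.:+ q Q.:= p) refl p q) (ℚₚ.+-comm e q) (ℚₚ.+-monoˡ-≤ q h)

  abs-lip : ∀ p q → abs (abs p - abs q) ≤ abs (p - q)
  abs-lip p q = abs-≤ (one p q)
    (subst₂ _≤_ (sym (neg-sub (abs p) (abs q))) (abs-sym q p) (one q p))
    where
    one : ∀ p q → abs p - abs q ≤ abs (p - q)
    one p q = ≤⇒sub (subst (λ t → abs t ≤ abs q + abs (p - q))
      (Q.solve 2 (λ p q → q Q.:+ (p Q.:- q) Q.:= p) refl p q)
      (ℚₚ.∣p+q∣≤∣p∣+∣q∣ q (p - q)))

  ½^ : ℕ → ℚ
  ½^ zero    = 1ℚ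
  ½^ (suc n) = ½^ n * ½

  0<½^ : ∀ n → 0ℚ < ½^ n
  0<½^ zero    = 0<recip 0
  0<½^ (suc n) = 0<half (0<½^ n)

  ½^≤recip : ∀ n → ½^ n ≤ recip n
  ½^≤recip n = subst₂ _≤_ lhs rhs
    (ℚₚ.*-monoʳ-≤-nonNeg (recip n) {{ℚ.nonNegative (ℚₚ.<⇒≤ (0<recip n))}} (go n))
    where
    go : ∀ n → ι (suc n) * ½^ n ≤ 1ℚ
    go zero    = ℚₚ.≤-refl
    go (suc n) = ℚₚ.≤-trans
      (*-mono (ℚₚ.<⇒≤ (0<½^ (suc n))) (0≤ι (suc n ℕ.+ suc n))
        (ι-mono (ℕₚ.+-monoʳ-≤ 1 (ℕₚ.m≤n+m (suc n) n))) ℚₚ.≤-refl)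
      (subst (_≤ 1ℚ) (sym eq) (go n))
      where
      eq : ι (suc n ℕ.+ suc n) * (½^ n * ½) ≡ ι (suc n) * ½^ n
      eq = trans (cong (_* (½^ n * ½)) (ι-+ (suc n) (suc n)))
        (trans (Q.solve 3 (λ a b h → (a Q.:+ a) Q.:* (b Q.:* h) Q.:= a Q.:* b Q.:* (h Q.:+ h)) refl
                 (ι (suc n)) (½^ n) ½)
               (ℚₚ.*-identityʳ _))
    lhs : ι (suc n) * ½^ n * recip n ≡ ½^ n
    lhs = trans (Q.solve 3 (λ a b c → a Q.:* b Q.:* c Q.:= b Q.:* (a Q.:* c)) refl
                  (ι (suc n)) (½^ n) (recip n))
                (trans (cong (½^ n *_) (ι*recip n)) (ℚₚ.*-identityʳ _))
    rhs : 1ℚ * recip n ≡ recip n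
    rhs = ℚₚ.*-identityˡ (recip n)

  ½^-anti : ∀ n l → ½^ (l ℕ.+ n) ≤ ½^ n
  ½^-anti n zero    = ℚₚ.≤-refl
  ½^-anti n (suc l) = ℚₚ.≤-trans
    (subst (½^ (l ℕ.+ n) * ½ ≤_) (ℚₚ.*-identityʳ _)
      (*-mono (ℚₚ.<⇒≤ 0<½) (ℚₚ.<⇒≤ (0<½^ (l ℕ.+ n))) ℚₚ.≤-refl (recip-anti {0} {1} ℕ.z≤n)))
    (½^-anti n l)

  divide : ∀ b → 0ℚ < b → ∀ ε → 0ℚ < ε → ∃[ δ ] 0ℚ < δ × b * δ ≡ ε
  divide b 0<b ε 0<ε = i * ε , 0<* 0<i 0<ε ,
    trans (sym (ℚₚ.*-assoc b i ε)) (trans (cong (_* ε) b*i) (ℚₚ.*-identityˡ ε))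
    where
    instance
      b-pos : ℚ.Positive b
      b-pos = ℚ.positive 0<b
      b-nz : ℚ.NonZero b
      b-nz = ℚₚ.pos⇒nonZero b
    i = ℚ.1/ b
    b*i : b * i ≡ 1ℚ
    b*i = ℚₚ.*-inverseʳ b
    0<i : 0ℚ < i
    0<i = ℚₚ.positive⁻¹ i {{ℚₚ.1/pos⇒pos b}}

  vanish : ∀ b → 0ℚ < b → ∀ ε → 0ℚ < ε → ∃[ n ] b * ½^ n ≤ ε
  vanish b 0<b ε 0<ε with divide b 0<b ε 0<ε
  ... | δ , 0<δ , bδ≡ε with recip≤ δ 0<δ
  ... | n , le = n , subst (b * ½^ n ≤_) bδ≡ε
    (ℚₚ.*-monoˡ-≤-nonNeg b {{ℚ.nonNegative (ℚₚ.<⇒≤ 0<b)}} (ℚₚ.≤-trans (½^≤recip n) le))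

open Rational using (½^)

IsCauchy : (ℕ → ℚ) → Set
IsCauchy s = ∀ ε → 0ℚ ℚ.< ε → ∃[ N ] (∀ m n → N ℕ.≤ m → N ℕ.≤ n → ℚ.∣ s m ℚ.- s n ∣ ℚ.≤ ε)

module CauchyLemmas where

  open import Data.Rational.Base using (_+_; _*_; _-_; -_; _≤_; _<_) renaming (∣_∣ to abs)
  open Rational

  const-cauchy : ∀ q → IsCauchy (λ _ → q)
  const-cauchy q ε 0<ε = 0 , λ _ _ _ _ →
    subst (λ t → abs t ≤ ε) (sym (ℚₚ.+-inverseʳ q)) (ℚₚ.<⇒≤ 0<ε)

  neg-cauchy : ∀ {s} → IsCauchy s → IsCauchy (λ n → - s n)
  neg-cauchy {s} c ε 0<ε with c ε 0<ε
  ... | N , h = N , λ m n Nm Nn → subst (_≤ ε)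
    (trans (abs-sym (s m) (s n))
      (cong abs (Q.solve 2 (λ a b → b Q.:- a Q.:= Q.:- a Q.:- (Q.:- b)) refl (s m) (s n))))
    (h m n Nm Nn)

  abs-cauchy : ∀ {s} → IsCauchy s → IsCauchy (λ n → abs (s n))
  abs-cauchy {s} c ε 0<ε with c ε 0<ε
  ... | N , h = N , λ m n Nm Nn → ℚₚ.≤-trans (abs-lip (s m) (s n)) (h m n Nm Nn)

  +-cauchy : ∀ {s t} → IsCauchy s → IsCauchy t → IsCauchy (λ n → s n + t n)
  +-cauchy {s} {t} cs ct ε 0<ε with cs (ε * ½) (0<half 0<ε) | ct (ε * ½) (0<half 0<ε)
  ... | N , h | M , k = N ℕ.⊔ M , λ m n m≥ n≥ → begin
    abs (s m + t m - (s n + t n))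
      ≡⟨ cong abs (Q.solve 4 (λ a b c d → a Q.:+ b Q.:- (c Q.:+ d) Q.:= (a Q.:- c) Q.:+ (b Q.:- d))
           refl (s m) (t m) (s n) (t n)) ⟩
    abs ((s m - s n) + (t m - t n))
      ≤⟨ ℚₚ.∣p+q∣≤∣p∣+∣q∣ (s m - s n) (t m - t n) ⟩
    abs (s m - s n) + abs (t m - t n)
      ≤⟨ ℚₚ.+-mono-≤ (h m n (ℕₚ.m⊔n≤o⇒m≤o N M m≥) (ℕₚ.m⊔n≤o⇒m≤o N M n≥))
                     (k m n (ℕₚ.m⊔n≤o⇒n≤o N M m≥) (ℕₚ.m⊔n≤o⇒n≤o N M n≥)) ⟩
    ε * ½ + ε * ½
      ≡⟨ half+half ε ⟩
    ε ∎
    where open ℚₚ.≤-Reasoning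

  bounded : ∀ {s} → IsCauchy s → ∃[ B ] 0ℚ < B × (∃[ N ] (∀ n → N ℕ.≤ n → abs (s n) ≤ B))
  bounded {s} c with c 1ℚ (0<recip 0)
  ... | N , h = abs (s N) + 1ℚ ,
    0<+ (ℚₚ.0≤∣p∣ (s N)) (0<recip 0) , N , λ n n≥ → begin
    abs (s n)                    ≡⟨ cong abs (Q.solve 2 (λ a b → a Q.:= b Q.:+ (a Q.:- b)) refl (s n) (s N)) ⟩
    abs (s N + (s n - s N))      ≤⟨ ℚₚ.∣p+q∣≤∣p∣+∣q∣ (s N) (s n - s N) ⟩
    abs (s N) + abs (s n - s N)  ≤⟨ ℚₚ.+-monoʳ-≤ (abs (s N)) (h n N n≥ ℕₚ.≤-refl) ⟩
    abs (s N) + 1ℚ ∎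
    where open ℚₚ.≤-Reasoning

  abs-*-diff : ∀ {a b c d A B α β} → 0ℚ ≤ A → 0ℚ ≤ β → abs a ≤ A → abs d ≤ B →
                 abs (b - d) ≤ α → abs (a - c) ≤ β → abs (a * b - c * d) ≤ A * α + β * B
  abs-*-diff {a} {b} {c} {d} {A} {B} {α} {β} 0≤A 0≤β a≤ d≤ bd≤ ac≤ = begin
      abs (a * b - c * d)
        ≡⟨ cong abs (Q.solve 4 (λ a b c d → a Q.:* b Q.:- c Q.:* d Q.:=
             a Q.:* (b Q.:- d) Q.:+ (a Q.:- c) Q.:* d) refl a b c d) ⟩
      abs (a * (b - d) + (a - c) * d)
        ≤⟨ ℚₚ.∣p+q∣≤∣p∣+∣q∣ (a * (b - d)) ((a - c) * d) ⟩
      abs (a * (b - d)) + abs ((a - c) * d)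
        ≡⟨ cong₂ _+_ (ℚₚ.∣p*q∣≡∣p∣*∣q∣ a (b - d)) (ℚₚ.∣p*q∣≡∣p∣*∣q∣ (a - c) d) ⟩
      abs a * abs (b - d) + abs (a - c) * abs d
        ≤⟨ ℚₚ.+-mono-≤ (*-mono (ℚₚ.0≤∣p∣ (b - d)) 0≤A a≤ bd≤) (*-mono (ℚₚ.0≤∣p∣ d) 0≤β ac≤ d≤) ⟩
      A * α + β * B ∎
      where open ℚₚ.≤-Reasoning

  *-cauchy : ∀ {s t} → IsCauchy s → IsCauchy t → IsCauchy (λ n → s n * t n)
  *-cauchy {s} {t} cs ct ε 0<ε = combine (bounded cs) (bounded ct)
    where
    combine : ∃[ A ] 0ℚ < A × (∃[ N ] (∀ n → N ℕ.≤ n → abs (s n) ≤ A)) →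
              ∃[ B ] 0ℚ < B × (∃[ N ] (∀ n → N ℕ.≤ n → abs (t n) ≤ B)) →
              ∃[ N ] (∀ m n → N ℕ.≤ m → N ℕ.≤ n → abs (s m * t m - s n * t n) ≤ ε)
    combine (A , 0<A , Na , ha) (B , 0<B , Nb , hb) =
      step (divide A 0<A (ε * ½) (0<half 0<ε)) (divide B 0<B (ε * ½) (0<half 0<ε))
      where
      step : ∃[ α ] 0ℚ < α × A * α ≡ ε * ½ → ∃[ β ] 0ℚ < β × B * β ≡ ε * ½ →
             ∃[ N ] (∀ m n → N ℕ.≤ m → N ℕ.≤ n → abs (s m * t m - s n * t n) ≤ ε)
      step (α , 0<α , Aα≡) (β , 0<β , Bβ≡) with cs β 0<β | ct α 0<α
      ... | N , h | M , k = (Na ℕ.⊔ Nb) ℕ.⊔ (N ℕ.⊔ M) , λ m n m≥ n≥ →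
        let m₁ = ℕₚ.m⊔n≤o⇒m≤o (Na ℕ.⊔ Nb) (N ℕ.⊔ M) m≥
            m₂ = ℕₚ.m⊔n≤o⇒n≤o (Na ℕ.⊔ Nb) (N ℕ.⊔ M) m≥
            n₁ = ℕₚ.m⊔n≤o⇒m≤o (Na ℕ.⊔ Nb) (N ℕ.⊔ M) n≥
            n₂ = ℕₚ.m⊔n≤o⇒n≤o (Na ℕ.⊔ Nb) (N ℕ.⊔ M) n≥
        in ℚₚ.≤-trans
             (abs-*-diff {s m} {t m} {s n} {t n} {A} {B} {α} {β} (ℚₚ.<⇒≤ 0<A) (ℚₚ.<⇒≤ 0<β)
               (ha m (ℕₚ.m⊔n≤o⇒m≤o Na Nb m₁)) (hb n (ℕₚ.m⊔n≤o⇒n≤o Na Nb n₁))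
               (k m n (ℕₚ.m⊔n≤o⇒n≤o N M m₂) (ℕₚ.m⊔n≤o⇒n≤o N M n₂))
               (h m n (ℕₚ.m⊔n≤o⇒m≤o N M m₂) (ℕₚ.m⊔n≤o⇒m≤o N M n₂)))
             (ℚₚ.≤-reflexive total)
        where
        total : A * α + β * B ≡ ε
        total = trans (cong₂ _+_ Aα≡ (trans (ℚₚ.*-comm β B) Bβ≡)) (half+half ε)

open CauchyLemmas

-- The lower end, after n bisection steps, of an interval that starts as
-- [0 , q + 1] and keeps containing √q.
√-lower : ℚ → ℕ → ℚ
√-lower q zero    = 0ℚ
√-lower q (suc n) =
  let mid = √-lower q n ℚ.+ (q ℚ.+ 1ℚ) ℚ.* ½^ (suc n)
  in if does (mid ℚ.* mid ℚₚ.≤? q) then mid else √-lower q n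

module SqrtLemmas where

  open import Data.Rational.Base using (_+_; _*_; _-_; -_; _≤_; _<_) renaming (∣_∣ to abs)
  open Rational

  width : ℚ → ℕ → ℚ
  width q n = (q + 1ℚ) * ½^ n

  sq-mono : ∀ {a b} → 0ℚ ≤ a → a ≤ b → a * a ≤ b * b
  sq-mono 0≤a a≤b = *-mono 0≤a (ℚₚ.≤-trans 0≤a a≤b) a≤b a≤b

  width-suc : ∀ q n → width q (suc n) + width q (suc n) ≡ width q n
  width-suc q n = trans
    (Q.solve 3 (λ a b h → a Q.:* (b Q.:* h) Q.:+ a Q.:* (b Q.:* h) Q.:= a Q.:* b Q.:* h Q.:+ a Q.:* b Q.:* h)
      refl (q + 1ℚ) (½^ n) ½)
    (half+half (width q n))

  0≤width : ∀ {q} n → 0ℚ ≤ q → 0ℚ ≤ width q n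
  0≤width n 0≤q = 0≤* (0≤+ 0≤q (ℚₚ.<⇒≤ (0<recip 0))) (ℚₚ.<⇒≤ (0<½^ n))

  √-lower-spec : ∀ q n → 0ℚ ≤ q → let s = √-lower q n in
                 0ℚ ≤ s × s * s ≤ q × q ≤ (s + width q n) * (s + width q n)
  √-lower-spec q zero 0≤q = ℚₚ.≤-refl , 0≤q , (begin
    q
      ≡⟨ sym (ℚₚ.*-identityʳ q) ⟩
    q * 1ℚ
      ≤⟨ *-mono (ℚₚ.<⇒≤ (0<recip 0)) 0≤q+1 q≤q+1 1≤q+1 ⟩
    (q + 1ℚ) * (q + 1ℚ)
      ≡⟨ cong₂ _*_ (sym w) (sym w) ⟩
    (0ℚ + width q 0) * (0ℚ + width q 0) ∎)
    where
    open ℚₚ.≤-Reasoning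
    w : 0ℚ + width q 0 ≡ q + 1ℚ
    w = trans (ℚₚ.+-identityˡ (width q 0)) (ℚₚ.*-identityʳ (q + 1ℚ))
    q≤q+1 : q ≤ q + 1ℚ
    q≤q+1 = subst (_≤ q + 1ℚ) (ℚₚ.+-identityʳ q) (ℚₚ.+-monoʳ-≤ q (ℚₚ.<⇒≤ (0<recip 0)))
    1≤q+1 : 1ℚ ≤ q + 1ℚ
    1≤q+1 = subst (_≤ q + 1ℚ) (ℚₚ.+-identityˡ 1ℚ) (ℚₚ.+-monoˡ-≤ 1ℚ 0≤q)
    0≤q+1 : 0ℚ ≤ q + 1ℚ
    0≤q+1 = ℚₚ.≤-trans 0≤q q≤q+1
  √-lower-spec q (suc n) 0≤q = step (mid * mid ℚₚ.≤? q) (√-lower-spec q n 0≤q)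
    where
    s = √-lower q n
    w = width q (suc n)
    mid = s + w
    step : (d : Dec (mid * mid ≤ q)) →
           0ℚ ≤ s × s * s ≤ q × q ≤ (s + width q n) * (s + width q n) →
           let s′ = if does d then mid else s in
           0ℚ ≤ s′ × s′ * s′ ≤ q × q ≤ (s′ + w) * (s′ + w)
    step (yes mid²≤q) (0≤s , _ , q≤) =
      0≤+ {s} {w} 0≤s (0≤width (suc n) 0≤q) , mid²≤q ,
      subst (λ t → q ≤ t * t)
        (sym (trans (ℚₚ.+-assoc s w w) (cong (λ t → s + t) (width-suc q n)))) q≤
    step (no ¬mid²≤q) (0≤s , s²≤q , _) = 0≤s , s²≤q , ℚₚ.<⇒≤ (ℚₚ.≰⇒> ¬mid²≤q)

  -- With a ≤ √p, √q ≤ b + w and w ≤ ε/2: a > b + ε would force p - q ≥ (ε/2)².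
  gap : ∀ {a b w ε p q} → 0ℚ < ε → 0ℚ ≤ b → 0ℚ ≤ w → w ≤ ε * ½ →
        a * a ≤ p → q ≤ (b + w) * (b + w) → p - q < ε * ½ * (ε * ½) → a ≤ b + ε
  gap {a} {b} {w} {ε} {p} {q} 0<ε 0≤b 0≤w w≤ a²≤p q≤ p-q< = ℚₚ.≮⇒≥ λ b+ε<a →
    ℚₚ.<-irrefl refl (begin-strict
      p
        ≡⟨ Q.solve 2 (λ p q → p Q.:= (p Q.:- q) Q.:+ q) refl p q ⟩
      (p - q) + q
        <⟨ ℚₚ.+-monoˡ-< q p-q< ⟩
      h * h + q
        ≤⟨ ℚₚ.+-monoʳ-≤ (h * h) (ℚₚ.≤-trans q≤ (sq-mono (0≤+ 0≤b 0≤w) (ℚₚ.+-monoʳ-≤ b w≤))) ⟩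
      h * h + (b + h) * (b + h)
        ≡⟨ sym (ℚₚ.+-identityʳ _) ⟩
      h * h + (b + h) * (b + h) + 0ℚ
        ≤⟨ ℚₚ.+-monoʳ-≤ (h * h + (b + h) * (b + h)) 0≤rest ⟩
      h * h + (b + h) * (b + h) + (b * h + b * h + (h * h + h * h))
        ≡⟨ Q.solve 2 (λ b h → h Q.:* h Q.:+ (b Q.:+ h) Q.:* (b Q.:+ h) Q.:+
               (b Q.:* h Q.:+ b Q.:* h Q.:+ (h Q.:* h Q.:+ h Q.:* h)) Q.:=
               (b Q.:+ (h Q.:+ h)) Q.:* (b Q.:+ (h Q.:+ h))) refl b h ⟩
      (b + (h + h)) * (b + (h + h))
        ≡⟨ cong (λ t → (b + t) * (b + t)) (half+half ε) ⟩
      (b + ε) * (b + ε)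
        ≤⟨ sq-mono (0≤+ 0≤b (ℚₚ.<⇒≤ 0<ε)) (ℚₚ.<⇒≤ b+ε<a) ⟩
      a * a
        ≤⟨ a²≤p ⟩
      p ∎)
    where
    open ℚₚ.≤-Reasoning
    h = ε * ½
    0≤h = ℚₚ.<⇒≤ (0<half 0<ε)
    0≤rest : 0ℚ ≤ b * h + b * h + (h * h + h * h)
    0≤rest = 0≤+ (0≤+ (0≤* 0≤b 0≤h) (0≤* 0≤b 0≤h))
                         (0≤+ (0≤* 0≤h 0≤h) (0≤* 0≤h 0≤h))

  √-cauchy : ∀ {s} → IsCauchy s → (∀ n → 0ℚ ≤ s n) → IsCauchy (λ n → √-lower (s n) n)
  √-cauchy {s} c 0≤s ε 0<ε = given-bound (bounded c)
    where
    η = ε * ½ * (ε * ½)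
    0<η : 0ℚ < η
    0<η = 0<* (0<half 0<ε) (0<half 0<ε)
    η/2<η : η * ½ < η
    η/2<η = subst₂ _<_ (ℚₚ.+-identityʳ (η * ½)) (half+half η) (ℚₚ.+-monoʳ-< (η * ½) (0<half 0<η))
    module _ {B N₁ N₂ N₃} (0<B : 0ℚ < B) (hB : ∀ n → N₁ ℕ.≤ n → abs (s n) ≤ B)
             (w≤ : (B + 1ℚ) * ½^ N₂ ≤ ε * ½)
             (near : ∀ m n → N₃ ℕ.≤ m → N₃ ℕ.≤ n → abs (s m - s n) ≤ η * ½) where
      width≤ : ∀ n → N₁ ℕ.≤ n → N₂ ℕ.≤ n → width (s n) n ≤ ε * ½
      width≤ n n≥₁ n≥₂ = ℚₚ.≤-trans
        (*-mono (ℚₚ.<⇒≤ (0<½^ n)) (ℚₚ.<⇒≤ (0<+ (ℚₚ.<⇒≤ 0<B) (0<recip 0)))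
          (ℚₚ.+-monoˡ-≤ 1ℚ (ℚₚ.≤-trans (p≤abs (s n)) (hB n n≥₁)))
          (subst (λ t → ½^ t ≤ ½^ N₂) (ℕₚ.m∸n+n≡m n≥₂) (½^-anti N₂ (n ℕ.∸ N₂))))
        w≤
      one : ∀ m n → N₁ ℕ.⊔ (N₂ ℕ.⊔ N₃) ℕ.≤ m → N₁ ℕ.⊔ (N₂ ℕ.⊔ N₃) ℕ.≤ n →
            √-lower (s m) m ≤ √-lower (s n) n + ε
      one m n m≥ n≥ =
        let (_ , a²≤ , _)   = √-lower-spec (s m) m (0≤s m)
            (0≤b , _ , ≤b²) = √-lower-spec (s n) n (0≤s n)
            m₂₃ = ℕₚ.m⊔n≤o⇒n≤o N₁ (N₂ ℕ.⊔ N₃) m≥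
            n₂₃ = ℕₚ.m⊔n≤o⇒n≤o N₁ (N₂ ℕ.⊔ N₃) n≥
        in gap {w = width (s n) n} 0<ε 0≤b (0≤width n (0≤s n))
             (width≤ n (ℕₚ.m⊔n≤o⇒m≤o N₁ (N₂ ℕ.⊔ N₃) n≥) (ℕₚ.m⊔n≤o⇒m≤o N₂ N₃ n₂₃))
             a²≤ ≤b²
             (ℚₚ.≤-<-trans
               (ℚₚ.≤-trans (p≤abs (s m - s n))
                 (near m n (ℕₚ.m⊔n≤o⇒n≤o N₂ N₃ m₂₃) (ℕₚ.m⊔n≤o⇒n≤o N₂ N₃ n₂₃)))
               η/2<η)
    given-bound : ∃[ B ] 0ℚ < B × (∃[ N ] (∀ n → N ℕ.≤ n → abs (s n) ≤ B)) →
                  ∃[ N ] (∀ m n → N ℕ.≤ m → N ℕ.≤ n →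
                    abs (√-lower (s m) m - √-lower (s n) n) ≤ ε)
    given-bound (B , 0<B , N₁ , hB) =
      combine (vanish (B + 1ℚ) (0<+ (ℚₚ.<⇒≤ 0<B) (0<recip 0)) (ε * ½) (0<half 0<ε))
              (c (η * ½) (0<half 0<η))
      where
      combine : ∃[ N₂ ] (B + 1ℚ) * ½^ N₂ ≤ ε * ½ →
                ∃[ N₃ ] (∀ m n → N₃ ℕ.≤ m → N₃ ℕ.≤ n → abs (s m - s n) ≤ η * ½) →
                ∃[ N ] (∀ m n → N ℕ.≤ m → N ℕ.≤ n →
                  abs (√-lower (s m) m - √-lower (s n) n) ≤ ε)
      combine (N₂ , w≤) (N₃ , near) = N₁ ℕ.⊔ (N₂ ℕ.⊔ N₃) , λ m n m≥ n≥ →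
        abs-≤ {√-lower (s m) m - √-lower (s n) n} {ε}
          (≤⇒sub {√-lower (s m) m} {√-lower (s n) n} {ε} (one 0<B hB w≤ near m n m≥ n≥))
          (subst (_≤ ε) (sym (neg-sub (√-lower (s m) m) (√-lower (s n) n)))
            (≤⇒sub {√-lower (s n) n} {√-lower (s m) m} {ε} (one 0<B hB w≤ near n m n≥ m≥)))

-- The partial sums of the exponential series form a Cauchy sequence, with a
-- modulus that depends only on a bound M for the argument.
module ExpLemmas where

  open import Data.Rational.Base using (_+_; _*_; _-_; -_; _≤_; _<_) renaming (∣_∣ to abs)
  open Rational

  majorant : ℚ → ℕ → ℚ
  majorant M zero    = 1ℚ
  majorant M (suc k) = recip k * (M * majorant M k)

  0≤majorant : ∀ {M} → 0ℚ ≤ M → ∀ k → 0ℚ ≤ majorant M k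
  0≤majorant 0≤M zero = ℚₚ.<⇒≤ (0<recip 0)
  0≤majorant {M} 0≤M (suc k) = 0≤* {recip k} {M * majorant M k} (ℚₚ.<⇒≤ (0<recip k))
    (0≤* {M} {majorant M k} 0≤M (0≤majorant 0≤M k))

  term-step : ∀ {r x y a b M t} → 0ℚ ≤ r → 0ℚ ≤ M → abs x + abs y ≤ M → abs a + abs b ≤ t →
              abs (r * (x * a - y * b)) + abs (r * (x * b + y * a)) ≤ r * (M * t)
  term-step {r} {x} {y} {a} {b} {M} {t} 0≤r 0≤M xy≤M ab≤t = begin
    abs (r * (x * a - y * b)) + abs (r * (x * b + y * a))
      ≡⟨ cong₂ _+_ (pull (x * a - y * b)) (pull (x * b + y * a)) ⟩
    r * abs (x * a - y * b) + r * abs (x * b + y * a)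
      ≡⟨ sym (ℚₚ.*-distribˡ-+ r (abs (x * a - y * b)) (abs (x * b + y * a))) ⟩
    r * (abs (x * a - y * b) + abs (x * b + y * a))
      ≤⟨ ℚₚ.*-monoˡ-≤-nonNeg r {{ℚ.nonNegative 0≤r}} (ℚₚ.≤-trans
           (ℚₚ.+-mono-≤ {abs (x * a - y * b)} {abs (x * a) + abs (y * b)}
                        {abs (x * b + y * a)} {abs (x * b) + abs (y * a)}
             (ℚₚ.∣p-q∣≤∣p∣+∣q∣ (x * a) (y * b)) (ℚₚ.∣p+q∣≤∣p∣+∣q∣ (x * b) (y * a)))
           (ℚₚ.≤-reflexive expand)) ⟩
    r * ((abs x + abs y) * (abs a + abs b))
      ≤⟨ ℚₚ.*-monoˡ-≤-nonNeg r {{ℚ.nonNegative 0≤r}}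
           (*-mono {abs x + abs y} {M} {abs a + abs b} {t}
             (0≤+ {abs a} {abs b} (ℚₚ.0≤∣p∣ a) (ℚₚ.0≤∣p∣ b)) 0≤M xy≤M ab≤t) ⟩
    r * (M * t) ∎
    where
    open ℚₚ.≤-Reasoning
    pull : ∀ p → abs (r * p) ≡ r * abs p
    pull p = trans (ℚₚ.∣p*q∣≡∣p∣*∣q∣ r p) (cong (_* abs p) (ℚₚ.0≤p⇒∣p∣≡p 0≤r))
    expand : (abs (x * a) + abs (y * b)) + (abs (x * b) + abs (y * a))
             ≡ (abs x + abs y) * (abs a + abs b)
    expand = trans
      (cong₂ _+_ (cong₂ _+_ (ℚₚ.∣p*q∣≡∣p∣*∣q∣ x a) (ℚₚ.∣p*q∣≡∣p∣*∣q∣ y b))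
                 (cong₂ _+_ (ℚₚ.∣p*q∣≡∣p∣*∣q∣ x b) (ℚₚ.∣p*q∣≡∣p∣*∣q∣ y a)))
      (Q.solve 4 (λ x y a b → (x Q.:* a Q.:+ y Q.:* b) Q.:+ (x Q.:* b Q.:+ y Q.:* a) Q.:=
        (x Q.:+ y) Q.:* (a Q.:+ b)) refl (abs x) (abs y) (abs a) (abs b))

  module _ (M : ℚ) (0≤M : 0ℚ ≤ M) where

    private
      t = majorant M
      K : ℕ
      K = proj₁ (archimedean (M + M))

    halves : ∀ k → K ℕ.≤ k → t (suc k) ≤ t k * ½
    halves k K≤k = ℚₚ.≤-trans
      (ℚₚ.≤-reflexive (sym (ℚₚ.*-assoc (recip k) M (t k))))
      (ℚₚ.≤-trans
        (ℚₚ.*-monoʳ-≤-nonNeg (t k) {{ℚ.nonNegative (0≤majorant 0≤M k)}} rM≤½)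
        (ℚₚ.≤-reflexive (ℚₚ.*-comm ½ (t k))))
      where
      M+M≤ : M + M ≤ ι (suc k)
      M+M≤ = ℚₚ.≤-trans (proj₂ (archimedean (M + M))) (ι-mono (ℕₚ.≤-trans K≤k (ℕₚ.n≤1+n k)))
      r½ = recip k * ½
      0≤r½ : 0ℚ ≤ r½
      0≤r½ = 0≤* {recip k} {½} (ℚₚ.<⇒≤ (0<recip k)) (ℚₚ.<⇒≤ 0<½)
      rM≤½ : recip k * M ≤ ½
      rM≤½ = subst₂ _≤_
        (trans (Q.solve 3 (λ r h m → r Q.:* h Q.:* (m Q.:+ m) Q.:= r Q.:* m Q.:* h Q.:+ r Q.:* m Q.:* h)
                 refl (recip k) ½ M) (half+half (recip k * M)))
        (trans (Q.solve 3 (λ r h i → r Q.:* h Q.:* i Q.:= i Q.:* r Q.:* h) refl (recip k) ½ (ι (suc k)))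
          (trans (cong (_* ½) (ι*recip k)) (ℚₚ.*-identityˡ ½)))
        (ℚₚ.*-monoˡ-≤-nonNeg r½ {{ℚ.nonNegative 0≤r½}} M+M≤)

    decay : ∀ i → t (i ℕ.+ K) ≤ t K * ½^ i
    decay zero    = ℚₚ.≤-reflexive (sym (ℚₚ.*-identityʳ (t K)))
    decay (suc i) = ℚₚ.≤-trans (halves (i ℕ.+ K) (ℕₚ.m≤n+m K i))
      (ℚₚ.≤-trans (ℚₚ.*-monoʳ-≤-nonNeg ½ (decay i)) (ℚₚ.≤-reflexive (ℚₚ.*-assoc (t K) (½^ i) ½)))

    Dominated : (ℕ → ℚ) → Set
    Dominated S = ∀ k → abs (S (suc k) - S k) ≤ t k

    tail : ∀ {S} → Dominated S → ∀ n → K ℕ.≤ n → ∀ l →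
           abs (S (l ℕ.+ n) - S n) + (t (l ℕ.+ n) + t (l ℕ.+ n)) ≤ t n + t n
    tail {S} dom n K≤n zero = ℚₚ.≤-reflexive
      (trans (cong (λ u → abs u + (t n + t n)) (ℚₚ.+-inverseʳ (S n))) (ℚₚ.+-identityˡ (t n + t n)))
    tail {S} dom n K≤n (suc l) = begin
      abs (S (suc p) - S n) + (t (suc p) + t (suc p))
        ≤⟨ ℚₚ.+-mono-≤ {abs (S (suc p) - S n)} {t p + abs (S p - S n)}
             {t (suc p) + t (suc p)} {t p}
             (ℚₚ.≤-trans (triangle (S (suc p)) (S p) (S n))
               (ℚₚ.+-monoˡ-≤ (abs (S p - S n)) (dom p)))
             (ℚₚ.≤-trans
               (ℚₚ.+-mono-≤ {t (suc p)} {t p * ½} {t (suc p)} {t p * ½} (halves p K≤p) (halves p K≤p))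
               (ℚₚ.≤-reflexive (half+half (t p)))) ⟩
      t p + abs (S p - S n) + t p
        ≡⟨ Q.solve 2 (λ u v → u Q.:+ v Q.:+ u Q.:= v Q.:+ (u Q.:+ u)) refl (t p) (abs (S p - S n)) ⟩
      abs (S p - S n) + (t p + t p)
        ≤⟨ tail {S} dom n K≤n l ⟩
      t n + t n ∎
      where
      open ℚₚ.≤-Reasoning
      p = l ℕ.+ n
      K≤p : K ℕ.≤ p
      K≤p = ℕₚ.≤-trans K≤n (ℕₚ.m≤n+m n l)

    uniform-cauchy : ∀ ε → 0ℚ < ε →
      ∃[ N ] (∀ S → Dominated S → ∀ m n → N ℕ.≤ m → N ℕ.≤ n → abs (S m - S n) ≤ ε)
    uniform-cauchy ε 0<ε = from (vanish b 0<b (ε * ½) (0<half 0<ε))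
      where
      b = t K + t K + 1ℚ
      0<b : 0ℚ < b
      0<b = 0<+ {t K + t K} {1ℚ} (0≤+ {t K} {t K} (0≤majorant 0≤M K) (0≤majorant 0≤M K)) (0<recip 0)
      from : ∃[ i ] b * ½^ i ≤ ε * ½ →
        ∃[ N ] (∀ S → Dominated S → ∀ m n → N ℕ.≤ m → N ℕ.≤ n → abs (S m - S n) ≤ ε)
      from (i , b½^i≤) = N , λ S dom m n m≥ n≥ →
        ℚₚ.≤-trans (triangle (S m) (S N) (S n))
          (ℚₚ.≤-trans
            (ℚₚ.+-mono-≤ {abs (S m - S N)} {ε * ½} {abs (S N - S n)} {ε * ½}
              (near S dom m m≥)
              (subst (_≤ ε * ½) (abs-sym (S n) (S N)) (near S dom n n≥)))
            (ℚₚ.≤-reflexive (half+half ε)))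
        where
        N = i ℕ.+ K
        2tN≤ : t N + t N ≤ ε * ½
        2tN≤ = begin
          t N + t N                    ≤⟨ ℚₚ.+-mono-≤ {t N} {t K * ½^ i} {t N} {t K * ½^ i} (decay i) (decay i) ⟩
          t K * ½^ i + t K * ½^ i      ≡⟨ sym (ℚₚ.*-distribʳ-+ (½^ i) (t K) (t K)) ⟩
          (t K + t K) * ½^ i           ≤⟨ ℚₚ.*-monoʳ-≤-nonNeg (½^ i) {{ℚ.nonNegative (ℚₚ.<⇒≤ (0<½^ i))}} 2tK≤b ⟩
          b * ½^ i                     ≤⟨ b½^i≤ ⟩
          ε * ½                        ∎
          where
          open ℚₚ.≤-Reasoning
          2tK≤b : t K + t K ≤ b
          2tK≤b = subst (_≤ b) (ℚₚ.+-identityʳ (t K + t K)) (ℚₚ.+-monoʳ-≤ (t K + t K) (ℚₚ.<⇒≤ (0<recip 0)))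
        near : ∀ S → Dominated S → ∀ m → N ℕ.≤ m → abs (S m - S N) ≤ ε * ½
        near S dom m m≥ = subst (λ p → abs (S p - S N) ≤ ε * ½) (ℕₚ.m∸n+n≡m m≥)
          (begin
            d                          ≡⟨ sym (ℚₚ.+-identityʳ d) ⟩
            d + 0ℚ                     ≤⟨ ℚₚ.+-monoʳ-≤ d (0≤+ {t p} {t p} (0≤majorant 0≤M p) (0≤majorant 0≤M p)) ⟩
            d + (t p + t p)            ≤⟨ tail {S} dom N (ℕₚ.m≤n+m K i) l ⟩
            t N + t N                  ≤⟨ 2tN≤ ⟩
            ε * ½                      ∎)
          where
          open ℚₚ.≤-Reasoning
          l = m ℕ.∸ N
          p = l ℕ.+ N
          d = abs (S p - S N)

module RiemannLemmas where

  open import Data.Rational.Base using (_+_; _*_; _-_; -_; _≤_; _<_) renaming (∣_∣ to abs)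
  open Rational

  Σ< : ∀ n → (ℕ → ℚ) → ℚ
  Σ< n h = sum ℚ.+-0-rawMonoid {n} (λ j → h (toℕ j))

  Σ<-cong : ∀ n {h g} → (∀ k → h k ≡ g k) → Σ< n h ≡ Σ< n g
  Σ<-cong zero    eq = refl
  Σ<-cong (suc n) eq = cong₂ _+_ (eq 0) (Σ<-cong n (λ k → eq (suc k)))

  Σ<-++ : ∀ a b h → Σ< (a ℕ.+ b) h ≡ Σ< a h + Σ< b (λ k → h (a ℕ.+ k))
  Σ<-++ zero    b h = sym (ℚₚ.+-identityˡ (Σ< b h))
  Σ<-++ (suc a) b h = trans (cong (λ u → h 0 + u) (Σ<-++ a b (λ k → h (suc k))))
    (sym (ℚₚ.+-assoc (h 0) (Σ< a (λ k → h (suc k))) (Σ< b (λ k → h (suc (a ℕ.+ k))))))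

  Σ<-* : ∀ a b h → Σ< (a ℕ.* b) h ≡ Σ< a (λ j → Σ< b (λ i → h (j ℕ.* b ℕ.+ i)))
  Σ<-* zero    b h = refl
  Σ<-* (suc a) b h = trans (Σ<-++ b (a ℕ.* b) h)
    (cong (λ u → Σ< b h + u)
      (trans (Σ<-* a b (λ k → h (b ℕ.+ k)))
        (Σ<-cong a (λ j → Σ<-cong b (λ i → cong h (sym (ℕₚ.+-assoc b (j ℕ.* b) i)))))))

  Σ<-const : ∀ n c → Σ< n (λ _ → c) ≡ ι n * c
  Σ<-const zero    c = sym (ℚₚ.*-zeroˡ c)
  Σ<-const (suc n) c = trans (cong (λ u → c + u) (Σ<-const n c))
    (trans (cong (λ u → u + ι n * c) (sym (ℚₚ.*-identityˡ c)))
      (trans (sym (ℚₚ.*-distribʳ-+ c 1ℚ (ι n))) (cong (_* c) (sym (ι-+ 1 n)))))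

  Σ<-scale : ∀ n c h → Σ< n (λ k → c * h k) ≡ c * Σ< n h
  Σ<-scale zero    c h = sym (ℚₚ.*-zeroʳ c)
  Σ<-scale (suc n) c h = trans (cong (λ u → c * h 0 + u) (Σ<-scale n c (λ k → h (suc k))))
    (sym (ℚₚ.*-distribˡ-+ c (h 0) (Σ< n (λ k → h (suc k)))))

  Σ<-close : ∀ n h g c → (∀ k → k ℕ.< n → abs (h k - g k) ≤ c) → abs (Σ< n h - Σ< n g) ≤ ι n * c
  Σ<-close zero    h g c _ = ℚₚ.≤-reflexive (sym (ℚₚ.*-zeroˡ c))
  Σ<-close (suc n) h g c close = begin
    abs (h 0 + H - (g 0 + G))
      ≡⟨ cong abs (Q.solve 4 (λ a b c d → a Q.:+ b Q.:- (c Q.:+ d) Q.:= (a Q.:- c) Q.:+ (b Q.:- d))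
           refl (h 0) H (g 0) G) ⟩
    abs ((h 0 - g 0) + (H - G))
      ≤⟨ ℚₚ.∣p+q∣≤∣p∣+∣q∣ (h 0 - g 0) (H - G) ⟩
    abs (h 0 - g 0) + abs (H - G)
      ≤⟨ ℚₚ.+-mono-≤ {abs (h 0 - g 0)} {c} {abs (H - G)} {ι n * c} (close 0 (ℕ.s≤s ℕ.z≤n))
           (Σ<-close n (λ k → h (suc k)) (λ k → g (suc k)) c (λ k k<n → close (suc k) (ℕ.s≤s k<n))) ⟩
    c + ι n * c
      ≡⟨ cong (λ u → u + ι n * c) (sym (ℚₚ.*-identityˡ c)) ⟩
    1ℚ * c + ι n * c
      ≡⟨ sym (ℚₚ.*-distribʳ-+ c 1ℚ (ι n)) ⟩
    (1ℚ + ι n) * c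
      ≡⟨ cong (_* c) (sym (ι-+ 1 n)) ⟩
    ι (suc n) * c ∎
    where
    open ℚₚ.≤-Reasoning
    H = Σ< n (λ k → h (suc k))
    G = Σ< n (λ k → g (suc k))

  -- (1/N) Σ_{j<N} f(j/N) with N = n + 1
  leftSum : (ℚ → ℚ) → ℕ → ℚ
  leftSum f n = recip n * Σ< (suc n) (λ j → f (ι j * recip n))

  recip-* : ∀ n m → recip (m ℕ.+ n ℕ.* suc m) ≡ recip n * recip m
  recip-* n m = begin
    r                                    ≡⟨ sym (ℚₚ.*-identityʳ r) ⟩
    r * 1ℚ                               ≡⟨ cong (r *_) (sym one) ⟩
    r * (ι N * (recip n * recip m))      ≡⟨ sym (ℚₚ.*-assoc r (ι N) (recip n * recip m)) ⟩
    r * ι N * (recip n * recip m)        ≡⟨ cong (_* (recip n * recip m)) (trans (ℚₚ.*-comm r (ι N)) (ι*recip (m ℕ.+ n ℕ.* suc m))) ⟩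
    1ℚ * (recip n * recip m)             ≡⟨ ℚₚ.*-identityˡ (recip n * recip m) ⟩
    recip n * recip m                    ∎
    where
    open ≡-Reasoning
    N = suc n ℕ.* suc m
    r = recip (m ℕ.+ n ℕ.* suc m)
    one : ι N * (recip n * recip m) ≡ 1ℚ
    one = trans (cong (_* (recip n * recip m)) (ι-* (suc n) (suc m)))
      (trans (Q.solve 4 (λ a b c d → a Q.:* b Q.:* (c Q.:* d) Q.:= a Q.:* c Q.:* (b Q.:* d)) refl
               (ι (suc n)) (ι (suc m)) (recip n) (recip m))
        (trans (cong₂ _*_ (ι*recip n) (ι*recip m)) (ℚₚ.*-identityˡ 1ℚ)))

  module _ (f : ℚ → ℚ) (L : ℚ) (0≤L : 0ℚ ≤ L)
           (lip : ∀ s t → 0ℚ ≤ s → 0ℚ ≤ t → abs (f s - f t) ≤ L * abs (s - t)) where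

    refine : ∀ n m → abs (leftSum f (m ℕ.+ n ℕ.* suc m) - leftSum f n) ≤ L * recip n
    refine n m = begin
      abs (leftSum f n′ - leftSum f n)
        ≡⟨ cong abs (cong₂ _-_ fine coarse) ⟩
      abs (recip n′ * A - recip n′ * B)
        ≡⟨ cong abs (Q.solve 3 (λ r a b → r Q.:* a Q.:- r Q.:* b Q.:= r Q.:* (a Q.:- b)) refl (recip n′) A B) ⟩
      abs (recip n′ * (A - B))
        ≡⟨ trans (ℚₚ.∣p*q∣≡∣p∣*∣q∣ (recip n′) (A - B))
             (cong (_* abs (A - B)) (ℚₚ.0≤p⇒∣p∣≡p (0≤recip n′))) ⟩
      recip n′ * abs (A - B)
        ≤⟨ ℚₚ.*-monoˡ-≤-nonNeg (recip n′) {{ℚ.nonNegative (0≤recip n′)}}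
             (Σ<-close (suc n) (λ j → Σ< (suc m) (λ i → f (u j i)))
                 (λ j → Σ< (suc m) (λ i → f (ι j * recip n))) (ι (suc m) * c) (λ j _ →
               Σ<-close (suc m) (λ i → f (u j i)) (λ i → f (ι j * recip n)) c (near j))) ⟩
      recip n′ * (ι (suc n) * (ι (suc m) * c))
        ≡⟨ cong (_* (ι (suc n) * (ι (suc m) * c))) (recip-* n m) ⟩
      recip n * recip m * (ι (suc n) * (ι (suc m) * c))
        ≡⟨ Q.solve 5 (λ a b x y c → a Q.:* b Q.:* (x Q.:* (y Q.:* c)) Q.:= x Q.:* a Q.:* (y Q.:* b) Q.:* c)
             refl (recip n) (recip m) (ι (suc n)) (ι (suc m)) c ⟩
      ι (suc n) * recip n * (ι (suc m) * recip m) * c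
        ≡⟨ cong (_* c) (trans (cong₂ _*_ (ι*recip n) (ι*recip m)) (ℚₚ.*-identityˡ 1ℚ)) ⟩
      1ℚ * c
        ≡⟨ ℚₚ.*-identityˡ c ⟩
      c ∎
      where
      open ℚₚ.≤-Reasoning
      n′ = m ℕ.+ n ℕ.* suc m
      c = L * recip n
      0≤recip : ∀ k → 0ℚ ≤ recip k
      0≤recip k = ℚₚ.<⇒≤ (0<recip k)
      u : ℕ → ℕ → ℚ
      u j i = ι (j ℕ.* suc m ℕ.+ i) * recip n′
      A = Σ< (suc n) (λ j → Σ< (suc m) (λ i → f (u j i)))
      B = Σ< (suc n) (λ j → Σ< (suc m) (λ i → f (ι j * recip n)))
      fine : leftSum f n′ ≡ recip n′ * A
      fine = cong (recip n′ *_) (Σ<-* (suc n) (suc m) (λ k → f (ι k * recip n′)))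
      coarse : leftSum f n ≡ recip n′ * B
      coarse = sym (trans
        (cong₂ _*_ (recip-* n m)
          (trans (Σ<-cong (suc n) (λ j → Σ<-const (suc m) (f (ι j * recip n))))
                 (Σ<-scale (suc n) (ι (suc m)) (λ j → f (ι j * recip n)))))
        (trans
          (Q.solve 4 (λ a b x s → a Q.:* b Q.:* (x Q.:* s) Q.:= x Q.:* b Q.:* (a Q.:* s)) refl
            (recip n) (recip m) (ι (suc m)) F)
          (trans (cong (_* (recip n * F)) (ι*recip m)) (ℚₚ.*-identityˡ (recip n * F)))))
        where
        F = Σ< (suc n) (λ j → f (ι j * recip n))
      u-split : ∀ j i → u j i ≡ ι j * recip n + ι i * recip n′
      u-split j i = trans (cong (_* recip n′) (trans (ι-+ (j ℕ.* suc m) i) (cong (λ v → v + ι i) (ι-* j (suc m)))))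
        (trans (ℚₚ.*-distribʳ-+ (recip n′) (ι j * ι (suc m)) (ι i))
          (cong (λ v → v + ι i * recip n′)
            (trans (cong (ι j * ι (suc m) *_) (recip-* n m))
              (trans (Q.solve 4 (λ j x a b → j Q.:* x Q.:* (a Q.:* b) Q.:= j Q.:* a Q.:* (x Q.:* b)) refl
                       (ι j) (ι (suc m)) (recip n) (recip m))
                (trans (cong (ι j * recip n *_) (ι*recip m)) (ℚₚ.*-identityʳ (ι j * recip n)))))))
      offset : ∀ j i → u j i - ι j * recip n ≡ ι i * recip n′
      offset j i = trans (cong (λ v → v - ι j * recip n) (u-split j i))
        (Q.solve 2 (λ a b → a Q.:+ b Q.:- a Q.:= b) refl (ι j * recip n) (ι i * recip n′))
      offset≤ : ∀ i → i ℕ.< suc m → ι i * recip n′ ≤ recip n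
      offset≤ i i<M = ℚₚ.≤-trans
        (ℚₚ.*-monoʳ-≤-nonNeg (recip n′) {{ℚ.nonNegative (0≤recip n′)}} (ι-mono (ℕₚ.<⇒≤ i<M)))
        (ℚₚ.≤-reflexive (trans (cong (ι (suc m) *_) (recip-* n m))
          (trans (Q.solve 3 (λ x a b → x Q.:* (a Q.:* b) Q.:= x Q.:* b Q.:* a) refl (ι (suc m)) (recip n) (recip m))
            (trans (cong (_* recip n) (ι*recip m)) (ℚₚ.*-identityˡ (recip n))))))
      0≤ι* : ∀ k l → 0ℚ ≤ ι k * recip l
      0≤ι* k l = 0≤* {ι k} {recip l} (0≤ι k) (0≤recip l)
      near : ∀ j i → i ℕ.< suc m → abs (f (u j i) - f (ι j * recip n)) ≤ c
      near j i i<M = ℚₚ.≤-trans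
        (lip (u j i) (ι j * recip n) (0≤ι* (j ℕ.* suc m ℕ.+ i) n′) (0≤ι* j n))
        (ℚₚ.*-monoˡ-≤-nonNeg L {{ℚ.nonNegative 0≤L}}
          (subst (_≤ recip n)
            (sym (trans (cong abs (offset j i)) (ℚₚ.0≤p⇒∣p∣≡p (0≤ι* i n′)))) (offset≤ i i<M)))

    leftSum-cauchy : IsCauchy (leftSum f)
    leftSum-cauchy ε 0<ε = from (divide (L + 1ℚ) (0<+ {L} {1ℚ} 0≤L (0<recip 0)) (ε * ½) (0<half 0<ε))
      where
      from : ∃[ δ ] 0ℚ < δ × (L + 1ℚ) * δ ≡ ε * ½ →
             ∃[ N ] (∀ m n → N ℕ.≤ m → N ℕ.≤ n → abs (leftSum f m - leftSum f n) ≤ ε)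
      from (δ , 0<δ , Lδ≡) = N , λ m n m≥ n≥ →
        ℚₚ.≤-trans (triangle (leftSum f m) (leftSum f (n ℕ.+ m ℕ.* suc n)) (leftSum f n))
          (ℚₚ.≤-trans
            (ℚₚ.+-mono-≤ {abs (leftSum f m - leftSum f (n ℕ.+ m ℕ.* suc n))} {ε * ½}
                         {abs (leftSum f (n ℕ.+ m ℕ.* suc n) - leftSum f n)} {ε * ½}
              (subst (_≤ ε * ½) (abs-sym (leftSum f (n ℕ.+ m ℕ.* suc n)) (leftSum f m))
                (ℚₚ.≤-trans (refine m n) (small m m≥)))
              (subst (λ k → abs (leftSum f k - leftSum f n) ≤ ε * ½) (ℕₚ.suc-injective (ℕₚ.*-comm (suc n) (suc m)))
                (ℚₚ.≤-trans (refine n m) (small n n≥))))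
            (ℚₚ.≤-reflexive (half+half ε)))
        where
        N = proj₁ (recip≤ δ 0<δ)
        small : ∀ n → N ℕ.≤ n → L * recip n ≤ ε * ½
        small n n≥ = ℚₚ.≤-trans
          (*-mono {L} {L + 1ℚ} {recip n} {δ} (ℚₚ.<⇒≤ (0<recip n))
            (ℚₚ.<⇒≤ (0<+ {L} {1ℚ} 0≤L (0<recip 0)))
            (subst (_≤ L + 1ℚ) (ℚₚ.+-identityʳ L) (ℚₚ.+-monoʳ-≤ L (ℚₚ.<⇒≤ (0<recip 0))))
            (ℚₚ.≤-trans (recip-anti n≥) (proj₂ (recip≤ δ 0<δ))))
          (ℚₚ.≤-reflexive Lδ≡)

  0≤sq : ∀ q → 0ℚ ≤ q * q
  0≤sq q with ℚₚ.≤-total 0ℚ q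
  ... | inj₁ 0≤q = 0≤* {q} {q} 0≤q 0≤q
  ... | inj₂ q≤0 = subst (0ℚ ≤_) (Q.solve 1 (λ q → (Q.:- q) Q.:* (Q.:- q) Q.:= q Q.:* q) refl q)
    (0≤* { - q} { - q} (ℚₚ.neg-antimono-≤ q≤0) (ℚₚ.neg-antimono-≤ q≤0))

  1≤1+sq : ∀ q → 1ℚ ≤ 1ℚ + q * q
  1≤1+sq q = subst (_≤ 1ℚ + q * q) (ℚₚ.+-identityʳ 1ℚ) (ℚₚ.+-monoʳ-≤ 1ℚ (0≤sq q))

  0<1+sq : ∀ q → 0ℚ < 1ℚ + q * q
  0<1+sq q = ℚₚ.<-≤-trans (0<recip 0) (1≤1+sq q)

  q≤1+sq : ∀ q → q ≤ 1ℚ + q * q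
  q≤1+sq q with ℚₚ.≤-total q 1ℚ
  ... | inj₁ q≤1 = ℚₚ.≤-trans q≤1 (1≤1+sq q)
  ... | inj₂ 1≤q = ℚₚ.≤-trans
    (subst (_≤ q * q) (ℚₚ.*-identityʳ q)
      (ℚₚ.*-monoˡ-≤-nonNeg q {{ℚ.nonNegative (ℚₚ.≤-trans (ℚₚ.<⇒≤ (0<recip 0)) 1≤q)}} 1≤q))
    (subst (_≤ 1ℚ + q * q) (ℚₚ.+-identityˡ (q * q)) (ℚₚ.+-monoˡ-≤ (q * q) (ℚₚ.<⇒≤ (0<recip 0))))

  arctan′ : ℚ → ℚ
  arctan′ q = (ℚ.1/ (1ℚ + q * q)) {{ℚ.>-nonZero (0<1+sq q)}}

  arctan′-spec : ∀ q → arctan′ q * (1ℚ + q * q) ≡ 1ℚ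
  arctan′-spec q = ℚₚ.*-inverseˡ (1ℚ + q * q) {{ℚ.>-nonZero (0<1+sq q)}}

  0≤arctan′ : ∀ q → 0ℚ ≤ arctan′ q
  0≤arctan′ q = ℚₚ.≮⇒≥ λ a<0 → ℚₚ.<-irrefl refl (ℚₚ.<-trans (0<recip 0)
    (subst₂ _<_ (arctan′-spec q) (ℚₚ.*-zeroˡ (1ℚ + q * q))
      (ℚₚ.*-monoˡ-<-pos (1ℚ + q * q) {{ℚ.positive (0<1+sq q)}} a<0)))

  arctan′*≤1 : ∀ q r → r ≤ 1ℚ + q * q → arctan′ q * r ≤ 1ℚ
  arctan′*≤1 q r r≤ = subst (arctan′ q * r ≤_) (arctan′-spec q)
    (ℚₚ.*-monoˡ-≤-nonNeg (arctan′ q) {{ℚ.nonNegative (0≤arctan′ q)}} r≤)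

  arctan′-lip : ∀ s t → 0ℚ ≤ s → 0ℚ ≤ t → abs (arctan′ s - arctan′ t) ≤ ι 2 * abs (s - t)
  arctan′-lip s t 0≤s 0≤t = go (arctan′ s) (arctan′ t) (arctan′-spec s) (arctan′-spec t)
    (0≤arctan′ s) (0≤arctan′ t)
    (arctan′*≤1 s s (q≤1+sq s)) (arctan′*≤1 t t (q≤1+sq t))
    (arctan′≤1 s) (arctan′≤1 t)
    where
    arctan′≤1 : ∀ q → arctan′ q ≤ 1ℚ
    arctan′≤1 q = subst (_≤ 1ℚ) (ℚₚ.*-identityʳ (arctan′ q)) (arctan′*≤1 q 1ℚ (1≤1+sq q))
    go : ∀ a b → a * (1ℚ + s * s) ≡ 1ℚ → b * (1ℚ + t * t) ≡ 1ℚ → 0ℚ ≤ a → 0ℚ ≤ b →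
         a * s ≤ 1ℚ → b * t ≤ 1ℚ → a ≤ 1ℚ → b ≤ 1ℚ → abs (a - b) ≤ ι 2 * abs (s - t)
    go a b as bt 0≤a 0≤b as≤1 bt≤1 a≤1 b≤1 = begin
      abs (a - b)
        ≡⟨ cong abs diff ⟩
      abs (k * (t - s))
        ≡⟨ trans (ℚₚ.∣p*q∣≡∣p∣*∣q∣ k (t - s)) (cong₂ _*_ (ℚₚ.0≤p⇒∣p∣≡p 0≤k) (abs-sym t s)) ⟩
      k * abs (s - t)
        ≤⟨ ℚₚ.*-monoʳ-≤-nonNeg (abs (s - t)) {{ℚₚ.∣-∣-nonNeg (s - t)}} k≤2 ⟩
      ι 2 * abs (s - t) ∎
      where
      open ℚₚ.≤-Reasoning
      k = b * (a * s) + a * (b * t)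
      0≤k : 0ℚ ≤ k
      0≤k = 0≤+ {b * (a * s)} {a * (b * t)}
        (0≤* {b} {a * s} 0≤b (0≤* {a} {s} 0≤a 0≤s)) (0≤* {a} {b * t} 0≤a (0≤* {b} {t} 0≤b 0≤t))
      k≤2 : k ≤ ι 2
      k≤2 = ℚₚ.+-mono-≤ {b * (a * s)} {1ℚ} {a * (b * t)} {1ℚ} (prod≤1 0≤b 0≤a 0≤s b≤1 as≤1) (prod≤1 0≤a 0≤b 0≤t a≤1 bt≤1)
        where
        prod≤1 : ∀ {x y z} → 0ℚ ≤ x → 0ℚ ≤ y → 0ℚ ≤ z → x ≤ 1ℚ → y * z ≤ 1ℚ → x * (y * z) ≤ 1ℚ
        prod≤1 {x} {y} {z} 0≤x 0≤y 0≤z x≤1 yz≤1 = subst (x * (y * z) ≤_) (ℚₚ.*-identityʳ 1ℚ)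
          (*-mono {x} {1ℚ} {y * z} {1ℚ} (0≤* {y} {z} 0≤y 0≤z) (ℚₚ.<⇒≤ (0<recip 0)) x≤1 yz≤1)
      diff : a - b ≡ k * (t - s)
      diff = begin-equality
        a - b
          ≡⟨ cong₂ _-_ (sym (ℚₚ.*-identityʳ a)) (sym (ℚₚ.*-identityʳ b)) ⟩
        a * 1ℚ - b * 1ℚ
          ≡⟨ cong₂ (λ x y → a * x - b * y) (sym bt) (sym as) ⟩
        a * (b * (1ℚ + t * t)) - b * (a * (1ℚ + s * s))
          ≡⟨ Q.solve 5 (λ a b s t o →
               a Q.:* (b Q.:* (o Q.:+ t Q.:* t)) Q.:- b Q.:* (a Q.:* (o Q.:+ s Q.:* s)) Q.:=
               (b Q.:* (a Q.:* s) Q.:+ a Q.:* (b Q.:* t)) Q.:* (t Q.:- s)) refl a b s t 1ℚ ⟩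
        k * (t - s) ∎

record ℝ : Set where
  constructor mkℝ
  field
    seq    : ℕ → ℚ
    cauchy : IsCauchy seq
open ℝ public

infix 4 _≈_ _≤_ _<_

_≈_ : ℝ → ℝ → Set
x ≈ y = ∀ ε → 0ℚ ℚ.< ε → ∃[ N ] (∀ n → N ℕ.≤ n → ℚ.∣ seq x n ℚ.- seq y n ∣ ℚ.≤ ε)

_≤_ : ℝ → ℝ → Set
x ≤ y = ∀ ε → 0ℚ ℚ.< ε → ∃[ N ] (∀ n → N ℕ.≤ n → seq x n ℚ.≤ seq y n ℚ.+ ε)

_<_ : ℝ → ℝ → Set
x < y = ∃[ ε ] 0ℚ ℚ.< ε × (∃[ N ] (∀ n → N ℕ.≤ n → seq x n ℚ.+ ε ℚ.≤ seq y n))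

infixl 6 _+_ _-_
infixl 7 _*_

fromℚ : ℚ → ℝ
fromℚ q = mkℝ (λ _ → q) (const-cauchy q)

fromℕ : ℕ → ℝ
fromℕ n = fromℚ (ι n)

0ℝ 1ℝ : ℝ
0ℝ = fromℚ 0ℚ
1ℝ = fromℚ 1ℚ

neg : ℝ → ℝ
neg x = mkℝ (λ n → ℚ.- seq x n) (neg-cauchy {seq x} (cauchy x))

_+_ _-_ _*_ : ℝ → ℝ → ℝ
x + y = mkℝ (λ n → seq x n ℚ.+ seq y n) (+-cauchy {seq x} {seq y} (cauchy x) (cauchy y))
x * y = mkℝ (λ n → seq x n ℚ.* seq y n) (*-cauchy {seq x} {seq y} (cauchy x) (cauchy y))

x - y = x + neg y

abs : ℝ → ℝ
abs x = mkℝ (λ n → ℚ.∣ seq x n ∣) (abs-cauchy {seq x} (cauchy x))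

∑ : ∀ {n} → (Fin n → ℝ) → ℝ
∑ = sum record { Carrier = ℝ ; _≈_ = _≈_ ; _∙_ = _+_ ; ε = 0ℝ }

IsCauchyℝ : (ℕ → ℝ) → Set
IsCauchyℝ X = ∀ ε → 0ℚ ℚ.< ε → ∃[ N ] (∀ m n → N ℕ.≤ m → N ℕ.≤ n → abs (X m - X n) ≤ fromℚ ε)

-- The n-th approximation to the limit is a term of X n within 1/(n+1) of all
-- later terms of X n.
module Limit (X : ℕ → ℝ) (X-cauchy : IsCauchyℝ X) where

  open Rational using (recip≤; 0<recip; 0<half; half+half; triangle; recip-anti; abs-sym)

  settle : ∀ n → ∃[ p ] (∀ i j → p ℕ.≤ i → p ℕ.≤ j → ℚ.∣ seq (X n) i ℚ.- seq (X n) j ∣ ℚ.≤ recip n)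
  settle n = cauchy (X n) (recip n) (0<recip n)

  limSeq : ℕ → ℚ
  limSeq n = seq (X n) (proj₁ (settle n))

  limSeq-cauchy : IsCauchy limSeq
  limSeq-cauchy ε 0<ε
    with recip≤ (ε ℚ.* ½ ℚ.* ½) (0<half (0<half 0<ε)) | X-cauchy (ε ℚ.* ½ ℚ.* ½) (0<half (0<half 0<ε))
  ... | K , K≤ | N , h = K ℕ.⊔ N , bound
    where
    δ = ε ℚ.* ½ ℚ.* ½
    bound : ∀ m n → K ℕ.⊔ N ℕ.≤ m → K ℕ.⊔ N ℕ.≤ n → ℚ.∣ limSeq m ℚ.- limSeq n ∣ ℚ.≤ ε
    bound m n m≥ n≥ with h m n (ℕₚ.m⊔n≤o⇒n≤o K N m≥) (ℕₚ.m⊔n≤o⇒n≤o K N n≥) δ (0<half (0<half 0<ε))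
    ... | J , g = begin
      ℚ.∣ limSeq m ℚ.- limSeq n ∣
        ≤⟨ triangle (limSeq m) (seq (X m) j) (limSeq n) ⟩
      ℚ.∣ limSeq m ℚ.- seq (X m) j ∣ ℚ.+ ℚ.∣ seq (X m) j ℚ.- limSeq n ∣
        ≤⟨ ℚₚ.+-monoʳ-≤ ℚ.∣ limSeq m ℚ.- seq (X m) j ∣ (triangle (seq (X m) j) (seq (X n) j) (limSeq n)) ⟩
      ℚ.∣ limSeq m ℚ.- seq (X m) j ∣ ℚ.+
        (ℚ.∣ seq (X m) j ℚ.- seq (X n) j ∣ ℚ.+ ℚ.∣ seq (X n) j ℚ.- limSeq n ∣)
        ≤⟨ ℚₚ.+-mono-≤ near-m (ℚₚ.+-mono-≤ (g j J≤j) near-n) ⟩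
      δ ℚ.+ ((δ ℚ.+ δ) ℚ.+ δ)
        ≡⟨ Q.solve 1 (λ d → d Q.:+ ((d Q.:+ d) Q.:+ d) Q.:= (d Q.:+ d) Q.:+ (d Q.:+ d)) refl δ ⟩
      (δ ℚ.+ δ) ℚ.+ (δ ℚ.+ δ)
        ≡⟨ cong₂ ℚ._+_ (half+half (ε ℚ.* ½)) (half+half (ε ℚ.* ½)) ⟩
      ε ℚ.* ½ ℚ.+ ε ℚ.* ½
        ≡⟨ half+half ε ⟩
      ε ∎
      where
      open ℚₚ.≤-Reasoning
      pm = proj₁ (settle m)
      pn = proj₁ (settle n)
      j = J ℕ.⊔ (pm ℕ.⊔ pn)
      J≤j = ℕₚ.m≤m⊔n J (pm ℕ.⊔ pn)
      pm≤j : pm ℕ.≤ j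
      pm≤j = ℕₚ.≤-trans (ℕₚ.m≤m⊔n pm pn) (ℕₚ.m≤n⊔m J (pm ℕ.⊔ pn))
      pn≤j : pn ℕ.≤ j
      pn≤j = ℕₚ.≤-trans (ℕₚ.m≤n⊔m pm pn) (ℕₚ.m≤n⊔m J (pm ℕ.⊔ pn))
      near-m : ℚ.∣ limSeq m ℚ.- seq (X m) j ∣ ℚ.≤ δ
      near-m = ℚₚ.≤-trans (proj₂ (settle m) pm j ℕₚ.≤-refl pm≤j)
        (ℚₚ.≤-trans (recip-anti (ℕₚ.m⊔n≤o⇒m≤o K N m≥)) K≤)
      near-n : ℚ.∣ seq (X n) j ℚ.- limSeq n ∣ ℚ.≤ δ
      near-n = ℚₚ.≤-trans (proj₂ (settle n) j pn pn≤j ℕₚ.≤-refl)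
        (ℚₚ.≤-trans (recip-anti (ℕₚ.m⊔n≤o⇒m≤o K N n≥)) K≤)

lim : (X : ℕ → ℝ) → IsCauchyℝ X → ℝ
lim X c = mkℝ (Limit.limSeq X c) (Limit.limSeq-cauchy X c)

-- √∣x∣; only used for x ≥ 0. The absolute value keeps the approximations of
-- such an x nonnegative.
√ : ℝ → ℝ
√ x = mkℝ (λ n → √-lower ℚ.∣ seq x n ∣ n)
          (SqrtLemmas.√-cauchy {seq (abs x)} (cauchy (abs x)) (λ n → ℚₚ.0≤∣p∣ (seq x n)))

infix  5 _+i_
infixl 6 _+ℂ_
infixl 7 _*ℂ_

record ℂ : Set where
  constructor _+i_
  field
    re : ℝ
    im : ℝ
open ℂ public

fromℝ : ℝ → ℂ
fromℝ x = x +i 0ℝ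

0ℂ 1ℂ : ℂ
0ℂ = fromℝ 0ℝ
1ℂ = fromℝ 1ℝ

_+ℂ_ _*ℂ_ : ℂ → ℂ → ℂ
z +ℂ w = (re z + re w) +i (im z + im w)
z *ℂ w = (re z * re w - im z * im w) +i (re z * im w + im z * re w)

_·ℂ_ : ℝ → ℂ → ℂ
r ·ℂ z = (r * re z) +i (r * im z)

∣_∣ℂ : ℂ → ℝ
∣ z ∣ℂ = √ (re z * re z + im z * im z)

∑ℂ : ∀ {n} → (Fin n → ℂ) → ℂ
∑ℂ f = ∑ (λ k → re (f k)) +i ∑ (λ k → im (f k))

-- z^k / k!
expTerm : ℂ → ℕ → ℂ
expTerm z zero    = 1ℂ
expTerm z (suc k) = fromℚ (recip k) ·ℂ (z *ℂ expTerm z k)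

expPartial : ℂ → ℕ → ℂ
expPartial z zero    = 0ℂ
expPartial z (suc k) = expPartial z k +ℂ expTerm z k

module ExpConvergence (z : ℂ) where

  open Rational using (0<recip; 0≤+)
  open ExpLemmas

  private
    bound-re = bounded {seq (re z)} (cauchy (re z))
    bound-im = bounded {seq (im z)} (cauchy (im z))
    A  = proj₁ bound-re
    B  = proj₁ bound-im
    Nʳ = proj₁ (proj₂ (proj₂ bound-re))
    Nⁱ = proj₁ (proj₂ (proj₂ bound-im))
    M = A ℚ.+ B
    J = Nʳ ℕ.⊔ Nⁱ

    0≤M : 0ℚ ℚ.≤ M
    0≤M = 0≤+ {A} {B} (ℚₚ.<⇒≤ (proj₁ (proj₂ bound-re))) (ℚₚ.<⇒≤ (proj₁ (proj₂ bound-im)))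

    a b : ℕ → ℕ → ℚ
    a k = seq (re (expTerm z k))
    b k = seq (im (expTerm z k))

    z≤M : ∀ j → J ℕ.≤ j → ℚ.∣ seq (re z) j ∣ ℚ.+ ℚ.∣ seq (im z) j ∣ ℚ.≤ M
    z≤M j J≤j = ℚₚ.+-mono-≤ {ℚ.∣ seq (re z) j ∣} {A} {ℚ.∣ seq (im z) j ∣} {B}
      (proj₂ (proj₂ (proj₂ bound-re)) j (ℕₚ.m⊔n≤o⇒m≤o Nʳ Nⁱ J≤j))
      (proj₂ (proj₂ (proj₂ bound-im)) j (ℕₚ.m⊔n≤o⇒n≤o Nʳ Nⁱ J≤j))

    term≤ : ∀ j → J ℕ.≤ j → ∀ k → ℚ.∣ a k j ∣ ℚ.+ ℚ.∣ b k j ∣ ℚ.≤ majorant M k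
    term≤ j J≤j zero    = ℚₚ.≤-refl
    term≤ j J≤j (suc k) = term-step {recip k} {seq (re z) j} {seq (im z) j} {a k j} {b k j} {M} {majorant M k}
      (ℚₚ.<⇒≤ (0<recip k)) 0≤M (z≤M j J≤j) (term≤ j J≤j k)

    drop-left : ∀ p q → ℚ.∣ p ℚ.+ q ℚ.- p ∣ ≡ ℚ.∣ q ∣
    drop-left p q = cong ℚ.∣_∣ (Q.solve 2 (λ p q → p Q.:+ q Q.:- p Q.:= q) refl p q)

    dominated-re : ∀ j → J ℕ.≤ j → Dominated M 0≤M (λ k → seq (re (expPartial z k)) j)
    dominated-re j J≤j k = ℚₚ.≤-trans
      (ℚₚ.≤-reflexive (drop-left (seq (re (expPartial z k)) j) (a k j)))
      (ℚₚ.≤-trans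
        (subst (ℚ._≤ ℚ.∣ a k j ∣ ℚ.+ ℚ.∣ b k j ∣) (ℚₚ.+-identityʳ ℚ.∣ a k j ∣)
          (ℚₚ.+-monoʳ-≤ ℚ.∣ a k j ∣ (ℚₚ.0≤∣p∣ (b k j))))
        (term≤ j J≤j k))

    dominated-im : ∀ j → J ℕ.≤ j → Dominated M 0≤M (λ k → seq (im (expPartial z k)) j)
    dominated-im j J≤j k = ℚₚ.≤-trans
      (ℚₚ.≤-reflexive (drop-left (seq (im (expPartial z k)) j) (b k j)))
      (ℚₚ.≤-trans
        (subst (ℚ._≤ ℚ.∣ a k j ∣ ℚ.+ ℚ.∣ b k j ∣) (ℚₚ.+-identityˡ ℚ.∣ b k j ∣)
          (ℚₚ.+-monoˡ-≤ ℚ.∣ b k j ∣ (ℚₚ.0≤∣p∣ (a k j))))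
        (term≤ j J≤j k))

    from-dominated : (X : ℕ → ℝ) → (∀ j → J ℕ.≤ j → Dominated M 0≤M (λ k → seq (X k) j)) → IsCauchyℝ X
    from-dominated X dom ε 0<ε = N , λ m n m≥ n≥ δ 0<δ → J , λ j J≤j → ℚₚ.≤-trans
      (close (λ k → seq (X k) j) (dom j J≤j) m n m≥ n≥)
      (subst (ℚ._≤ ε ℚ.+ δ) (ℚₚ.+-identityʳ ε) (ℚₚ.+-monoʳ-≤ ε (ℚₚ.<⇒≤ 0<δ)))
      where
      N = proj₁ (uniform-cauchy M 0≤M ε 0<ε)
      close = proj₂ (uniform-cauchy M 0≤M ε 0<ε)

  re-cauchy : IsCauchyℝ (λ n → re (expPartial z n))
  re-cauchy = from-dominated (λ n → re (expPartial z n)) dominated-re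

  im-cauchy : IsCauchyℝ (λ n → im (expPartial z n))
  im-cauchy = from-dominated (λ n → im (expPartial z n)) dominated-im

exp : ℂ → ℂ
exp z = lim (λ n → re (expPartial z n)) (ExpConvergence.re-cauchy z)
     +i lim (λ n → im (expPartial z n)) (ExpConvergence.im-cauchy z)

-- π = 4 ∫₀¹ dx/(1+x²), as the limit of left Riemann sums.
π : ℝ
π = fromℕ 4 * mkℝ (leftSum arctan′)
                  (leftSum-cauchy arctan′ (ι 2) (Rational.0≤ι 2) arctan′-lip)
  where open RiemannLemmas

-- k/(n+1)
grid : ℕ → ℕ → ℝ
grid n k = fromℚ (ι k ℚ.* recip n)

-- A tag in each of the n + 1 equal subintervals of [0,1].
Tags : ∀ n → (Fin (suc n) → ℝ) → Set
Tags n ξ = ∀ k → grid n (toℕ k) ≤ ξ k × ξ k ≤ grid n (suc (toℕ k))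

-- The Riemann integral of g over [0,1] is I. For bounded g, convergence over
-- equal subintervals with arbitrary tags is equivalent to convergence over
-- arbitrary partitions, and for continuous g the value is the Lebesgue
-- integral.
∫₀¹_≐_ : (ℝ → ℝ) → ℝ → Set
∫₀¹ g ≐ I = ∀ ε → 0ℚ ℚ.< ε → ∃[ N ] (∀ n → N ℕ.≤ n → ∀ ξ → Tags n ξ →
  abs (fromℚ (recip n) * ∑ (λ k → g (ξ k)) - I) ≤ fromℚ ε)

Squarefree : ℕ → Set
Squarefree n = ∀ d → d ℕ.* d ∣ n → d ≡ 1

squarefree? : ∀ n .{{_ : ℕ.NonZero n}} → Dec (Squarefree n)
squarefree? n@(suc _) =
  map′ (λ h d d²∣n → h (ℕ.s≤s (≤n d d²∣n)) d²∣n) (λ sf {d} _ → sf d)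
    (ℕₚ.allUpTo? (λ d → (d ℕ.* d ∣? n) →-dec (d ℕₚ.≟ 1)) (suc n))
  where
  ≤n : ∀ d → d ℕ.* d ∣ n → d ℕ.≤ n
  ≤n zero      _    = ℕ.z≤n
  ≤n d@(suc _) d²∣n = ℕₚ.≤-trans (ℕₚ.m≤m*n d d) (∣⇒≤ d²∣n)

-- X_R is Fin R, with i standing for the integer i + 1.
int : ∀ {R} → Fin R → ℕ
int i = suc (toℕ i)

X′ : ∀ R → Subset R
X′ R = tabulate (λ i → does (squarefree? (int i)))

SignFunction : ∀ {R} → Subset R → Set
SignFunction S = ∀ i → i ∈ S → Sign

extend : ∀ {R} → SignFunction (X′ R) → Fin R → ℤ
extend {R} f i with i ∈? X′ R
... | yes i∈X′ = f i i∈X′ ℤ.◃ 1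
... | no  _    = + 0

_^ : ∀ {R} → SignFunction (X′ R) → ℝ → ℂ
(f ^) x = ∑ℂ (λ n → fromℚ (extend f n ℚ./ 1) ·ℂ
                    exp (0ℝ +i neg (fromℕ 2 * π * fromℕ (int n) * x)))

IsL¹Norm IsL²Norm : (ℝ → ℂ) → ℝ → Set
IsL¹Norm F l = ∫₀¹ (λ x → ∣ F x ∣ℂ) ≐ l
IsL²Norm F l = ∃[ I ] (∫₀¹ (λ x → ∣ F x ∣ℂ * ∣ F x ∣ℂ) ≐ I) × l ≈ √ I

-- ρ = ‖F‖₁ / ‖F‖₂; in particular both norms exist and ‖F‖₂ ≠ 0.
IsFourierRatio : (ℝ → ℂ) → ℝ → Set
IsFourierRatio F ρ = ∃[ ‖F‖₁ ] ∃[ ‖F‖₂ ]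
  IsL¹Norm F ‖F‖₁ × IsL²Norm F ‖F‖₂ × 0ℝ < ‖F‖₂ × ρ * ‖F‖₂ ≈ ‖F‖₁

Class : ℕ → Set₁
Class R = SignFunction (X′ R) → Set

ℋ : ∀ R → ℝ → Class R
ℋ R c₀ f = ∃[ ρ ] IsFourierRatio (f ^) ρ × c₀ ≤ ρ

Shatters : ∀ {R} → Class R → Subset R → Set
Shatters {R} 𝓕 S = Σ[ S⊆X′ ∈ S ⊆ X′ R ] (∀ (σ : SignFunction S) →
  ∃[ f ] 𝓕 f × (∀ i (i∈S : i ∈ S) → f i (S⊆X′ i∈S) ≡ σ i i∈S))

IsVCDimension : ∀ {R} → Class R → ℕ → Set
IsVCDimension {R} 𝓕 d =
  (Σ[ S ∈ Subset R ] Shatters 𝓕 S × ∣ S ∣ ≡ d) × (∀ S → Shatters 𝓕 S → ∣ S ∣ ℕ.≤ d)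

-- VC(𝓕) ≥ t. A maximum is at least t exactly when some candidate is; the
-- maximum is not computable here, because membership in 𝓕 need not be
-- decidable.
VC[_]≥_ : ∀ {R} → Class R → ℝ → Set
VC[_]≥_ {R} 𝓕 t = Σ[ S ∈ Subset R ] Shatters 𝓕 S × t ≤ fromℕ ∣ S ∣

VC≥⇒≤ : ∀ {R} {𝓕 : Class R} {d t} → IsVCDimension 𝓕 d → VC[ 𝓕 ]≥ t → t ≤ fromℕ d
VC≥⇒≤ (_ , max) (S , shatters , t≤) ε 0<ε with t≤ ε 0<ε
... | N , h = N , λ n n≥ →
  ℚₚ.≤-trans (h n n≥) (ℚₚ.+-monoˡ-≤ ε (Rational.ι-mono (max S shatters)))

≤⇒VC≥ : ∀ {R} {𝓕 : Class R} {d t} → IsVCDimension 𝓕 d → t ≤ fromℕ d → VC[ 𝓕 ]≥ t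
≤⇒VC≥ ((S , shatters , refl) , _) t≤d = S , shatters , t≤d

-- Let P(x) = Σ_{n ≤ 2^k} r_n e(-nx), r_n = ±1, be the Rudin–Shapiro polynomial
-- with R ≤ 2^k = O(R); by the parallelogram law |P|² ≤ 2^(k+1) =: B². Take for S
-- the squarefree numbers up to R/16. A sign function σ on S is extended to f by
-- f(n) = r_n off S. By orthogonality ∫ f̂ P̄ = Σ f(n) r_n ≥ |X′| - 2|S|, and
-- |X′| ≥ R/4 because Σ_{d ≥ 2} 1/d² ≤ 3/4, so this is at least |X′|/2; hence
-- ‖f̂‖₁ ≥ |X′|/(2B), while ‖f̂‖₂ = √|X′|.
--
-- The analytic input is e(1/2) = -1 for π = 4 ∫₀¹ dx/(1+x²). It comes, like the
-- addition theorem, from one principle: two points of the unit circle that both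
-- move by Euler steps z ↦ z + i d z + O(d²) keep their inner product up to O(d²)
-- per step. For π the points are e^{iθ}, θ a partial Riemann sum of 2 arctan′,
-- and (1 + ix)/(1 - ix), x the node reached.

module Submission where

open import Algebra.Bundles using (CommutativeRing)
import Algebra.Properties.Semiring.Sum as SemiringSum
import Algebra.Solver.Ring as RingSolver
import Algebra.Solver.Ring.AlmostCommutativeRing as ACR
open import Data.Bool.Base using (Bool; true; false; _∧_)
open import Data.Fin.Base using (Fin; zero; suc; toℕ)
import Data.Fin.Properties as Finₚ
open import Data.Fin.Subset using (Subset; _∈_; _⊆_) renaming (∣_∣ to size)
open import Data.Fin.Subset.Properties using (_∈?_)
open import Data.Integer.Base as ℤ using (ℤ; +_)
open import Data.Maybe.Base using (Maybe; just; nothing)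
open import Data.Nat.Base as ℕ using (ℕ; zero; suc)
open import Data.Nat.DivMod using (m≡m%n+[m/n]*n; m%n<n; m/n*n≤m; m/n≤m; m≥n⇒m/n>0)
open import Data.Nat.Divisibility
  using (_∣_; divides; _∣?_; ∣⇒≤; 0∣⇒≡0; ∣-trans; m∣m*n; m≤n⇒m!∣n!)
import Data.Nat.Properties as ℕₚ
open import Data.Product.Base using (∃-syntax; _×_; _,_; proj₁; proj₂)
open import Data.Rational.Base as ℚ using (ℚ; 0ℚ; 1ℚ; ½)
import Data.Rational.Properties as ℚₚ
open import Data.Rational.Solver using (module +-*-Solver)
open import Data.Sign.Base as Sign using (Sign; opposite)
open import Data.Sum.Base using (_⊎_; inj₁; inj₂)
open import Data.Vec.Base using (tabulate)
open import Data.Vec.Properties using (lookup∘tabulate; []=⇒lookup; lookup⇒[]=)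
open import Data.Vec.Properties.WithK using ([]=-irrelevant)
open import Function.Base using (case_of_)
open import Level using (0ℓ)
open import Relation.Binary.Bundles using (Preorder)
open import Relation.Binary.Definitions using (Tri; tri<; tri≈; tri>)
open import Relation.Binary.PropositionalEquality
  using (_≡_; _≢_; refl; sym; trans; cong; cong₂; subst; subst₂)
import Relation.Binary.Reasoning.Preorder as PreorderReasoning
import Relation.Binary.Reasoning.Setoid as SetoidReasoning
open import Relation.Nullary.Decidable using (Dec; yes; no; does; dec-true)
open import Relation.Nullary.Negation using (¬_; contradiction)
open import Defs as D
  using (ℝ; seq; cauchy; ι; recip; fromℚ; fromℕ; 0ℝ; _<_; Squarefree; squarefree?;
         SignFunction; X′; extend; ℋ; Shatters; VC[_]≥_)

-- Membership in the class asks for both norms, so the integrals must be shown to exist and then be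
-- evaluated. Both are done through averages over n + 1 equally spaced points: a Lipschitz function
-- has an integral approached at rate O(1/n), so it suffices to know averages for arbitrarily large
-- n, and n is chosen so that 2p divides n + 1 for every frequency p in play. Orthogonality is then
-- an exact finite identity that uses only e(1/2) = -1: half a period later each summand changes
-- sign. Periodicity would not do, since summing a geometric progression needs a ratio different
-- from 1. Constants: k is odd, so B = 2^((k+1)/2) is an integer, and B² ≤ 8R ≤ 32 |X′|. Rounding 32
-- up to the square 36 gives B ≤ 6 √|X′| and FR ≥ √|X′|/(2B) ≥ 1/12. For S, R/16 is rounded down to
-- R₁ ≥ 1; then R ≤ 16 R₁ + 15 ≤ 32 R₁ and |S| ≥ R₁/4 ≥ R/128.

private
  module Q = +-*-Solver
  module DR = D.Rational
  module RL = D.RiemannLemmas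
  module DE = D.ExpLemmas

-- Ordered field operations on ℝ

infix 4 _≋_ _≼_
infixl 6 _+_ _-_
infixl 7 _*_
infix 8 -_

-- The operations are opaque so that unification treats them as constructors.
opaque
  _+_ _*_ : ℝ → ℝ → ℝ
  _+_ = D._+_
  _*_ = D._*_

  -_ ∣_∣ √ : ℝ → ℝ
  -_ = D.neg
  ∣_∣ = D.abs
  √ = D.√

  ⌜_⌝ : ℚ → ℝ
  ⌜_⌝ = fromℚ

  _≋_ _≼_ : ℝ → ℝ → Set
  _≋_ = D._≈_
  _≼_ = D._≤_

_-_ : ℝ → ℝ → ℝ
x - y = x + - y

0r 1r : ℝ
0r = ⌜ 0ℚ ⌝
1r = ⌜ 1ℚ ⌝

-- Estimates for rational approximations

Ev : (ℕ → Set) → Set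
Ev P = ∃[ N ] (∀ n → N ℕ.≤ n → P n)

ev-map : ∀ {P Q : ℕ → Set} → (∀ n → P n → Q n) → Ev P → Ev Q
ev-map f (N , p) = N , λ n n≥ → f n (p n n≥)

ev-× : ∀ {P Q : ℕ → Set} → Ev P → Ev Q → Ev (λ n → P n × Q n)
ev-× (N , p) (M , q) = N ℕ.⊔ M , λ n n≥ →
  p n (ℕₚ.m⊔n≤o⇒m≤o N M n≥) , q n (ℕₚ.m⊔n≤o⇒n≤o N M n≥)

≤-by : ∀ {p q} r → q ≡ p ℚ.+ r → 0ℚ ℚ.≤ r → p ℚ.≤ q
≤-by {p} {q} r eq 0≤r = subst₂ ℚ._≤_ (ℚₚ.+-identityʳ p) (sym eq) (ℚₚ.+-monoʳ-≤ p 0≤r)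

≤⇒0≤diff : ∀ {p q} → p ℚ.≤ q → 0ℚ ℚ.≤ q ℚ.- p
≤⇒0≤diff {p} {q} p≤q = subst (ℚ._≤ q ℚ.- p) (ℚₚ.+-inverseʳ p) (ℚₚ.+-monoˡ-≤ (ℚ.- p) p≤q)

abs≤⇒≤ : ∀ {p q} → ℚ.∣ p ∣ ℚ.≤ q → p ℚ.≤ q
abs≤⇒≤ {p} h = ℚₚ.≤-trans (DR.p≤abs p) h

abs≤⇒-≤ : ∀ {p q} → ℚ.∣ p ∣ ℚ.≤ q → ℚ.- p ℚ.≤ q
abs≤⇒-≤ {p} h = ℚₚ.≤-trans (DR.p≤abs (ℚ.- p)) (subst (ℚ._≤ _) (sym (ℚₚ.∣-p∣≡∣p∣ p)) h)

private
  W : ℚ → ℚ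
  W c = c ℚ.* (c ℚ.+ c ℚ.+ c)

  0<W : ∀ {c} → 0ℚ ℚ.< c → 0ℚ ℚ.< W c
  0<W 0<c = DR.0<* 0<c (DR.0<+ (ℚₚ.<⇒≤ (DR.0<+ (ℚₚ.<⇒≤ 0<c) 0<c)) 0<c)

-- From s² ≤ q ≤ (s + w)², where s is the lower end and w the width, q - s² is at most w (2s + w).
-- With c = B + 1 one has w ≤ c δ, s ≤ c and w ≤ c, so this is at most 3 c² δ = `W c` δ.
√-lower-close : ∀ {B δ ε} q n → 0ℚ ℚ.≤ q → 0ℚ ℚ.≤ B → q ℚ.≤ B → DR.½^ n ℚ.≤ δ → 0ℚ ℚ.≤ δ → W (B ℚ.+ 1ℚ) ℚ.* δ ≡ ε →
  ℚ.∣ D.√-lower q n ℚ.* D.√-lower q n ℚ.- q ∣ ℚ.≤ ε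
√-lower-close {B} {δ} {ε} q n 0≤q 0≤B q≤B half≤δ 0≤δ Wδ =
  go (D.√-lower q n) (D.SqrtLemmas.width q n) (D.SqrtLemmas.√-lower-spec q n 0≤q) (D.SqrtLemmas.0≤width n 0≤q)
    (DR.*-mono {q ℚ.+ 1ℚ} {c} (ℚₚ.<⇒≤ (DR.0<½^ n)) 0≤c q+1≤c half≤δ)
    (subst (D.SqrtLemmas.width q n ℚ.≤_) (ℚₚ.*-identityʳ c) (DR.*-mono {q ℚ.+ 1ℚ} {c} (ℚₚ.<⇒≤ (DR.0<½^ n)) 0≤c q+1≤c
      (subst (λ t → DR.½^ t ℚ.≤ 1ℚ) (ℕₚ.+-identityʳ n) (DR.½^-anti 0 n))))
  where
  c = B ℚ.+ 1ℚ
  0≤c : 0ℚ ℚ.≤ c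
  0≤c = ℚₚ.<⇒≤ (DR.0<+ 0≤B (DR.0<recip 0))
  q+1≤c : q ℚ.+ 1ℚ ℚ.≤ c
  q+1≤c = ℚₚ.+-monoˡ-≤ 1ℚ q≤B
  go : ∀ s w → 0ℚ ℚ.≤ s × s ℚ.* s ℚ.≤ q × q ℚ.≤ (s ℚ.+ w) ℚ.* (s ℚ.+ w) → 0ℚ ℚ.≤ w →
       w ℚ.≤ c ℚ.* δ → w ℚ.≤ c → ℚ.∣ s ℚ.* s ℚ.- q ∣ ℚ.≤ ε
  go s w (0≤s , s²≤q , q≤) 0≤w w≤δ w≤c = DR.abs-≤
    (ℚₚ.≤-trans (≤-by (q ℚ.- s ℚ.* s)
        (Q.solve 2 (λ s q → Q.con 0ℚ Q.:= s Q.:* s Q.:- q Q.:+ (q Q.:- s Q.:* s)) refl s q) (≤⇒0≤diff s²≤q))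
      (subst (0ℚ ℚ.≤_) Wδ (DR.0≤* (DR.0≤* 0≤c (DR.0≤+ (DR.0≤+ 0≤c 0≤c) 0≤c)) 0≤δ)))
    (subst₂ ℚ._≤_ (sym (DR.neg-sub (s ℚ.* s) q)) Wδ
      (ℚₚ.≤-trans
        (ℚₚ.≤-trans (≤-by (((s ℚ.+ w) ℚ.* (s ℚ.+ w) ℚ.- q))
            (Q.solve 3 (λ s w q → w Q.:* (s Q.:+ s Q.:+ w) Q.:= (q Q.:- s Q.:* s) Q.:+ ((s Q.:+ w) Q.:* (s Q.:+ w) Q.:- q)) refl s w q)
            (≤⇒0≤diff q≤))
          (DR.*-mono {w} {c ℚ.* δ} {s ℚ.+ s ℚ.+ w} {c ℚ.+ c ℚ.+ c} (DR.0≤+ (DR.0≤+ 0≤s 0≤s) 0≤w) (DR.0≤* 0≤c 0≤δ)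
            w≤δ (ℚₚ.+-mono-≤ (ℚₚ.+-mono-≤ s≤c s≤c) w≤c)))
        (ℚₚ.≤-reflexive (Q.solve 2 (λ c d → c Q.:* d Q.:* (c Q.:+ c Q.:+ c) Q.:= c Q.:* (c Q.:+ c Q.:+ c) Q.:* d) refl c δ))))
    where
    c≤c² : c ℚ.≤ c ℚ.* c
    c≤c² = ≤-by (c ℚ.* B) (Q.solve 1 (λ b → (b Q.:+ Q.con 1ℚ) Q.:* (b Q.:+ Q.con 1ℚ) Q.:=
      (b Q.:+ Q.con 1ℚ) Q.:+ (b Q.:+ Q.con 1ℚ) Q.:* b) refl B) (DR.0≤* 0≤c 0≤B)
    s≤c : s ℚ.≤ c
    s≤c = ℚₚ.≮⇒≥ λ c<s → ℚₚ.<-irrefl refl (ℚₚ.<-≤-trans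
      (subst (ℚ._< c ℚ.* c ℚ.+ 1ℚ) (ℚₚ.+-identityʳ _) (ℚₚ.+-monoʳ-< (c ℚ.* c) (DR.0<recip 0)))
      (ℚₚ.≤-trans (ℚₚ.+-monoˡ-≤ 1ℚ (D.SqrtLemmas.sq-mono 0≤c (ℚₚ.<⇒≤ c<s)))
        (ℚₚ.≤-trans (ℚₚ.+-monoˡ-≤ 1ℚ s²≤q) (ℚₚ.≤-trans q+1≤c c≤c²))))

-- If p exceeded q + 4δ, its square would be at least q² + 8 (q + δ) δ + 8 δ², more than allowed.
-- The hypothesis is q ≥ -δ rather than q ≥ 0 because the approximations of a nonnegative real are
-- nonnegative only up to an error.
sq-gap : ∀ p q δ → 0ℚ ℚ.< δ → 0ℚ ℚ.≤ q ℚ.+ δ → p ℚ.* p ℚ.≤ q ℚ.* q ℚ.+ (δ ℚ.* δ ℚ.+ δ ℚ.* δ) →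
  p ℚ.≤ q ℚ.+ ((δ ℚ.+ δ) ℚ.+ (δ ℚ.+ δ))
sq-gap p q δ 0<δ c d = ℚₚ.≮⇒≥ λ q+4δ<p → ℚₚ.<-irrefl refl (begin-strict
  p ℚ.* p
    ≤⟨ d ⟩
  r
    ≡⟨ sym (ℚₚ.+-identityʳ r) ⟩
  r ℚ.+ 0ℚ
    <⟨ ℚₚ.+-monoʳ-< r (DR.0<* {δ} {δ} 0<δ 0<δ) ⟩
  r ℚ.+ δ ℚ.* δ
    ≤⟨ ≤-by {r ℚ.+ δ ℚ.* δ} {s ℚ.* s} w
         (Q.solve 2 (λ q e → let m = (q Q.:+ e) Q.:* e ; n = e Q.:* e in
             (q Q.:+ ((e Q.:+ e) Q.:+ (e Q.:+ e))) Q.:* (q Q.:+ ((e Q.:+ e) Q.:+ (e Q.:+ e))) Q.:=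
             (q Q.:* q Q.:+ (n Q.:+ n) Q.:+ n) Q.:+ (Q.con (ι 8) Q.:* m Q.:+ Q.con (ι 5) Q.:* n))
           refl q δ)
         (DR.0≤+ {ι 8 ℚ.* m} {ι 5 ℚ.* n} (DR.0≤* {ι 8} {m} (DR.0≤ι 8) 0≤m) (DR.0≤* {ι 5} {n} (DR.0≤ι 5) 0≤n)) ⟩
  s ℚ.* s
    ≤⟨ D.SqrtLemmas.sq-mono {s} {p} 0≤s (ℚₚ.<⇒≤ q+4δ<p) ⟩
  p ℚ.* p ∎)
  where
  open ℚₚ.≤-Reasoning
  r = q ℚ.* q ℚ.+ (δ ℚ.* δ ℚ.+ δ ℚ.* δ)
  s = q ℚ.+ ((δ ℚ.+ δ) ℚ.+ (δ ℚ.+ δ))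
  m = (q ℚ.+ δ) ℚ.* δ
  n = δ ℚ.* δ
  w = ι 8 ℚ.* m ℚ.+ ι 5 ℚ.* n
  0≤δ = ℚₚ.<⇒≤ 0<δ
  0≤m : 0ℚ ℚ.≤ m
  0≤m = DR.0≤* {q ℚ.+ δ} {δ} c 0≤δ
  0≤n : 0ℚ ℚ.≤ n
  0≤n = DR.0≤* {δ} {δ} 0≤δ 0≤δ
  0≤s : 0ℚ ℚ.≤ s
  0≤s = ℚₚ.≤-trans {0ℚ} {q ℚ.+ δ} {s} c (≤-by {q ℚ.+ δ} {s} (ι 3 ℚ.* δ)
    (Q.solve 2 (λ q e → q Q.:+ ((e Q.:+ e) Q.:+ (e Q.:+ e)) Q.:= q Q.:+ e Q.:+ Q.con (ι 3) Q.:* e) refl q δ)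
    (DR.0≤* {ι 3} {δ} (DR.0≤ι 3) 0≤δ))

opaque
  unfolding _+_

  pointwise : ∀ {x y} → (∀ n → seq x n ≡ seq y n) → x ≋ y
  pointwise {x} {y} eq ε 0<ε = 0 , λ n _ → ℚₚ.≤-trans
    (ℚₚ.≤-reflexive (cong ℚ.∣_∣ (trans (cong (ℚ._- seq y n) (eq n)) (ℚₚ.+-inverseʳ (seq y n)))))
    (ℚₚ.<⇒≤ 0<ε)

  pointwise-≤ : ∀ {x y} → Ev (λ n → seq x n ℚ.≤ seq y n) → x ≼ y
  pointwise-≤ {x} {y} h ε 0<ε = ev-map (λ n le → ≤-by (seq y n ℚ.+ ε ℚ.- seq x n)
    (Q.solve 3 (λ x y e → y Q.:+ e Q.:= x Q.:+ (y Q.:+ e Q.:- x)) refl (seq x n) (seq y n) ε)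
    (≤⇒0≤diff (ℚₚ.≤-trans le (≤-by ε refl (ℚₚ.<⇒≤ 0<ε))))) h

  ≋-refl : ∀ {x} → x ≋ x
  ≋-refl {x} = pointwise {x} {x} (λ _ → refl)

  ≋-sym : ∀ {x y} → x ≋ y → y ≋ x
  ≋-sym {x} {y} h ε 0<ε = ev-map (λ n → subst (ℚ._≤ ε) (DR.abs-sym (seq x n) (seq y n))) (h ε 0<ε)

  ≋-trans : ∀ {x y z} → x ≋ y → y ≋ z → x ≋ z
  ≋-trans {x} {y} {z} h k ε 0<ε = ev-map
    (λ n (a , b) → ℚₚ.≤-trans (DR.triangle (seq x n) (seq y n) (seq z n))
      (ℚₚ.≤-trans (ℚₚ.+-mono-≤ a b) (ℚₚ.≤-reflexive (DR.half+half ε))))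
    (ev-× (h (ε ℚ.* ½) (DR.0<half 0<ε)) (k (ε ℚ.* ½) (DR.0<half 0<ε)))

  ≼-reflexive : ∀ {x y} → x ≋ y → x ≼ y
  ≼-reflexive {x} {y} h ε 0<ε = ev-map
    (λ n a → DR.sub⇒≤ (abs≤⇒≤ a)) (h ε 0<ε)

  ≼-trans : ∀ {x y z} → x ≼ y → y ≼ z → x ≼ z
  ≼-trans {x} {y} {z} h k ε 0<ε = ev-map
    (λ n (a , b) → ℚₚ.≤-trans a (ℚₚ.≤-trans (ℚₚ.+-monoˡ-≤ (ε ℚ.* ½) b)
      (ℚₚ.≤-reflexive (trans (ℚₚ.+-assoc (seq z n) _ _) (cong (seq z n ℚ.+_) (DR.half+half ε))))))
    (ev-× (h (ε ℚ.* ½) (DR.0<half 0<ε)) (k (ε ℚ.* ½) (DR.0<half 0<ε)))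

  ≼-antisym : ∀ {x y} → x ≼ y → y ≼ x → x ≋ y
  ≼-antisym {x} {y} h k ε 0<ε = ev-map
    (λ n (a , b) → DR.abs-≤ (DR.≤⇒sub a)
      (subst (ℚ._≤ ε) (sym (DR.neg-sub (seq x n) (seq y n))) (DR.≤⇒sub b)))
    (ev-× (h ε 0<ε) (k ε 0<ε))

  ≼-mono-+ : ∀ {x y u v} → x ≼ y → u ≼ v → x + u ≼ y + v
  ≼-mono-+ {x} {y} {u} {v} h k ε 0<ε = ev-map
    (λ n (a , b) → ℚₚ.≤-trans (ℚₚ.+-mono-≤ a b) (ℚₚ.≤-reflexive
      (trans (Q.solve 3 (λ y v e → (y Q.:+ e) Q.:+ (v Q.:+ e) Q.:= (y Q.:+ v) Q.:+ (e Q.:+ e))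
                refl (seq y n) (seq v n) (ε ℚ.* ½))
             (cong ((seq y n ℚ.+ seq v n) ℚ.+_) (DR.half+half ε)))))
    (ev-× (h (ε ℚ.* ½) (DR.0<half 0<ε)) (k (ε ℚ.* ½) (DR.0<half 0<ε)))

  +-cong : ∀ {x y u v} → x ≋ y → u ≋ v → x + u ≋ y + v
  +-cong {x} {y} {u} {v} h k = ≼-antisym {x + u} {y + v}
    (≼-mono-+ {x} {y} {u} {v} (≼-reflexive {x} {y} h) (≼-reflexive {u} {v} k))
    (≼-mono-+ {y} {x} {v} {u} (≼-reflexive {y} {x} (≋-sym {x} {y} h)) (≼-reflexive {v} {u} (≋-sym {u} {v} k)))

  neg-cong : ∀ {x y} → x ≋ y → - x ≋ - y
  neg-cong {x} {y} h ε 0<ε = ev-map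
    (λ n → subst (ℚ._≤ ε) (trans (DR.abs-sym (seq x n) (seq y n))
      (cong ℚ.∣_∣ (Q.solve 2 (λ a b → b Q.:- a Q.:= Q.:- a Q.:- (Q.:- b)) refl (seq x n) (seq y n)))))
    (h ε 0<ε)

  ∣∣-cong : ∀ {x y} → x ≋ y → ∣ x ∣ ≋ ∣ y ∣
  ∣∣-cong {x} {y} h ε 0<ε = ev-map (λ n → ℚₚ.≤-trans (DR.abs-lip (seq x n) (seq y n))) (h ε 0<ε)

  seq-bounded : ∀ x → ∃[ B ] 0ℚ ℚ.< B × Ev (λ n → ℚ.∣ seq x n ∣ ℚ.≤ B)
  seq-bounded x = D.CauchyLemmas.bounded {seq x} (cauchy x)

  *-cong : ∀ {x y u v} → x ≋ y → u ≋ v → x * u ≋ y * v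
  *-cong {x} {y} {u} {v} h k ε 0<ε =
    case seq-bounded x of λ (A , 0<A , hA) →
    case seq-bounded v of λ (B , 0<B , hB) →
    case DR.divide A 0<A (ε ℚ.* ½) (DR.0<half 0<ε) of λ (α , 0<α , Aα) →
    case DR.divide B 0<B (ε ℚ.* ½) (DR.0<half 0<ε) of λ (β , 0<β , Bβ) →
    ev-map
      (λ n ((a , b) , (c , d)) → ℚₚ.≤-trans
        (D.CauchyLemmas.abs-*-diff {seq x n} {seq u n} {seq y n} {seq v n} (ℚₚ.<⇒≤ 0<A) (ℚₚ.<⇒≤ 0<β) a b c d)
        (ℚₚ.≤-reflexive (trans (cong₂ ℚ._+_ Aα (trans (ℚₚ.*-comm β B) Bβ)) (DR.half+half ε))))
      (ev-× (ev-× hA hB) (ev-× (k α 0<α) (h β 0<β)))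

  -- Eventually p, q ≥ -η for the approximations, and p q = (p + η)(q + η) - η (p + q + η). Taking η
  -- ≤ 1 bounds the last bracket by A + B + 1, so η is the minimum of 1 and ε/(A + B + 1).
  *-nonneg : ∀ {x y} → 0r ≼ x → 0r ≼ y → 0r ≼ x * y
  *-nonneg {x} {y} h k ε 0<ε =
    case seq-bounded x of λ (A , 0<A , hA) →
    case seq-bounded y of λ (B , 0<B , hB) →
    case DR.divide (A ℚ.+ B ℚ.+ 1ℚ) (DR.0<+ (ℚₚ.<⇒≤ (DR.0<+ (ℚₚ.<⇒≤ 0<A) 0<B)) (DR.0<recip 0)) ε 0<ε of λ (δ , 0<δ , Kδ) →
    let η = δ ℚ.⊓ 1ℚ in
    ev-map
      (λ n ((a , b) , (c , d)) → step (ℚₚ.<⇒≤ 0<A) (ℚₚ.<⇒≤ 0<B) (ℚₚ.<⇒≤ (0<η 0<δ)) (ℚₚ.p⊓q≤p δ 1ℚ) (ℚₚ.p⊓q≤q δ 1ℚ) Kδ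
         (abs≤⇒≤ {seq x n} a) (abs≤⇒≤ {seq y n} b) c d)
      (ev-× (ev-× hA hB) (ev-× (h η (0<η 0<δ)) (k η (0<η 0<δ))))
    where
    0<η : ∀ {δ} → 0ℚ ℚ.< δ → 0ℚ ℚ.< δ ℚ.⊓ 1ℚ
    0<η {δ} 0<δ with ℚₚ.⊓-sel δ 1ℚ
    ... | inj₁ e = subst (0ℚ ℚ.<_) (sym e) 0<δ
    ... | inj₂ e = subst (0ℚ ℚ.<_) (sym e) (DR.0<recip 0)
    step : ∀ {p q A B η δ} → 0ℚ ℚ.≤ A → 0ℚ ℚ.≤ B → 0ℚ ℚ.≤ η → η ℚ.≤ δ → η ℚ.≤ 1ℚ → (A ℚ.+ B ℚ.+ 1ℚ) ℚ.* δ ≡ ε →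
           p ℚ.≤ A → q ℚ.≤ B → 0ℚ ℚ.≤ p ℚ.+ η → 0ℚ ℚ.≤ q ℚ.+ η → 0ℚ ℚ.≤ p ℚ.* q ℚ.+ ε
    step {p} {q} {A} {B} {η} {δ} 0≤A 0≤B 0≤η η≤δ η≤1 Kδ p≤A q≤B c d = ℚₚ.≤-trans
      (≤-by ((p ℚ.+ η) ℚ.* (q ℚ.+ η) ℚ.+ η ℚ.* ((A ℚ.- p) ℚ.+ (B ℚ.- q) ℚ.+ (1ℚ ℚ.- η)))
        (Q.solve 5 (λ p q e a b → p Q.:* q Q.:+ (a Q.:+ b Q.:+ Q.con 1ℚ) Q.:* e Q.:=
           Q.con 0ℚ Q.:+ ((p Q.:+ e) Q.:* (q Q.:+ e) Q.:+ e Q.:* ((a Q.:- p) Q.:+ (b Q.:- q) Q.:+ (Q.con 1ℚ Q.:- e))))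
           refl p q η A B)
        (DR.0≤+ {(p ℚ.+ η) ℚ.* (q ℚ.+ η)} {η ℚ.* ((A ℚ.- p) ℚ.+ (B ℚ.- q) ℚ.+ (1ℚ ℚ.- η))}
          (DR.0≤* {p ℚ.+ η} {q ℚ.+ η} c d) (DR.0≤* {η} {(A ℚ.- p) ℚ.+ (B ℚ.- q) ℚ.+ (1ℚ ℚ.- η)} 0≤η
          (DR.0≤+ {(A ℚ.- p) ℚ.+ (B ℚ.- q)} {1ℚ ℚ.- η} (DR.0≤+ {A ℚ.- p} {B ℚ.- q}
            (≤⇒0≤diff {p} {A} p≤A) (≤⇒0≤diff {q} {B} q≤B)) (≤⇒0≤diff {η} {1ℚ} η≤1)))))
      (ℚₚ.+-monoʳ-≤ (p ℚ.* q) (ℚₚ.≤-trans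
        (ℚₚ.*-monoˡ-≤-nonNeg (A ℚ.+ B ℚ.+ 1ℚ) {{ℚ.nonNegative (DR.0≤+ {A ℚ.+ B} {1ℚ} (DR.0≤+ {A} {B} 0≤A 0≤B) (ℚₚ.<⇒≤ (DR.0<recip 0)))}} η≤δ)
        (ℚₚ.≤-reflexive Kδ)))

  -- The approximations satisfy the hypotheses up to δ and 2δ², which `sq-gap` turns into an error
  -- 4δ = ε. Bounds on square roots and moduli are obtained from this by comparing squares.
  sq-cancel : ∀ {a b} → 0r ≼ b → a * a ≼ b * b → a ≼ b
  sq-cancel {a} {b} h k ε 0<ε = ev-map
    (λ n (c , d) → subst (λ t → seq a n ℚ.≤ seq b n ℚ.+ t) 4δ≡ε (sq-gap (seq a n) (seq b n) δ 0<δ c d))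
    (ev-× (h δ 0<δ) (k (δ ℚ.* δ ℚ.+ δ ℚ.* δ) (DR.0<+ {δ ℚ.* δ} {δ ℚ.* δ} (ℚₚ.<⇒≤ (DR.0<* {δ} {δ} 0<δ 0<δ)) (DR.0<* {δ} {δ} 0<δ 0<δ))))
    where
    δ : ℚ
    δ = ε ℚ.* ½ ℚ.* ½
    0<δ : 0ℚ ℚ.< δ
    0<δ = DR.0<half (DR.0<half 0<ε)
    4δ≡ε : (δ ℚ.+ δ) ℚ.+ (δ ℚ.+ δ) ≡ ε
    4δ≡ε = trans (cong₂ ℚ._+_ (DR.half+half (ε ℚ.* ½)) (DR.half+half (ε ℚ.* ½))) (DR.half+half ε)

  ≼∣∣ : ∀ x → x ≼ ∣ x ∣
  ≼∣∣ x = pointwise-≤ {x} {∣ x ∣} (0 , λ n _ → DR.p≤abs (seq x n))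

  -≼∣∣ : ∀ x → - x ≼ ∣ x ∣
  -≼∣∣ x = pointwise-≤ { - x} {∣ x ∣} (0 , λ n _ → abs≤⇒-≤ ℚₚ.≤-refl)

  ∣∣≼ : ∀ {x y} → x ≼ y → - x ≼ y → ∣ x ∣ ≼ y
  ∣∣≼ {x} {y} h k ε 0<ε = ev-map (λ n (a , b) → DR.abs-≤ a b) (ev-× (h ε 0<ε) (k ε 0<ε))

  ∣∣-* : ∀ x y → ∣ x * y ∣ ≋ ∣ x ∣ * ∣ y ∣
  ∣∣-* x y = pointwise {∣ x * y ∣} {∣ x ∣ * ∣ y ∣} (λ n → ℚₚ.∣p*q∣≡∣p∣*∣q∣ (seq x n) (seq y n))

  0≼sq : ∀ x → 0r ≼ x * x
  0≼sq x = pointwise-≤ {0r} {x * x} (0 , λ n _ → RL.0≤sq (seq x n))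

  0≼∣∣ : ∀ x → 0r ≼ ∣ x ∣
  0≼∣∣ x = pointwise-≤ {0r} {∣ x ∣} (0 , λ n _ → ℚₚ.0≤∣p∣ (seq x n))

  ⌜⌝-mono : ∀ {p q} → p ℚ.≤ q → ⌜ p ⌝ ≼ ⌜ q ⌝
  ⌜⌝-mono {p} {q} h = pointwise-≤ {⌜ p ⌝} {⌜ q ⌝} (0 , λ _ _ → h)

  ⌜⌝-+ : ∀ p q → ⌜ p ℚ.+ q ⌝ ≋ ⌜ p ⌝ + ⌜ q ⌝
  ⌜⌝-+ p q = pointwise {⌜ p ℚ.+ q ⌝} {⌜ p ⌝ + ⌜ q ⌝} (λ _ → refl)

  ⌜⌝-* : ∀ p q → ⌜ p ℚ.* q ⌝ ≋ ⌜ p ⌝ * ⌜ q ⌝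
  ⌜⌝-* p q = pointwise {⌜ p ℚ.* q ⌝} {⌜ p ⌝ * ⌜ q ⌝} (λ _ → refl)

  ⌜⌝-neg : ∀ p → ⌜ ℚ.- p ⌝ ≋ - ⌜ p ⌝
  ⌜⌝-neg p = pointwise {⌜ ℚ.- p ⌝} { - ⌜ p ⌝} (λ _ → refl)

  archimedean : ∀ x → ∃[ B ] 0ℚ ℚ.≤ B × ∣ x ∣ ≼ ⌜ B ⌝
  archimedean x = case seq-bounded x of λ (B , 0<B , h) →
    B , ℚₚ.<⇒≤ 0<B , pointwise-≤ {∣ x ∣} {⌜ B ⌝} h

  ≼-limit : ∀ {x y} → (∀ ε → 0ℚ ℚ.< ε → x ≼ y + ⌜ ε ⌝) → x ≼ y
  ≼-limit {x} {y} h ε 0<ε = ev-map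
    (λ n a → ℚₚ.≤-trans a (ℚₚ.≤-reflexive (trans (ℚₚ.+-assoc (seq y n) _ _) (cong (seq y n ℚ.+_) (DR.half+half ε)))))
    (h (ε ℚ.* ½) (DR.0<half 0<ε) (ε ℚ.* ½) (DR.0<half 0<ε))

  approx : ∀ x ε → 0ℚ ℚ.< ε → Ev (λ n → ∣ x - ⌜ seq x n ⌝ ∣ ≼ ⌜ ε ⌝)
  approx x ε 0<ε = case cauchy x ε 0<ε of λ (N , h) → N , λ n n≥ → pointwise-≤ {∣ x - ⌜ seq x n ⌝ ∣} {⌜ ε ⌝} (N , λ m m≥ → h m n m≥ n≥)

  +-assoc : ∀ x y z → (x + y) + z ≋ x + (y + z)
  +-assoc x y z = pointwise {(x + y) + z} {x + (y + z)} (λ n → ℚₚ.+-assoc (seq x n) (seq y n) (seq z n))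

  +-comm : ∀ x y → x + y ≋ y + x
  +-comm x y = pointwise {x + y} {y + x} (λ n → ℚₚ.+-comm (seq x n) (seq y n))

  +-identityˡ : ∀ x → 0r + x ≋ x
  +-identityˡ x = pointwise {0r + x} {x} (λ n → ℚₚ.+-identityˡ (seq x n))

  +-inverseˡ : ∀ x → - x + x ≋ 0r
  +-inverseˡ x = pointwise { - x + x} {0r} (λ n → ℚₚ.+-inverseˡ (seq x n))

  *-assoc : ∀ x y z → (x * y) * z ≋ x * (y * z)
  *-assoc x y z = pointwise {(x * y) * z} {x * (y * z)} (λ n → ℚₚ.*-assoc (seq x n) (seq y n) (seq z n))

  *-comm : ∀ x y → x * y ≋ y * x
  *-comm x y = pointwise {x * y} {y * x} (λ n → ℚₚ.*-comm (seq x n) (seq y n))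

  *-identityˡ : ∀ x → 1r * x ≋ x
  *-identityˡ x = pointwise {1r * x} {x} (λ n → ℚₚ.*-identityˡ (seq x n))

  *-distribˡ : ∀ x y z → x * (y + z) ≋ x * y + x * z
  *-distribˡ x y z = pointwise {x * (y + z)} {x * y + x * z} (λ n → ℚₚ.*-distribˡ-+ (seq x n) (seq y n) (seq z n))

  √-nonneg : ∀ x → 0r ≼ √ x
  √-nonneg x = pointwise-≤ {0r} {√ x} (0 , λ n _ →
    proj₁ (D.SqrtLemmas.√-lower-spec ℚ.∣ seq x n ∣ n (ℚₚ.0≤∣p∣ (seq x n))))

  √-sq : ∀ x → √ x * √ x ≋ ∣ x ∣
  √-sq x ε 0<ε =
    case seq-bounded x of λ (B , 0<B , hB) →
    case DR.divide (W (B ℚ.+ 1ℚ)) (0<W (DR.0<+ (ℚₚ.<⇒≤ 0<B) (DR.0<recip 0))) ε 0<ε of λ (δ , 0<δ , Wδ) →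
    case DR.vanish 1ℚ (DR.0<recip 0) δ 0<δ of λ (M , M≤) →
    ev-map (λ n (b , m) → √-lower-close ℚ.∣ seq x n ∣ n (ℚₚ.0≤∣p∣ (seq x n)) (ℚₚ.<⇒≤ 0<B) b
        (ℚₚ.≤-trans (subst (λ t → DR.½^ t ℚ.≤ DR.½^ M) (ℕₚ.m∸n+n≡m m) (DR.½^-anti M (n ℕ.∸ M)))
          (subst (ℚ._≤ δ) (ℚₚ.*-identityˡ (DR.½^ M)) M≤)) (ℚₚ.<⇒≤ 0<δ) Wδ)
      (ev-× hB (M , λ n n≥ → n≥))

-- The commutative ring ℝ and its solver

ℝ-ring : CommutativeRing 0ℓ 0ℓ
ℝ-ring = record
  { Carrier = ℝ ; _≈_ = _≋_ ; _+_ = _+_ ; _*_ = _*_ ; -_ = -_ ; 0# = 0r ; 1# = 1r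
  ; isCommutativeRing = record
    { isRing = record
      { +-isAbelianGroup = record
        { isGroup = record
          { isMonoid = record
            { isSemigroup = record
              { isMagma = record
                { isEquivalence = record { refl = ≋-refl ; sym = ≋-sym ; trans = ≋-trans }
                ; ∙-cong = +-cong }
              ; assoc = +-assoc }
            ; identity = +-identityˡ , λ x → ≋-trans (+-comm x 0r) (+-identityˡ x) }
          ; inverse = +-inverseˡ , λ x → ≋-trans (+-comm x (- x)) (+-inverseˡ x)
          ; ⁻¹-cong = neg-cong }
        ; comm = +-comm }
      ; *-cong = *-cong
      ; *-assoc = *-assoc
      ; *-identity = *-identityˡ , λ x → ≋-trans (*-comm x 1r) (*-identityˡ x)
      ; distrib = *-distribˡ , λ x y z → ≋-trans (*-comm (y + z) x)
          (≋-trans (*-distribˡ x y z) (+-cong (*-comm x y) (*-comm x z)))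
      }
    ; *-comm = *-comm } }

private
  ℚ-coeffs : ACR._-Raw-AlmostCommutative⟶_
    (CommutativeRing.rawRing ℚₚ.+-*-commutativeRing) (ACR.fromCommutativeRing ℝ-ring)
  ℚ-coeffs = record
    { ⟦_⟧ = ⌜_⌝ ; +-homo = ⌜⌝-+ ; *-homo = ⌜⌝-* ; -‿homo = ⌜⌝-neg
    ; 0-homo = ≋-refl ; 1-homo = ≋-refl }

  _coeff≟_ : (p q : ℚ) → Maybe (⌜ p ⌝ ≋ ⌜ q ⌝)
  p coeff≟ q with p ℚₚ.≟ q
  ... | yes p≡q = just (subst (λ r → ⌜ p ⌝ ≋ ⌜ r ⌝) p≡q ≋-refl)
  ... | no _ = nothing

-- Coefficients are rational, so identities with constants such as 1/2 are normalised by rational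
-- arithmetic.
module R = RingSolver (CommutativeRing.rawRing ℚₚ.+-*-commutativeRing)
  (ACR.fromCommutativeRing ℝ-ring) ℚ-coeffs _coeff≟_

ℝ-preorder : Preorder 0ℓ 0ℓ 0ℓ
ℝ-preorder = record
  { Carrier = ℝ ; _≈_ = _≋_ ; _≲_ = _≼_
  ; isPreorder = record
    { isEquivalence = CommutativeRing.isEquivalence ℝ-ring
    ; reflexive = ≼-reflexive ; trans = ≼-trans } }

module ≋R = SetoidReasoning (CommutativeRing.setoid ℝ-ring)

module ≼R = PreorderReasoning ℝ-preorder

≡⇒≋ : ∀ {x y} → x ≡ y → x ≋ y
≡⇒≋ refl = ≋-refl

≼-refl : ∀ {x} → x ≼ x
≼-refl = ≼-reflexive ≋-refl

≼-resp : ∀ {x x′ y y′} → x ≋ x′ → y ≋ y′ → x ≼ y → x′ ≼ y′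
≼-resp p q h = ≼-trans (≼-reflexive (≋-sym p)) (≼-trans h (≼-reflexive q))

-- The usual form of an inequality proof here: the difference is exhibited as a visibly nonnegative
-- r, and the equation is a ring identity.
≼-by : ∀ {x y} r → y ≋ x + r → 0r ≼ r → x ≼ y
≼-by {x} r eq h = ≼-resp (CommutativeRing.+-identityʳ ℝ-ring x) (≋-sym eq) (≼-mono-+ ≼-refl h)

≼⇒0≼- : ∀ {x y} → x ≼ y → 0r ≼ y - x
≼⇒0≼- {x} {y} h = ≼-resp (CommutativeRing.-‿inverseʳ ℝ-ring x) ≋-refl (≼-mono-+ h (≼-refl { - x}))

0≼+ : ∀ {x y} → 0r ≼ x → 0r ≼ y → 0r ≼ x + y
0≼+ h k = ≼-resp (+-identityˡ 0r) ≋-refl (≼-mono-+ h k)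

0≼⌜⌝ : ∀ {q} → 0ℚ ℚ.≤ q → 0r ≼ ⌜ q ⌝
0≼⌜⌝ = ⌜⌝-mono

≼-*ˡ : ∀ {x y z} → 0r ≼ z → x ≼ y → z * x ≼ z * y
≼-*ˡ {x} {y} {z} 0≼z h = ≼-by (z * (y - x))
  (R.solve 3 (λ x y z → z R.:* y R.:= z R.:* x R.:+ z R.:* (y R.:- x)) ≋-refl x y z)
  (*-nonneg 0≼z (≼⇒0≼- h))

≼-* : ∀ {x y u v} → 0r ≼ u → 0r ≼ y → x ≼ y → u ≼ v → x * u ≼ y * v
≼-* {x} {y} {u} {v} 0≼u 0≼y h k =
  ≼-trans (≼-resp (*-comm u x) (*-comm u y) (≼-*ˡ 0≼u h)) (≼-*ˡ 0≼y k)

≼-neg : ∀ {x y} → x ≼ y → - y ≼ - x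
≼-neg {x} {y} h = ≼-by (y - x)
  (R.solve 2 (λ x y → R.:- x R.:= R.:- y R.:+ (y R.:- x)) ≋-refl x y) (≼⇒0≼- h)

open CommutativeRing ℝ-ring public using (+-identityʳ; *-identityʳ; zeroˡ; zeroʳ; -‿inverseʳ; semiring)

∣∣-sq : ∀ x → ∣ x ∣ * ∣ x ∣ ≋ x * x
∣∣-sq x = ≼-antisym
  (≼-resp (∣∣-* x x) ≋-refl (∣∣≼ ≼-refl (≼-by (x * x + x * x)
     (R.solve 1 (λ x → x R.:* x R.:= R.:- (x R.:* x) R.:+ (x R.:* x R.:+ x R.:* x)) ≋-refl x)
     (0≼+ (0≼sq x) (0≼sq x)))))
  (≼-resp ≋-refl (∣∣-* x x) (≼∣∣ (x * x)))

∣∣≼⇒≼ : ∀ {x y} → ∣ x ∣ ≼ y → x ≼ y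
∣∣≼⇒≼ {x} h = ≼-trans (≼∣∣ x) h

∣∣≼⇒-≼ : ∀ {x y} → ∣ x ∣ ≼ y → - x ≼ y
∣∣≼⇒-≼ {x} h = ≼-trans (-≼∣∣ x) h

∣∣-nonneg : ∀ {x} → 0r ≼ x → ∣ x ∣ ≋ x
∣∣-nonneg {x} h = ≼-antisym (∣∣≼ ≼-refl (≼-by (x + x)
  (R.solve 1 (λ x → x R.:= R.:- x R.:+ (x R.:+ x)) ≋-refl x) (0≼+ h h))) (≼∣∣ x)

∣∣-+ : ∀ x y → ∣ x + y ∣ ≼ ∣ x ∣ + ∣ y ∣
∣∣-+ x y = ∣∣≼ (≼-mono-+ (≼∣∣ x) (≼∣∣ y))
  (≼-resp (R.solve 2 (λ x y → R.:- x R.:+ R.:- y R.:= R.:- (x R.:+ y)) ≋-refl x y) ≋-refl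
    (≼-mono-+ (-≼∣∣ x) (-≼∣∣ y)))

neg-neg : ∀ x → - (- x) ≋ x
neg-neg x = R.solve 1 (λ x → R.:- (R.:- x) R.:= x) ≋-refl x

∣∣-neg : ∀ x → ∣ - x ∣ ≋ ∣ x ∣
∣∣-neg x = ≼-antisym (∣∣≼ (-≼∣∣ x) (≼-resp (≋-sym (neg-neg x)) ≋-refl (≼∣∣ x)))
  (∣∣≼ (≼-resp (neg-neg x) ≋-refl (-≼∣∣ (- x))) (≼∣∣ (- x)))

∣∣-swap : ∀ x y → ∣ x - y ∣ ≋ ∣ y - x ∣
∣∣-swap x y = ≋-trans (≋-sym (∣∣-neg (x - y)))
  (∣∣-cong (R.solve 2 (λ x y → R.:- (x R.:- y) R.:= y R.:- x) ≋-refl x y))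

∣∣-+≼ : ∀ {x y a b} → ∣ x ∣ ≼ a → ∣ y ∣ ≼ b → ∣ x + y ∣ ≼ a + b
∣∣-+≼ {x} {y} h k = ≼-trans (∣∣-+ x y) (≼-mono-+ h k)

∣∣-*≼ : ∀ {x y a b} → ∣ x ∣ ≼ a → ∣ y ∣ ≼ b → ∣ x * y ∣ ≼ a * b
∣∣-*≼ {x} {y} h k = ≼-resp (≋-sym (∣∣-* x y)) ≋-refl
  (≼-* (0≼∣∣ y) (≼-trans (0≼∣∣ x) h) h k)

∣∣-neg≼ : ∀ {x a} → ∣ x ∣ ≼ a → ∣ - x ∣ ≼ a
∣∣-neg≼ {x} h = ≼-resp (≋-sym (∣∣-neg x)) ≋-refl h

∣∣-triangle : ∀ x y z → ∣ x - z ∣ ≼ ∣ x - y ∣ + ∣ y - z ∣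
∣∣-triangle x y z = ≼-resp
  (∣∣-cong (R.solve 3 (λ x y z → (x R.:- y) R.:+ (y R.:- z) R.:= x R.:- z) ≋-refl x y z)) ≋-refl
  (∣∣-+ (x - y) (y - z))

0≼recip : ∀ n → 0r ≼ ⌜ recip n ⌝
0≼recip n = 0≼⌜⌝ (ℚₚ.<⇒≤ (DR.0<recip n))

0≼ι : ∀ n → 0r ≼ ⌜ ι n ⌝
0≼ι n = 0≼⌜⌝ (DR.0≤ι n)

ι*recip : ∀ n → ⌜ ι (suc n) ⌝ * ⌜ recip n ⌝ ≋ 1r
ι*recip n = ≋-trans (≋-sym (⌜⌝-* (ι (suc n)) (recip n)))
  (subst (λ q → ⌜ ι (suc n) ℚ.* recip n ⌝ ≋ ⌜ q ⌝) (DR.ι*recip n) ≋-refl)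

⌜⌝-cong : ∀ {p q} → p ≡ q → ⌜ p ⌝ ≋ ⌜ q ⌝
⌜⌝-cong refl = ≋-refl

ι-+ : ∀ a b → ⌜ ι (a ℕ.+ b) ⌝ ≋ ⌜ ι a ⌝ + ⌜ ι b ⌝
ι-+ a b = ≋-trans (⌜⌝-cong (DR.ι-+ a b)) (⌜⌝-+ (ι a) (ι b))

ι-* : ∀ a b → ⌜ ι (a ℕ.* b) ⌝ ≋ ⌜ ι a ⌝ * ⌜ ι b ⌝
ι-* a b = ≋-trans (⌜⌝-cong (DR.ι-* a b)) (⌜⌝-* (ι a) (ι b))

small : ∀ K ε → 0ℚ ℚ.< ε → ∃[ N ] (∀ n → N ℕ.≤ n → K * ⌜ recip n ⌝ ≼ ⌜ ε ⌝)
small K ε 0<ε = N , bound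
  where
  B = proj₁ (archimedean K)
  0≤B = proj₁ (proj₂ (archimedean K))
  C = B ℚ.+ 1ℚ
  0<C : 0ℚ ℚ.< C
  0<C = DR.0<+ {B} {1ℚ} 0≤B (DR.0<recip 0)
  δ = DR.divide C 0<C ε 0<ε
  N = proj₁ (DR.recip≤ (proj₁ δ) (proj₁ (proj₂ δ)))
  bound : ∀ n → N ℕ.≤ n → K * ⌜ recip n ⌝ ≼ ⌜ ε ⌝
  bound n n≥ = ≼-trans (≼-* {K} {⌜ C ⌝} {⌜ recip n ⌝} {⌜ proj₁ δ ⌝} (0≼recip n) (0≼⌜⌝ (ℚₚ.<⇒≤ 0<C))
      (≼-trans (∣∣≼⇒≼ (proj₂ (proj₂ (archimedean K)))) (≼-by 1r (⌜⌝-+ B 1ℚ) (0≼⌜⌝ (ℚₚ.<⇒≤ (DR.0<recip 0)))))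
      (⌜⌝-mono (ℚₚ.≤-trans (DR.recip-anti n≥) (proj₂ (DR.recip≤ (proj₁ δ) (proj₁ (proj₂ δ)))))))
    (≼-reflexive (≋-trans (≋-sym (⌜⌝-* C (proj₁ δ))) (⌜⌝-cong (proj₂ (proj₂ δ)))))

≼-squeeze : ∀ {x y} K (N : ℕ) → (∀ n → N ℕ.≤ n → x ≼ y + K * ⌜ recip n ⌝) → x ≼ y
≼-squeeze {x} {y} K N h = ≼-limit λ ε 0<ε →
  let M , k = small K ε 0<ε in
  ≼-trans (h (N ℕ.⊔ M) (ℕₚ.m≤m⊔n N M)) (≼-mono-+ ≼-refl (k (N ℕ.⊔ M) (ℕₚ.m≤n⊔m N M)))

≋-squeeze : ∀ {x y} K (N : ℕ) → (∀ n → N ℕ.≤ n → ∣ x - y ∣ ≼ K * ⌜ recip n ⌝) → x ≋ y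
≋-squeeze {x} {y} K N h = ≼-antisym
  (≼-squeeze K N λ n n≥ → ≼-resp
    (R.solve 2 (λ x y → y R.:+ (x R.:- y) R.:= x) ≋-refl x y) ≋-refl
    (≼-mono-+ {y} ≼-refl (∣∣≼⇒≼ (h n n≥))))
  (≼-squeeze K N λ n n≥ → ≼-resp
    (R.solve 2 (λ x y → x R.:+ R.:- (x R.:- y) R.:= y) ≋-refl x y) ≋-refl
    (≼-mono-+ {x} ≼-refl (∣∣≼⇒-≼ (h n n≥))))

-- Finite sums

open SemiringSum semiring public
  using (sum; sum-cong-≋; ∑-distrib-+; ∑-comm; *-distribˡ-sum)

sum-mono : ∀ {n} {f g : Fin n → ℝ} → (∀ i → f i ≼ g i) → sum f ≼ sum g
sum-mono {zero}  h = ≼-refl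
sum-mono {suc n} h = ≼-mono-+ (h zero) (sum-mono (λ i → h (suc i)))

sum-neg : ∀ {n} (f : Fin n → ℝ) → sum (λ i → - f i) ≋ - sum f
sum-neg {zero}  f = R.solve 0 (R.con 0ℚ R.:= R.:- R.con 0ℚ) ≋-refl
sum-neg {suc n} f = ≋-trans (+-cong ≋-refl (sum-neg (λ i → f (suc i))))
  (R.solve 2 (λ x y → R.:- x R.:+ R.:- y R.:= R.:- (x R.:+ y)) ≋-refl (f zero) (sum (λ i → f (suc i))))

sum-const : ∀ n c → sum {n} (λ _ → c) ≋ ⌜ ι n ⌝ * c
sum-const zero    c = ≋-sym (zeroˡ c)
sum-const (suc n) c = ≋-trans (+-cong (≋-sym (*-identityˡ c)) (sum-const n c))
  (≋-trans (R.solve 3 (λ a b c → a R.:* c R.:+ b R.:* c R.:= (a R.:+ b) R.:* c) ≋-refl 1r ⌜ ι n ⌝ c)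
    (*-cong (≋-sym (ι-+ 1 n)) ≋-refl))

sum-abs : ∀ {n} (f : Fin n → ℝ) → ∣ sum f ∣ ≼ sum (λ i → ∣ f i ∣)
sum-abs {zero}  f = ∣∣≼ ≼-refl (≼-reflexive (R.solve 0 (R.:- R.con 0ℚ R.:= R.con 0ℚ) ≋-refl))
sum-abs {suc n} f = ∣∣-+≼ ≼-refl (sum-abs (λ i → f (suc i)))

sum-- : ∀ {n} (f g : Fin n → ℝ) → sum f - sum g ≋ sum (λ i → f i - g i)
sum-- f g = ≋-trans (+-cong ≋-refl (≋-sym (sum-neg g))) (≋-sym (∑-distrib-+ f (λ i → - g i)))

sum-abs≼ : ∀ {n} (f : Fin n → ℝ) c → (∀ i → ∣ f i ∣ ≼ c) → ∣ sum f ∣ ≼ ⌜ ι n ⌝ * c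
sum-abs≼ {n} f c h = ≼-trans (sum-abs f) (≼-trans (sum-mono h) (≼-reflexive (sum-const n c)))

sum-close : ∀ {n} (f g : Fin n → ℝ) c → (∀ i → ∣ f i - g i ∣ ≼ c) → ∣ sum f - sum g ∣ ≼ ⌜ ι n ⌝ * c
sum-close f g c h = ≼-resp (∣∣-cong (≋-sym (sum-- f g))) ≋-refl (sum-abs≼ (λ i → f i - g i) c h)

Σ< : ℕ → (ℕ → ℝ) → ℝ
Σ< n f = sum {n} (λ i → f (toℕ i))

Σ<-cong : ∀ n {f g} → (∀ k → k ℕ.< n → f k ≋ g k) → Σ< n f ≋ Σ< n g
Σ<-cong n h = sum-cong-≋ (λ i → h (toℕ i) (Finₚ.toℕ<n i))

Σ<-mono : ∀ n {f g} → (∀ k → k ℕ.< n → f k ≼ g k) → Σ< n f ≼ Σ< n g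
Σ<-mono n h = sum-mono (λ i → h (toℕ i) (Finₚ.toℕ<n i))

Σ<-+ : ∀ n f g → Σ< n (λ k → f k + g k) ≋ Σ< n f + Σ< n g
Σ<-+ n f g = ∑-distrib-+ {n} (λ i → f (toℕ i)) (λ i → g (toℕ i))

Σ<-scale : ∀ n c f → Σ< n (λ k → c * f k) ≋ c * Σ< n f
Σ<-scale n c f = ≋-sym (*-distribˡ-sum {n} c (λ i → f (toℕ i)))

Σ<-++ : ∀ a b f → Σ< (a ℕ.+ b) f ≋ Σ< a f + Σ< b (λ k → f (a ℕ.+ k))
Σ<-++ zero    b f = ≋-sym (+-identityˡ _)
Σ<-++ (suc a) b f = ≋-trans (+-cong ≋-refl (Σ<-++ a b (λ k → f (suc k)))) (≋-sym (+-assoc _ _ _))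

Σ<-snoc : ∀ n f → Σ< (suc n) f ≋ Σ< n f + f n
Σ<-snoc zero    f = +-comm (f 0) 0r
Σ<-snoc (suc n) f = ≋-trans (+-cong ≋-refl (Σ<-snoc n (λ k → f (suc k)))) (≋-sym (+-assoc _ _ _))

Σ<-* : ∀ a b f → Σ< (a ℕ.* b) f ≋ Σ< a (λ j → Σ< b (λ i → f (j ℕ.* b ℕ.+ i)))
Σ<-* zero    b f = ≋-refl
Σ<-* (suc a) b f = ≋-trans (Σ<-++ b (a ℕ.* b) f)
  (+-cong ≋-refl (≋-trans (Σ<-* a b (λ k → f (b ℕ.+ k)))
    (Σ<-cong a (λ j _ → Σ<-cong b (λ i _ → ≡⇒≋ (cong f (sym (ℕₚ.+-assoc b (j ℕ.* b) i))))))))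

Σ<-comm : ∀ m n (f : ℕ → ℕ → ℝ) → Σ< m (λ i → Σ< n (f i)) ≋ Σ< n (λ j → Σ< m (λ i → f i j))
Σ<-comm m n f = ∑-comm {m} {n} (λ i j → f (toℕ i) (toℕ j))

Σ<-zero : ∀ n {f} → (∀ k → k ℕ.< n → f k ≋ 0r) → Σ< n f ≋ 0r
Σ<-zero n h = ≋-trans (Σ<-cong n h) (≋-trans (sum-const n 0r) (zeroʳ _))

Σ<-prod : ∀ m n f g → Σ< m f * Σ< n g ≋ Σ< m (λ i → Σ< n (λ j → f i * g j))
Σ<-prod m n f g = ≋-trans (*-comm _ _) (≋-trans (≋-sym (Σ<-scale m (Σ< n g) f))
  (Σ<-cong m (λ i _ → ≋-trans (*-comm _ _) (≋-sym (Σ<-scale n (f i) g)))))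

-- Limits

Conv : (ℕ → ℝ) → ℝ → Set
Conv X x = ∀ ε → 0ℚ ℚ.< ε → Ev (λ n → ∣ X n - x ∣ ≼ ⌜ ε ⌝)

opaque
  unfolding _+_

  -- The j-th approximation of the limit is the entry of `X j` at its settling index. It is compared
  -- with entry j of `X n` through entry i of `X n` and of `X j`, with i beyond all moduli involved;
  -- the errors are δ, 2δ and δ, where 4δ = ε.
  lim-conv : ∀ X (c : D.IsCauchyℝ X) → Conv X (D.lim X c)
  lim-conv X c ε 0<ε =
    case c δ 0<δ of λ (N , h) →
    case DR.recip≤ δ 0<δ of λ (K , K≤) →
    N ℕ.⊔ K , λ n n≥ ε′ 0<ε′ →
    case cauchy (X n) δ 0<δ of λ (P , Xn-close) →
    P ℕ.⊔ (N ℕ.⊔ K) , λ j j≥ →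
    case h n j (ℕₚ.m⊔n≤o⇒m≤o N K n≥) (ℕₚ.m⊔n≤o⇒m≤o N K (ℕₚ.m⊔n≤o⇒n≤o P (N ℕ.⊔ K) j≥)) δ 0<δ of λ (J , g) →
    let pj = proj₁ (D.Limit.settle X c j)
        i  = P ℕ.⊔ (J ℕ.⊔ pj)
        P≤i : P ℕ.≤ i
        P≤i = ℕₚ.m≤m⊔n P (J ℕ.⊔ pj)
        J≤i : J ℕ.≤ i
        J≤i = ℕₚ.≤-trans (ℕₚ.m≤m⊔n J pj) (ℕₚ.m≤n⊔m P (J ℕ.⊔ pj))
        pj≤i : pj ℕ.≤ i
        pj≤i = ℕₚ.≤-trans (ℕₚ.m≤n⊔m J pj) (ℕₚ.m≤n⊔m P (J ℕ.⊔ pj))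
    in four (seq (X n) j) (seq (X n) i) (seq (X j) i) (seq (X j) pj) 0<ε′
         (Xn-close j i (ℕₚ.m⊔n≤o⇒m≤o P (N ℕ.⊔ K) j≥) P≤i)
         (g i J≤i)
         (ℚₚ.≤-trans (proj₂ (D.Limit.settle X c j) i pj pj≤i ℕₚ.≤-refl)
           (ℚₚ.≤-trans (DR.recip-anti (ℕₚ.m⊔n≤o⇒n≤o N K (ℕₚ.m⊔n≤o⇒n≤o P (N ℕ.⊔ K) j≥))) K≤))
    where
    δ : ℚ
    δ = ε ℚ.* ½ ℚ.* ½
    0<δ : 0ℚ ℚ.< δ
    0<δ = DR.0<half (DR.0<half 0<ε)
    4δ≡ε : (δ ℚ.+ δ) ℚ.+ (δ ℚ.+ δ) ≡ ε
    4δ≡ε = trans (cong₂ ℚ._+_ (DR.half+half (ε ℚ.* ½)) (DR.half+half (ε ℚ.* ½))) (DR.half+half ε)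
    four : ∀ a b c d {ε′} → 0ℚ ℚ.< ε′ → ℚ.∣ a ℚ.- b ∣ ℚ.≤ δ → ℚ.∣ b ℚ.- c ∣ ℚ.≤ δ ℚ.+ δ → ℚ.∣ c ℚ.- d ∣ ℚ.≤ δ →
           ℚ.∣ a ℚ.- d ∣ ℚ.≤ ε ℚ.+ ε′
    four a b c d {ε′} 0<ε′ h k l = ℚₚ.≤-trans (DR.triangle a b d)
      (ℚₚ.≤-trans (ℚₚ.+-mono-≤ h (ℚₚ.≤-trans (DR.triangle b c d) (ℚₚ.+-mono-≤ k l)))
        (ℚₚ.≤-trans (ℚₚ.≤-reflexive (trans
            (trans (cong (δ ℚ.+_) (ℚₚ.+-assoc δ δ δ)) (sym (ℚₚ.+-assoc δ δ (δ ℚ.+ δ)))) 4δ≡ε))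
          (≤-by {ε} {ε ℚ.+ ε′} ε′ refl (ℚₚ.<⇒≤ 0<ε′))))

conv-const : ∀ x → Conv (λ _ → x) x
conv-const x ε 0<ε = 0 , λ _ _ → ≼-resp (∣∣-cong (≋-sym (-‿inverseʳ x))) ≋-refl
  (≼-resp (≋-sym (∣∣-nonneg ≼-refl)) ≋-refl (0≼⌜⌝ (ℚₚ.<⇒≤ 0<ε)))

conv-+ : ∀ {X Y x y} → Conv X x → Conv Y y → Conv (λ n → X n + Y n) (x + y)
conv-+ {X} {Y} {x} {y} h k ε 0<ε = ev-map
  (λ n (a , b) → ≼-resp
    (∣∣-cong (R.solve 4 (λ a b c d → (a R.:- b) R.:+ (c R.:- d) R.:= (a R.:+ c) R.:- (b R.:+ d)) ≋-refl (X n) x (Y n) y))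
    (≋-trans (≋-sym (⌜⌝-+ _ _)) (⌜⌝-cong (DR.half+half ε)))
    (∣∣-+≼ a b))
  (ev-× (h (ε ℚ.* ½) (DR.0<half 0<ε)) (k (ε ℚ.* ½) (DR.0<half 0<ε)))

conv-neg : ∀ {X x} → Conv X x → Conv (λ n → - X n) (- x)
conv-neg {X} {x} h ε 0<ε = ev-map (λ n a → ≼-resp
  (≋-trans (≋-sym (∣∣-neg _)) (∣∣-cong (R.solve 2 (λ a b → R.:- (a R.:- b) R.:= R.:- a R.:- (R.:- b)) ≋-refl (X n) x)))
  ≋-refl a) (h ε 0<ε)

conv-scale : ∀ c {X x} → Conv X x → Conv (λ n → c * X n) (c * x)
conv-scale c {X} {x} h ε 0<ε = ev-map
  (λ n a → ≼-resp (∣∣-cong (R.solve 3 (λ c a b → c R.:* (a R.:- b) R.:= c R.:* a R.:- c R.:* b) ≋-refl c (X n) x))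
    (≋-trans (≋-sym (⌜⌝-* C (proj₁ δ))) (⌜⌝-cong (proj₂ (proj₂ δ))))
    (∣∣-*≼ c≼C a))
  (h (proj₁ δ) (proj₁ (proj₂ δ)))
  where
  B = proj₁ (archimedean c)
  C = B ℚ.+ 1ℚ
  0<C : 0ℚ ℚ.< C
  0<C = DR.0<+ {B} {1ℚ} (proj₁ (proj₂ (archimedean c))) (DR.0<recip 0)
  c≼C : ∣ c ∣ ≼ ⌜ C ⌝
  c≼C = ≼-trans (proj₂ (proj₂ (archimedean c))) (≼-by 1r (⌜⌝-+ B 1ℚ) (0≼⌜⌝ (ℚₚ.<⇒≤ (DR.0<recip 0))))
  δ = DR.divide C 0<C ε 0<ε

conv-≋ : ∀ {X Y x} → (∀ n → X n ≋ Y n) → Conv X x → Conv Y x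
conv-≋ e h ε 0<ε = ev-map (λ n → ≼-resp (∣∣-cong (+-cong (e n) ≋-refl)) ≋-refl) (h ε 0<ε)

conv-suc : ∀ {X x} → Conv X x → Conv (λ n → X (suc n)) x
conv-suc h ε 0<ε with h ε 0<ε
... | N , p = N , λ n n≥ → p (suc n) (ℕₚ.m≤n⇒m≤1+n n≥)

conv-bound : ∀ {X x b} → Conv X x → Ev (λ n → ∣ X n ∣ ≼ b) → ∣ x ∣ ≼ b
conv-bound {X} {x} {b} h (M , k) = ≼-limit λ ε 0<ε →
  case h ε 0<ε of λ (N , p) →
  let n = N ℕ.⊔ M in
  ≼-resp (∣∣-cong (R.solve 2 (λ a b → a R.:- (a R.:- b) R.:= b) ≋-refl (X n) x)) ≋-refl
    (∣∣-+≼ (k n (ℕₚ.m≤n⊔m N M)) (∣∣-neg≼ (p n (ℕₚ.m≤m⊔n N M))))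

≋-of-zero : ∀ {x y} → ∣ x - y ∣ ≼ 0r → x ≋ y
≋-of-zero {x} {y} h = ≋-squeeze 0r 0 λ n _ → ≼-trans h (≼-reflexive (≋-sym (zeroˡ _)))

conv-unique : ∀ {X x y} → Conv X x → Conv X y → x ≋ y
conv-unique {X} {x} {y} h k = ≋-of-zero (conv-bound {λ n → X n - X n} (conv-+ h (conv-neg k))
  (0 , λ n _ → ≼-resp (∣∣-cong (≋-sym (-‿inverseʳ (X n)))) ≋-refl (≼-reflexive (∣∣-nonneg ≼-refl))))

conv-lipschitz : ∀ {X Y x y} L → Conv X x → (∀ n → ∣ Y n - y ∣ ≼ L * ∣ X n - x ∣) → Conv Y y
conv-lipschitz {X} {Y} {x} {y} L c lip ε 0<ε = ev-map
  (λ n h → ≼-trans (lip n) (≼-resp (R.solve 2 (λ a l → l R.:* a R.:- l R.:* R.con 0ℚ R.:= l R.:* a) ≋-refl ∣ X n - x ∣ L) ≋-refl (∣∣≼⇒≼ h)))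
  (conv-scale L {λ n → ∣ X n - x ∣} {0r} distance ε 0<ε)
  where
  distance : Conv (λ n → ∣ X n - x ∣) 0r
  distance ε 0<ε = ev-map (λ n h → ≼-trans (≼-reflexive (≋-trans
    (∣∣-cong (R.solve 1 (λ a → a R.:- R.con 0ℚ R.:= a) ≋-refl ∣ X n - x ∣)) (∣∣-nonneg (0≼∣∣ (X n - x))))) h) (c ε 0<ε)

-- Cosine and sine

opaque
  cos sin : ℝ → ℝ
  cos y = D.re (D.exp (0ℝ D.+i y))
  sin y = D.im (D.exp (0ℝ D.+i y))

-- The real and imaginary parts of (iy)^k / k!.
cosTerm sinTerm : ℕ → ℝ → ℝ
cosTerm zero    y = 1r
cosTerm (suc k) y = - (⌜ recip k ⌝ * (y * sinTerm k y))
sinTerm zero    y = 0r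
sinTerm (suc k) y = ⌜ recip k ⌝ * (y * cosTerm k y)

opaque
  unfolding _+_

  expTerm-seq : ∀ k y n → seq (D.re (D.expTerm (0ℝ D.+i y) k)) n ≡ seq (cosTerm k y) n
                        × seq (D.im (D.expTerm (0ℝ D.+i y) k)) n ≡ seq (sinTerm k y) n
  expTerm-seq zero    y n = refl , refl
  expTerm-seq (suc k) y n with expTerm-seq k y n
  ... | p , q =
    trans (cong₂ (λ a b → recip k ℚ.* (0ℚ ℚ.* a ℚ.- seq y n ℚ.* b)) p q)
          (mul-re (recip k) (seq y n) (seq (cosTerm k y) n) (seq (sinTerm k y) n)) ,
    trans (cong₂ (λ a b → recip k ℚ.* (0ℚ ℚ.* b ℚ.+ seq y n ℚ.* a)) p q)
          (mul-im (recip k) (seq y n) (seq (cosTerm k y) n) (seq (sinTerm k y) n))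
    where
    mul-re : ∀ r y a b → r ℚ.* (0ℚ ℚ.* a ℚ.- y ℚ.* b) ≡ ℚ.- (r ℚ.* (y ℚ.* b))
    mul-re = Q.solve 4 (λ r y a b → r Q.:* (Q.con 0ℚ Q.:* a Q.:- y Q.:* b) Q.:= Q.:- (r Q.:* (y Q.:* b))) refl
    mul-im : ∀ r y a b → r ℚ.* (0ℚ ℚ.* b ℚ.+ y ℚ.* a) ≡ r ℚ.* (y ℚ.* a)
    mul-im = Q.solve 4 (λ r y a b → r Q.:* (Q.con 0ℚ Q.:* b Q.:+ y Q.:* a) Q.:= r Q.:* (y Q.:* a)) refl

  re-expTerm : ∀ k y → D.re (D.expTerm (0ℝ D.+i y) k) ≋ cosTerm k y
  re-expTerm k y = pointwise {D.re (D.expTerm (0ℝ D.+i y) k)} {cosTerm k y} λ n → proj₁ (expTerm-seq k y n)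

  im-expTerm : ∀ k y → D.im (D.expTerm (0ℝ D.+i y) k) ≋ sinTerm k y
  im-expTerm k y = pointwise {D.im (D.expTerm (0ℝ D.+i y) k)} {sinTerm k y} λ n → proj₂ (expTerm-seq k y n)

  re-expPartial-suc : ∀ z n → D.re (D.expPartial z (suc n)) ≋ D.re (D.expPartial z n) + D.re (D.expTerm z n)
  re-expPartial-suc z n = ≋-refl {D.re (D.expPartial z (suc n))}

  im-expPartial-suc : ∀ z n → D.im (D.expPartial z (suc n)) ≋ D.im (D.expPartial z n) + D.im (D.expTerm z n)
  im-expPartial-suc z n = ≋-refl {D.im (D.expPartial z (suc n))}

  re-expPartial-zero : ∀ z → D.re (D.expPartial z zero) ≋ 0r
  re-expPartial-zero z = ≋-refl {0r}

  im-expPartial-zero : ∀ z → D.im (D.expPartial z zero) ≋ 0r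
  im-expPartial-zero z = ≋-refl {0r}

cosSum sinSum : ℕ → ℝ → ℝ
cosSum n y = Σ< n (λ k → cosTerm k y)
sinSum n y = Σ< n (λ k → sinTerm k y)

re-expPartial : ∀ n y → D.re (D.expPartial (0ℝ D.+i y) n) ≋ cosSum n y
re-expPartial zero    y = re-expPartial-zero (0ℝ D.+i y)
re-expPartial (suc n) y = ≋-trans (re-expPartial-suc (0ℝ D.+i y) n)
  (≋-trans (+-cong (re-expPartial n y) (re-expTerm n y)) (≋-sym (Σ<-snoc n (λ k → cosTerm k y))))

im-expPartial : ∀ n y → D.im (D.expPartial (0ℝ D.+i y) n) ≋ sinSum n y
im-expPartial zero    y = im-expPartial-zero (0ℝ D.+i y)
im-expPartial (suc n) y = ≋-trans (im-expPartial-suc (0ℝ D.+i y) n)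
  (≋-trans (+-cong (im-expPartial n y) (im-expTerm n y)) (≋-sym (Σ<-snoc n (λ k → sinTerm k y))))

opaque
  unfolding cos

  cos-lim : ∀ y → Conv (λ n → D.re (D.expPartial (0ℝ D.+i y) n)) (cos y)
  cos-lim y = lim-conv (λ n → D.re (D.expPartial (0ℝ D.+i y) n)) (D.ExpConvergence.re-cauchy (0ℝ D.+i y))

  sin-lim : ∀ y → Conv (λ n → D.im (D.expPartial (0ℝ D.+i y) n)) (sin y)
  sin-lim y = lim-conv (λ n → D.im (D.expPartial (0ℝ D.+i y) n)) (D.ExpConvergence.im-cauchy (0ℝ D.+i y))

cosSum-conv : ∀ y → Conv (λ n → cosSum n y) (cos y)
cosSum-conv y = conv-≋ (λ n → re-expPartial n y) (cos-lim y)

sinSum-conv : ∀ y → Conv (λ n → sinSum n y) (sin y)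
sinSum-conv y = conv-≋ (λ n → im-expPartial n y) (sin-lim y)

module Euler (M : ℚ) (0≤M : 0ℚ ℚ.≤ M) where

  -- This is M^k / k!, which bounds the k-th term of the exponential series at every argument of
  -- absolute value at most M.
  major : ℕ → ℝ
  major k = ⌜ DE.majorant M k ⌝

  major-suc : ∀ k → major (suc k) ≋ ⌜ recip k ⌝ * (⌜ M ⌝ * major k)
  major-suc k = ≋-trans (⌜⌝-* _ _) (*-cong ≋-refl (⌜⌝-* _ _))

  0≼major : ∀ k → 0r ≼ major k
  0≼major k = 0≼⌜⌝ (DE.0≤majorant 0≤M k)

  opaque
    -- The partial sums of the series of e^M are Cauchy, so from some N on they exceed the N-th by
    -- at most 1. The resulting `E` plays the part of e^M.
    major-sum : ∃[ E ] 0ℚ ℚ.≤ E × Ev (λ n → Σ< n major ≼ ⌜ E ⌝)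
    major-sum = case DE.uniform-cauchy M 0≤M 1ℚ (DR.0<recip 0) of λ (N , h) →
      ℚ.∣ partial N ∣ ℚ.+ 1ℚ ,
      DR.0≤+ {ℚ.∣ partial N ∣} {1ℚ} (ℚₚ.0≤∣p∣ (partial N)) (ℚₚ.<⇒≤ (DR.0<recip 0)) ,
      N , λ n n≥ → ≼-resp (partial-real n) ≋-refl (⌜⌝-mono (bound N n (h partial dominated n N n≥ ℕₚ.≤-refl)))
      where
      partial : ℕ → ℚ
      partial zero    = 0ℚ
      partial (suc n) = partial n ℚ.+ DE.majorant M n
      partial-real : ∀ n → ⌜ partial n ⌝ ≋ Σ< n major
      partial-real zero    = ≋-refl
      partial-real (suc n) = ≋-trans (⌜⌝-+ _ _) (≋-trans (+-cong (partial-real n) ≋-refl) (≋-sym (Σ<-snoc n major)))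
      dominated : DE.Dominated M 0≤M partial
      dominated k = ℚₚ.≤-reflexive (trans (cong ℚ.∣_∣ (cancel (partial k) (DE.majorant M k)))
        (ℚₚ.0≤p⇒∣p∣≡p (DE.0≤majorant 0≤M k)))
        where
        cancel : ∀ p q → p ℚ.+ q ℚ.- p ≡ q
        cancel = Q.solve 2 (λ p q → p Q.:+ q Q.:- p Q.:= q) refl
      bound : ∀ N n → ℚ.∣ partial n ℚ.- partial N ∣ ℚ.≤ 1ℚ → partial n ℚ.≤ ℚ.∣ partial N ∣ ℚ.+ 1ℚ
      bound N n h = ℚₚ.≤-trans (DR.sub⇒≤ {partial n} {partial N} {1ℚ} (abs≤⇒≤ {partial n ℚ.- partial N} h))
        (ℚₚ.+-monoˡ-≤ 1ℚ (DR.p≤abs (partial N)))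

  E : ℚ
  E = proj₁ major-sum

  0≤E : 0ℚ ℚ.≤ E
  0≤E = proj₁ (proj₂ major-sum)

  term-bound : ∀ k y → ∣ y ∣ ≼ ⌜ M ⌝ → ∣ cosTerm k y ∣ ≼ major k × ∣ sinTerm k y ∣ ≼ major k
  term-bound zero    y h = ≼-reflexive (∣∣-nonneg (0≼major 0)) , ≼-trans (≼-reflexive (∣∣-nonneg ≼-refl)) (0≼major 0)
  term-bound (suc k) y h =
    ∣∣-neg≼ (next (sinTerm k y) (proj₂ (term-bound k y h))) , next (cosTerm k y) (proj₁ (term-bound k y h))
    where
    next : ∀ t → ∣ t ∣ ≼ major k → ∣ ⌜ recip k ⌝ * (y * t) ∣ ≼ major (suc k)
    next t b = ≼-resp ≋-refl (≋-sym (major-suc k))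
      (∣∣-*≼ (≼-reflexive (∣∣-nonneg (0≼recip k))) (∣∣-*≼ h b))

  module _ (u y : ℝ) (∣u∣≼M : ∣ u ∣ ≼ ⌜ M ⌝) (∣y∣≼M : ∣ y ∣ ≼ ⌜ M ⌝) where

    private
      d d² : ℝ
      d = u - y
      d² = d * d

      0≼d² : 0r ≼ d²
      0≼d² = 0≼sq d

    -- The errors of the first-order expansion of the (k+1)-st terms at y.
    errC errS : ℕ → ℝ
    errC k = cosTerm (suc k) u - cosTerm (suc k) y + d * sinTerm k y
    errS k = sinTerm (suc k) u - sinTerm (suc k) y - d * cosTerm k y

    -- Equal to M^(k-1) / (k-1)!, with 0 at k = 0 because the first-order expansion of the terms of
    -- degree one is exact.
    prev : ℕ → ℝ
    prev zero    = 0r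
    prev (suc k) = major k

    M*prev : ∀ k → ⌜ M ⌝ * prev k ≋ ⌜ ι k ⌝ * major k
    M*prev zero    = ≋-trans (zeroʳ _) (≋-sym (zeroˡ _))
    M*prev (suc k) = ≋-sym (≋-trans (*-cong ≋-refl (major-suc k))
      (≋-trans (≋-sym (*-assoc _ _ _)) (≋-trans (*-cong (ι*recip k) ≋-refl) (*-identityˡ _))))

    -- By `M*prev`, M `prev k` + `major k` is (k+1) `major k`, and the factor 1/(k+2) outweighs k+1.
    step-bound : ∀ k t v w → ∣ t ∣ ≼ d² * prev k → ∣ v ∣ ≼ d² * major k →
                 w ≋ ⌜ recip (suc k) ⌝ * (u * t + v) → ∣ w ∣ ≼ d² * prev (suc k)
    step-bound k t v w ht hv eq = ≼-trans
      (≼-resp (∣∣-cong (≋-sym eq)) ≋-refl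
        (∣∣-*≼ (≼-reflexive (∣∣-nonneg (0≼recip (suc k)))) (∣∣-+≼ (∣∣-*≼ ∣u∣≼M ht) hv)))
      (≼-by (d² * major k * ⌜ recip (suc k) ⌝)
        (begin
          d² * major k
            ≈⟨ *-identityˡ _ ⟨
          1r * (d² * major k)
            ≈⟨ *-cong (≋-trans (*-cong (≋-sym (ι-+ 2 k)) ≋-refl) (ι*recip (suc k))) ≋-refl ⟨
          (⌜ ι 2 ⌝ + ⌜ ι k ⌝) * r * (d² * major k)
            ≈⟨ R.solve 4 (λ i r e m → (R.con (ι 2) R.:+ i) R.:* r R.:* (e R.:* m) R.:=
                 r R.:* (e R.:* (i R.:* m) R.:+ e R.:* m) R.:+ e R.:* m R.:* r) ≋-refl ⌜ ι k ⌝ r d² (major k) ⟩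
          r * (d² * (⌜ ι k ⌝ * major k) + d² * major k) + d² * major k * r
            ≈⟨ +-cong (*-cong ≋-refl (+-cong (*-cong ≋-refl (M*prev k)) ≋-refl)) ≋-refl ⟨
          r * (d² * (⌜ M ⌝ * prev k) + d² * major k) + d² * major k * r
            ≈⟨ +-cong (*-cong ≋-refl (+-cong (R.solve 3 (λ m e p → m R.:* (e R.:* p) R.:= e R.:* (m R.:* p)) ≋-refl ⌜ M ⌝ d² (prev k)) ≋-refl)) ≋-refl ⟨
          r * (⌜ M ⌝ * (d² * prev k) + d² * major k) + d² * major k * r
            ∎)
        (*-nonneg (*-nonneg 0≼d² (0≼major k)) (0≼recip (suc k))))
      where
      open ≋R
      r = ⌜ recip (suc k) ⌝

    scaled-sin : ∀ k → y * cosTerm k y ≋ ⌜ ι (suc k) ⌝ * sinTerm (suc k) y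
    scaled-sin k = ≋-sym (≋-trans (≋-sym (*-assoc _ _ _)) (≋-trans (*-cong (ι*recip k) ≋-refl) (*-identityˡ _)))

    scaled-cos : ∀ k → - (y * sinTerm k y) ≋ ⌜ ι (suc k) ⌝ * cosTerm (suc k) y
    scaled-cos k = ≋-sym (≋-trans
      (R.solve 3 (λ i r t → i R.:* R.:- (r R.:* t) R.:= R.:- (i R.:* r R.:* t)) ≋-refl ⌜ ι (suc k) ⌝ ⌜ recip k ⌝ (y * sinTerm k y))
      (neg-cong (≋-trans (*-cong (ι*recip k) ≋-refl) (*-identityˡ _))))

    recip-absorb : ∀ k t → t ≋ ⌜ recip (suc k) ⌝ * (t + ⌜ ι (suc k) ⌝ * t)
    recip-absorb k t = ≋-sym (begin
      r * (t + ⌜ ι (suc k) ⌝ * t)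
        ≈⟨ R.solve 3 (λ r t i → r R.:* (t R.:+ i R.:* t) R.:= (R.con 1ℚ R.:+ i) R.:* r R.:* t) ≋-refl r t ⌜ ι (suc k) ⌝ ⟩
      (1r + ⌜ ι (suc k) ⌝) * r * t
        ≈⟨ *-cong (*-cong (ι-+ 1 (suc k)) ≋-refl) ≋-refl ⟨
      ⌜ ι (suc (suc k)) ⌝ * r * t
        ≈⟨ *-cong (ι*recip (suc k)) ≋-refl ⟩
      1r * t
        ≈⟨ *-identityˡ t ⟩
      t ∎)
      where
      open ≋R
      r = ⌜ recip (suc k) ⌝

    -- The terms of degree k+2 are 1/(k+2) times u or y times terms of degree k+1. Writing s as (s +
    -- (k+1) s)/(k+2) and replacing (k+1) s by y c leaves u times the preceding error and a
    -- remainder d² c.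
    errC-suc : ∀ k → errC (suc k) ≋ ⌜ recip (suc k) ⌝ * (u * - errS k + - (d² * cosTerm k y))
    errC-suc k = begin
      errC (suc k)
        ≈⟨ +-cong ≋-refl (*-cong ≋-refl (recip-absorb k s)) ⟩
      - (r * (u * sinTerm (suc k) u)) - - (r * (y * s)) + d * (r * (s + i * s))
        ≈⟨ R.solve 6 (λ r u y s′ s is → (R.:- (r R.:* (u R.:* s′)) R.:- (R.:- (r R.:* (y R.:* s)))) R.:+ (u R.:- y) R.:* (r R.:* (s R.:+ is))
             R.:= r R.:* (u R.:* (R.:- (s′ R.:- s)) R.:+ (u R.:- y) R.:* is)) ≋-refl r u y (sinTerm (suc k) u) s (i * s) ⟩
      r * (u * - (sinTerm (suc k) u - s) + d * (i * s))
        ≈⟨ *-cong ≋-refl (+-cong ≋-refl (*-cong ≋-refl (scaled-sin k))) ⟨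
      r * (u * - (sinTerm (suc k) u - s) + d * (y * c))
        ≈⟨ R.solve 6 (λ r u y s′ s c → r R.:* (u R.:* (R.:- (s′ R.:- s)) R.:+ (u R.:- y) R.:* (y R.:* c)) R.:=
             r R.:* (u R.:* (R.:- (s′ R.:- s R.:- (u R.:- y) R.:* c)) R.:+ R.:- ((u R.:- y) R.:* (u R.:- y) R.:* c)))
             ≋-refl r u y (sinTerm (suc k) u) s c ⟩
      r * (u * - errS k + - (d² * c)) ∎
      where
      open ≋R
      r = ⌜ recip (suc k) ⌝
      s = sinTerm (suc k) y
      c = cosTerm k y
      i = ⌜ ι (suc k) ⌝

    errS-suc : ∀ k → errS (suc k) ≋ ⌜ recip (suc k) ⌝ * (u * errC k + - (d² * sinTerm k y))
    errS-suc k = begin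
      errS (suc k)
        ≈⟨ +-cong ≋-refl (neg-cong (*-cong ≋-refl (recip-absorb k c))) ⟩
      r * (u * cosTerm (suc k) u) - r * (y * c) - d * (r * (c + i * c))
        ≈⟨ R.solve 6 (λ r u y c′ c ic → (r R.:* (u R.:* c′) R.:- r R.:* (y R.:* c)) R.:- (u R.:- y) R.:* (r R.:* (c R.:+ ic))
             R.:= r R.:* (u R.:* (c′ R.:- c) R.:- (u R.:- y) R.:* ic)) ≋-refl r u y (cosTerm (suc k) u) c (i * c) ⟩
      r * (u * (cosTerm (suc k) u - c) - d * (i * c))
        ≈⟨ *-cong ≋-refl (+-cong ≋-refl (neg-cong (*-cong ≋-refl (scaled-cos k)))) ⟨
      r * (u * (cosTerm (suc k) u - c) - d * - (y * s))
        ≈⟨ R.solve 6 (λ r u y c′ c s → r R.:* (u R.:* (c′ R.:- c) R.:- (u R.:- y) R.:* R.:- (y R.:* s)) R.:=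
             r R.:* (u R.:* (c′ R.:- c R.:+ (u R.:- y) R.:* s) R.:+ R.:- ((u R.:- y) R.:* (u R.:- y) R.:* s)))
             ≋-refl r u y (cosTerm (suc k) u) c s ⟩
      r * (u * errC k + - (d² * s)) ∎
      where
      open ≋R
      r = ⌜ recip (suc k) ⌝
      c = cosTerm (suc k) y
      s = sinTerm k y
      i = ⌜ ι (suc k) ⌝

    ∣d²*∣ : ∀ {k t} → ∣ t ∣ ≼ major k → ∣ - (d² * t) ∣ ≼ d² * major k
    ∣d²*∣ h = ∣∣-neg≼ (∣∣-*≼ (≼-reflexive (∣∣-nonneg 0≼d²)) h)

    err-bound : ∀ k → ∣ errC k ∣ ≼ d² * prev k × ∣ errS k ∣ ≼ d² * prev k
    err-bound zero    = vanishes (begin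
        - (⌜ recip 0 ⌝ * (u * 0r)) - - (⌜ recip 0 ⌝ * (y * 0r)) + d * 0r
          ≈⟨ R.solve 3 (λ r u y → R.:- (r R.:* (u R.:* R.con 0ℚ)) R.:- R.:- (r R.:* (y R.:* R.con 0ℚ)) R.:+ (u R.:- y) R.:* R.con 0ℚ R.:= R.con 0ℚ)
               ≋-refl ⌜ recip 0 ⌝ u y ⟩
        0r ∎) , vanishes (begin
        1r * (u * 1r) - 1r * (y * 1r) - d * 1r
          ≈⟨ R.solve 2 (λ u y → R.con 1ℚ R.:* (u R.:* R.con 1ℚ) R.:- R.con 1ℚ R.:* (y R.:* R.con 1ℚ) R.:- (u R.:- y) R.:* R.con 1ℚ R.:= R.con 0ℚ)
               ≋-refl u y ⟩
        0r ∎)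
      where
      open ≋R
      vanishes : ∀ {t} → t ≋ 0r → ∣ t ∣ ≼ d² * 0r
      vanishes e = ≼-trans (≼-reflexive (≋-trans (∣∣-cong e) (∣∣-nonneg ≼-refl))) (≼-reflexive (≋-sym (zeroʳ d²)))
    err-bound (suc k) =
      step-bound k (- errS k) (- (d² * cosTerm k y)) _ (∣∣-neg≼ (proj₂ (err-bound k))) (∣d²*∣ {k} {cosTerm k y} (proj₁ (term-bound k y ∣y∣≼M))) (errC-suc k) ,
      step-bound k (errC k) (- (d² * sinTerm k y)) _ (proj₁ (err-bound k)) (∣d²*∣ {k} {sinTerm k y} (proj₂ (term-bound k y ∣y∣≼M))) (errS-suc k)

    -- `prev` starts with 0, so its sum over n + 1 indices is the sum of `major` over n.
    Σerr-bound : ∀ n (f : ℕ → ℝ) → (∀ k → ∣ f k ∣ ≼ d² * prev k) → Σ< n major ≼ ⌜ E ⌝ → ∣ Σ< (suc n) f ∣ ≼ ⌜ E ⌝ * d²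
    Σerr-bound n f h b = ≼-trans (sum-abs {suc n} (λ i → f (toℕ i)))
      (≼-trans (Σ<-mono (suc n) {λ k → ∣ f k ∣} {λ k → d² * prev k} (λ k _ → h k))
        (≼-trans (≼-reflexive (≋-trans (Σ<-scale (suc n) d² prev) (*-cong ≋-refl (+-identityˡ _))))
          (≼-trans (≼-*ˡ 0≼d² b) (≼-reflexive (*-comm d² ⌜ E ⌝)))))

    -- The termwise expansions add up to one for the partial sums, and the bound passes to the
    -- limit. The cosine sum runs one degree further than the sine sum because `errC k` pairs the
    -- degrees k+1 and k.
    cos-euler : ∣ cos u - cos y + d * sin y ∣ ≼ ⌜ E ⌝ * d²
    cos-euler = conv-bound
      (conv-+ (conv-+ (conv-suc (conv-suc (cosSum-conv u))) (conv-neg (conv-suc (conv-suc (cosSum-conv y)))))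
        (conv-scale d (conv-suc (sinSum-conv y))))
      (ev-map (λ n b → ≼-resp (∣∣-cong (telescope n)) ≋-refl (Σerr-bound n errC (λ k → proj₁ (err-bound k)) b))
        (proj₂ (proj₂ major-sum)))
      where
      telescope : ∀ n → Σ< (suc n) errC ≋ cosSum (suc (suc n)) u - cosSum (suc (suc n)) y + d * sinSum (suc n) y
      telescope n = ≋-trans (Σ<-+ (suc n) (λ k → cosTerm (suc k) u - cosTerm (suc k) y) (λ k → d * sinTerm k y))
        (+-cong (≋-trans (≋-sym (sum-- {suc n} (λ i → cosTerm (suc (toℕ i)) u) (λ i → cosTerm (suc (toℕ i)) y)))
            (R.solve 3 (λ o p q → p R.:- q R.:= (o R.:+ p) R.:- (o R.:+ q)) ≋-refl 1r
              (Σ< (suc n) (λ k → cosTerm (suc k) u)) (Σ< (suc n) (λ k → cosTerm (suc k) y))))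
          (Σ<-scale (suc n) d (λ k → sinTerm k y)))

    sin-euler : ∣ sin u - sin y - d * cos y ∣ ≼ ⌜ E ⌝ * d²
    sin-euler = conv-bound
      (conv-+ (conv-+ (conv-suc (conv-suc (sinSum-conv u))) (conv-neg (conv-suc (conv-suc (sinSum-conv y)))))
        (conv-neg (conv-scale d (conv-suc (cosSum-conv y)))))
      (ev-map (λ n b → ≼-resp (∣∣-cong (telescope n)) ≋-refl (Σerr-bound n errS (λ k → proj₂ (err-bound k)) b))
        (proj₂ (proj₂ major-sum)))
      where
      telescope : ∀ n → Σ< (suc n) errS ≋ sinSum (suc (suc n)) u - sinSum (suc (suc n)) y - d * cosSum (suc n) y
      telescope n = ≋-trans (Σ<-+ (suc n) (λ k → sinTerm (suc k) u - sinTerm (suc k) y) (λ k → - (d * cosTerm k y)))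
        (+-cong (≋-trans (≋-sym (sum-- {suc n} (λ i → sinTerm (suc (toℕ i)) u) (λ i → sinTerm (suc (toℕ i)) y)))
            (R.solve 3 (λ o p q → p R.:- q R.:= (o R.:+ p) R.:- (o R.:+ q)) ≋-refl 0r
              (Σ< (suc n) (λ k → sinTerm (suc k) u)) (Σ< (suc n) (λ k → sinTerm (suc k) y))))
          (≋-trans (sum-neg {suc n} (λ i → d * cosTerm (toℕ i) y)) (neg-cong (Σ<-scale (suc n) d (λ k → cosTerm k y)))))

  module _ (y : ℝ) (∣y∣≼M : ∣ y ∣ ≼ ⌜ M ⌝) where

    Σterm-bound : ∀ n (f : ℕ → ℝ) → (∀ k → ∣ f k ∣ ≼ major k) → Σ< n major ≼ ⌜ E ⌝ → ∣ Σ< n f ∣ ≼ ⌜ E ⌝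
    Σterm-bound n f h b = ≼-trans (sum-abs {n} (λ i → f (toℕ i)))
      (≼-trans (Σ<-mono n {λ k → ∣ f k ∣} {major} (λ k _ → h k)) b)

    -- The bound by 1 will come out of the invariance of inner products, whose proof needs some
    -- bound beforehand; the crude one suffices.
    cos-bound : ∣ cos y ∣ ≼ ⌜ E ⌝
    cos-bound = conv-bound (cosSum-conv y)
      (ev-map (λ n → Σterm-bound n (λ k → cosTerm k y) (λ k → proj₁ (term-bound k y ∣y∣≼M))) (proj₂ (proj₂ major-sum)))

    sin-bound : ∣ sin y ∣ ≼ ⌜ E ⌝
    sin-bound = conv-bound (sinSum-conv y)
      (ev-map (λ n → Σterm-bound n (λ k → sinTerm k y) (λ k → proj₂ (term-bound k y ∣y∣≼M))) (proj₂ (proj₂ major-sum)))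

-- Motions by Euler steps and the addition theorems

drift : ∀ n (s : ℕ → ℝ) c → (∀ k → k ℕ.< n → ∣ s (suc k) - s k ∣ ≼ c) → ∣ s n - s 0 ∣ ≼ ⌜ ι n ⌝ * c
drift zero    s c h = ≼-reflexive (≋-trans (∣∣-cong (-‿inverseʳ (s 0))) (≋-trans (∣∣-nonneg ≼-refl) (≋-sym (zeroˡ c))))
drift (suc n) s c h = ≼-trans (∣∣-triangle (s (suc n)) (s n) (s 0))
  (≼-trans (≼-mono-+ (h n ℕₚ.≤-refl) (drift n s c (λ k k<n → h k (ℕₚ.m≤n⇒m≤1+n k<n))))
    (≼-reflexive (≋-trans (R.solve 2 (λ c i → c R.:+ i R.:* c R.:= (R.con 1ℚ R.:+ i) R.:* c) ≋-refl c ⌜ ι n ⌝)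
      (*-cong (≋-sym (ι-+ 1 n)) ≋-refl))))

-- (f , g) and (c , s) move by an Euler step of angle d up to η; then the inner
-- product f c + g s is stationary to second order in d.
rotation-step : ∀ {f g f′ g′ c s c′ s′ d E D η} →
  0r ≼ D →
  ∣ f ∣ ≼ E → ∣ g ∣ ≼ E → ∣ c ∣ ≼ E → ∣ s ∣ ≼ E → ∣ c′ ∣ ≼ E → ∣ s′ ∣ ≼ E → ∣ d ∣ ≼ D →
  ∣ f′ - f + d * g ∣ ≼ η → ∣ g′ - g - d * f ∣ ≼ η → ∣ c′ - c + d * s ∣ ≼ η → ∣ s′ - s - d * c ∣ ≼ η →
  ∣ (f′ * c′ + g′ * s′) - (f * c + g * s) ∣ ≼
    (η * E + (E + D * E) * η) + (η * E + (E + D * E) * η) + d * d * (E * E + E * E)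
rotation-step {f} {g} {f′} {g′} {c} {s} {c′} {s′} {d} {E} {D} {η} 0≼D f≼ g≼ c≼ s≼ c′≼ s′≼ d≼ ef eg ec es =
  ≼-resp (∣∣-cong (≋-sym identity)) ≋-refl
    (∣∣-+≼ (∣∣-+≼ (∣∣-+≼ (∣∣-*≼ ef c′≼) (∣∣-*≼ (∣∣-+≼ f≼ (∣∣-neg≼ (∣∣-*≼ d≼ g≼))) ec))
                  (∣∣-+≼ (∣∣-*≼ eg s′≼) (∣∣-*≼ (∣∣-+≼ g≼ (∣∣-*≼ d≼ f≼)) es)))
      (∣∣-*≼ (≼-reflexive (∣∣-nonneg (0≼sq d))) (∣∣-+≼ (∣∣-*≼ f≼ c≼) (∣∣-*≼ g≼ s≼))))
  where
  expand : ∀ f f′ c c′ x y → f′ * c′ ≋ (f′ - f + x) * c′ + (f - x) * (c′ - c + y) + (f - x) * (c - y)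
  expand = R.solve 6 (λ f f′ c c′ x y → f′ R.:* c′ R.:=
    (f′ R.:- f R.:+ x) R.:* c′ R.:+ (f R.:- x) R.:* (c′ R.:- c R.:+ y) R.:+ (f R.:- x) R.:* (c R.:- y)) ≋-refl
  expand′ : ∀ f f′ c c′ x y → f′ * c′ ≋ (f′ - f - x) * c′ + (f + x) * (c′ - c - y) + (f + x) * (c + y)
  expand′ = R.solve 6 (λ f f′ c c′ x y → f′ R.:* c′ R.:=
    (f′ R.:- f R.:- x) R.:* c′ R.:+ (f R.:+ x) R.:* (c′ R.:- c R.:- y) R.:+ (f R.:+ x) R.:* (c R.:+ y)) ≋-refl
  -- Exact Euler steps multiply the inner product by 1 + d²; this is the only change not caused by
  -- the errors η.
  cancel : ∀ f g c s d →
    (f - d * g) * (c - d * s) + (g + d * f) * (s + d * c) ≋ d * d * (f * c + g * s) + (f * c + g * s)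
  cancel = R.solve 5 (λ f g c s d →
    (f R.:- d R.:* g) R.:* (c R.:- d R.:* s) R.:+ (g R.:+ d R.:* f) R.:* (s R.:+ d R.:* c) R.:=
    d R.:* d R.:* (f R.:* c R.:+ g R.:* s) R.:+ (f R.:* c R.:+ g R.:* s)) ≋-refl
  X Y : ℝ
  X = (f′ - f + d * g) * c′ + (f - d * g) * (c′ - c + d * s)
  Y = (g′ - g - d * f) * s′ + (g + d * f) * (s′ - s - d * c)
  identity : (f′ * c′ + g′ * s′) - (f * c + g * s) ≋ X + Y + d * d * (f * c + g * s)
  identity = ≋-trans (+-cong (+-cong (expand f f′ c c′ (d * g) (d * s)) (expand′ g g′ s s′ (d * f) (d * c))) ≋-refl)
    (≋-trans (R.solve 5 (λ x y p q r → x R.:+ p R.:+ (y R.:+ q) R.:- r R.:= x R.:+ y R.:+ (p R.:+ q R.:- r)) ≋-refl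
        X Y ((f - d * g) * (c - d * s)) ((g + d * f) * (s + d * c)) (f * c + g * s))
      (+-cong ≋-refl (≋-trans (+-cong (cancel f g c s d) ≋-refl)
        (R.solve 2 (λ p q → p R.:+ q R.:- q R.:= p) ≋-refl (d * d * (f * c + g * s)) (f * c + g * s)))))

-- The equations f′ = -g and g′ = f with an explicit quadratic error, on |y| ≤ M. They are
-- abstracted from cos and sin so that shifted pairs and quarter turns qualify too.
record IsRotation (M E : ℚ) (f g : ℝ → ℝ) : Set where
  field
    bound₁ : ∀ y → ∣ y ∣ ≼ ⌜ M ⌝ → ∣ f y ∣ ≼ ⌜ E ⌝
    bound₂ : ∀ y → ∣ y ∣ ≼ ⌜ M ⌝ → ∣ g y ∣ ≼ ⌜ E ⌝
    euler₁ : ∀ u y → ∣ u ∣ ≼ ⌜ M ⌝ → ∣ y ∣ ≼ ⌜ M ⌝ → ∣ f u - f y + (u - y) * g y ∣ ≼ ⌜ E ⌝ * ((u - y) * (u - y))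
    euler₂ : ∀ u y → ∣ u ∣ ≼ ⌜ M ⌝ → ∣ y ∣ ≼ ⌜ M ⌝ → ∣ g u - g y - (u - y) * f y ∣ ≼ ⌜ E ⌝ * ((u - y) * (u - y))

  -- This is f + i g multiplied by -i, which keeps the angular speed.
  quarter-turn : IsRotation M E g (λ y → - f y)
  quarter-turn = record
    { bound₁ = bound₂
    ; bound₂ = λ y h → ∣∣-neg≼ (bound₁ y h)
    ; euler₁ = λ u y h k → ≼-resp (∣∣-cong (R.solve 4 (λ a b d c → a R.:- b R.:- d R.:* c R.:= a R.:- b R.:+ d R.:* R.:- c)
        ≋-refl (g u) (g y) (u - y) (f y))) ≋-refl (euler₂ u y h k)
    ; euler₂ = λ u y h k → ≼-resp (≋-trans (≋-sym (∣∣-neg _)) (∣∣-cong (R.solve 4 (λ a b d c →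
        R.:- (a R.:- b R.:+ d R.:* c) R.:= R.:- a R.:- R.:- b R.:- d R.:* c)
        ≋-refl (f u) (f y) (u - y) (g y)))) ≋-refl (euler₁ u y h k) }

  private
    lipschitz : ∀ {p q r d e} → e ≋ p - q + d * r → ∣ e ∣ ≼ ⌜ E ⌝ * (d * d) → ∣ d ∣ ≼ ⌜ M ⌝ + ⌜ M ⌝ → ∣ r ∣ ≼ ⌜ E ⌝ →
      ∣ p - q ∣ ≼ (⌜ E ⌝ + ⌜ E ⌝ * (⌜ M ⌝ + ⌜ M ⌝)) * ∣ d ∣
    lipschitz {p} {q} {r} {d} {e} eq h dM rE = ≼-trans
      (≼-resp (∣∣-cong (≋-trans (+-cong eq ≋-refl)
          (R.solve 3 (λ p q x → p R.:- q R.:+ x R.:- x R.:= p R.:- q) ≋-refl p q (d * r)))) ≋-refl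
        (∣∣-+≼ h (∣∣-neg≼ (∣∣-*≼ {d} ≼-refl rE))))
      (≼-trans (≼-mono-+ (≼-trans (≼-reflexive (*-cong ≋-refl (≋-sym (∣∣-sq d)))) (≼-*ˡ 0≼E (≼-*ˡ (0≼∣∣ d) dM))) ≼-refl)
        (≼-reflexive (R.solve 3 (λ e m a → e R.:* (a R.:* m) R.:+ a R.:* e R.:= (e R.:+ e R.:* m) R.:* a) ≋-refl ⌜ E ⌝ (⌜ M ⌝ + ⌜ M ⌝) ∣ d ∣)))
      where
      0≼E : 0r ≼ ⌜ E ⌝
      0≼E = ≼-trans (0≼∣∣ r) rE

  L : ℝ
  L = ⌜ E ⌝ + ⌜ E ⌝ * (⌜ M ⌝ + ⌜ M ⌝)

  lipschitz₁ : ∀ u y → ∣ u ∣ ≼ ⌜ M ⌝ → ∣ y ∣ ≼ ⌜ M ⌝ → ∣ f u - f y ∣ ≼ L * ∣ u - y ∣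
  lipschitz₁ u y h k = lipschitz ≋-refl (euler₁ u y h k) (∣∣-+≼ h (∣∣-neg≼ k)) (bound₂ y k)

  lipschitz₂ : ∀ u y → ∣ u ∣ ≼ ⌜ M ⌝ → ∣ y ∣ ≼ ⌜ M ⌝ → ∣ g u - g y ∣ ≼ L * ∣ u - y ∣
  lipschitz₂ u y h k = lipschitz
    (R.solve 3 (λ a d c → a R.:- d R.:* c R.:= a R.:+ d R.:* R.:- c) ≋-refl (g u - g y) (u - y) (f y))
    (euler₂ u y h k) (∣∣-+≼ h (∣∣-neg≼ k)) (∣∣-neg≼ (bound₁ y k))

  private
    cong-from : ∀ {p q u y} → ∣ p - q ∣ ≼ L * ∣ u - y ∣ → u ≋ y → p ≋ q
    cong-from {u = u} {y} h e = ≋-of-zero (≼-trans h (≼-reflexive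
      (≋-trans (*-cong ≋-refl (≋-trans (∣∣-cong (≋-trans (+-cong e ≋-refl) (-‿inverseʳ y))) (∣∣-nonneg ≼-refl))) (zeroʳ L))))

  -- The Lipschitz bound vanishes at equal arguments, so congruence needs no look at the sequences
  -- that define `exp`.
  resp₁ : ∀ {u y} → ∣ y ∣ ≼ ⌜ M ⌝ → u ≋ y → f u ≋ f y
  resp₁ {u} {y} h e = cong-from (lipschitz₁ u y (≼-resp (∣∣-cong (≋-sym e)) ≋-refl h) h) e

  resp₂ : ∀ {u y} → ∣ y ∣ ≼ ⌜ M ⌝ → u ≋ y → g u ≋ g y
  resp₂ {u} {y} h e = cong-from (lipschitz₂ u y (≼-resp (∣∣-cong (≋-sym e)) ≋-refl h) h) e

open IsRotation

module _ {M E f g c s} (fg : IsRotation M E f g) (cs : IsRotation M E c s) where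

  -- The derivative of the inner product is 0. In discrete form: n + 1 steps of length t/(n+1)
  -- change it by at most K t²/(n+1)² each, hence by K t²/(n+1) in total, for every n.
  rotation-invariant : ∀ t → ∣ t ∣ ≼ ⌜ M ⌝ → f t * c t + g t * s t ≋ f 0r * c 0r + g 0r * s 0r
  rotation-invariant t t≼M = ≋-squeeze (t * t * K) 0 λ n _ → estimate n
    where
    K : ℝ
    K = (⌜ E ⌝ * ⌜ E ⌝ + (⌜ E ⌝ + ⌜ M ⌝ * ⌜ E ⌝) * ⌜ E ⌝) + (⌜ E ⌝ * ⌜ E ⌝ + (⌜ E ⌝ + ⌜ M ⌝ * ⌜ E ⌝) * ⌜ E ⌝)
        + (⌜ E ⌝ * ⌜ E ⌝ + ⌜ E ⌝ * ⌜ E ⌝)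
    0≼M : 0r ≼ ⌜ M ⌝
    0≼M = ≼-trans (0≼∣∣ t) t≼M
    F : ℝ → ℝ
    F y = f y * c y + g y * s y
    F-cong : ∀ {u y} → ∣ y ∣ ≼ ⌜ M ⌝ → u ≋ y → F u ≋ F y
    F-cong h e = +-cong (*-cong (resp₁ fg h e) (resp₁ cs h e)) (*-cong (resp₂ fg h e) (resp₂ cs h e))
    module _ (n : ℕ) where
      r h : ℝ
      r = ⌜ recip n ⌝
      h = r * t
      point : ℕ → ℝ
      point k = ⌜ ι k ⌝ * h
      increment : ∀ k → point (suc k) - point k ≋ h
      increment k = ≋-trans (+-cong (*-cong (ι-+ 1 k) ≋-refl) ≋-refl)
        (R.solve 2 (λ i h → (R.con 1ℚ R.:+ i) R.:* h R.:- i R.:* h R.:= h) ≋-refl ⌜ ι k ⌝ h)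
      point-end : point (suc n) ≋ t
      point-end = ≋-trans (≋-sym (*-assoc _ _ _)) (≋-trans (*-cong (ι*recip n) ≋-refl) (*-identityˡ t))
      ∣point∣ : ∀ k → k ℕ.≤ suc n → ∣ point k ∣ ≼ ⌜ M ⌝
      ∣point∣ k k≤ = ≼-trans (∣∣-*≼ (≼-trans (≼-reflexive (∣∣-nonneg (0≼ι k))) (⌜⌝-mono (DR.ι-mono k≤))) (≼-refl {∣ h ∣}))
        (≼-trans (≼-reflexive (≋-trans (*-cong (≋-sym (∣∣-nonneg (0≼ι (suc n)))) ≋-refl)
           (≋-trans (≋-sym (∣∣-* _ _)) (∣∣-cong point-end)))) t≼M)
      h≼M : ∣ h ∣ ≼ ⌜ M ⌝
      h≼M = ≼-resp (∣∣-cong (≋-trans (*-cong ≋-refl ≋-refl) (*-identityˡ h))) ≋-refl (∣point∣ 1 (ℕ.s≤s ℕ.z≤n))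
      step : ∀ k → k ℕ.< suc n → ∣ F (point (suc k)) - F (point k) ∣ ≼ h * h * K
      step k k<n = ≼-trans
        (rotation-step {d = d} 0≼M (bound₁ fg y y≼) (bound₂ fg y y≼) (bound₁ cs y y≼) (bound₂ cs y y≼) (bound₁ cs u u≼) (bound₂ cs u u≼)
          (≼-trans (≼-reflexive (∣∣-cong (increment k))) h≼M)
          (euler₁ fg u y u≼ y≼) (euler₂ fg u y u≼ y≼) (euler₁ cs u y u≼ y≼) (euler₂ cs u y u≼ y≼))
        (≼-reflexive (≋-trans
          (R.solve 3 (λ e m q → (e R.:* q R.:* e R.:+ (e R.:+ m R.:* e) R.:* (e R.:* q)) R.:+ (e R.:* q R.:* e R.:+ (e R.:+ m R.:* e) R.:* (e R.:* q))
               R.:+ q R.:* (e R.:* e R.:+ e R.:* e) R.:=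
               q R.:* ((e R.:* e R.:+ (e R.:+ m R.:* e) R.:* e) R.:+ (e R.:* e R.:+ (e R.:+ m R.:* e) R.:* e) R.:+ (e R.:* e R.:+ e R.:* e)))
             ≋-refl ⌜ E ⌝ ⌜ M ⌝ (d * d))
          (*-cong (*-cong (increment k) (increment k)) ≋-refl)))
        where
        u y d : ℝ
        u = point (suc k)
        y = point k
        d = u - y
        u≼ : ∣ u ∣ ≼ ⌜ M ⌝
        u≼ = ∣point∣ (suc k) k<n
        y≼ : ∣ y ∣ ≼ ⌜ M ⌝
        y≼ = ∣point∣ k (ℕₚ.<⇒≤ k<n)
      estimate : ∣ F t - F 0r ∣ ≼ t * t * K * r
      estimate = ≼-resp
        (∣∣-cong (+-cong (F-cong t≼M point-end)
          (neg-cong (F-cong (≼-trans (≼-reflexive (∣∣-nonneg ≼-refl)) 0≼M) (zeroˡ h)))))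
        (≋-trans (R.solve 4 (λ i r t k → i R.:* (r R.:* t R.:* (r R.:* t) R.:* k) R.:= i R.:* r R.:* (t R.:* t R.:* k R.:* r))
            ≋-refl ⌜ ι (suc n) ⌝ r t K)
          (≋-trans (*-cong (ι*recip n) ≋-refl) (*-identityˡ _)))
        (drift (suc n) (λ k → F (point k)) (h * h * K) step)

module _ (M : ℚ) (0≤M : 0ℚ ℚ.≤ M) where
  open Euler M 0≤M using (E; cos-bound; sin-bound; cos-euler; sin-euler)

  cos-sin-rotation : IsRotation M E cos sin
  cos-sin-rotation = record { bound₁ = cos-bound ; bound₂ = sin-bound ; euler₁ = cos-euler ; euler₂ = sin-euler }

restrict : ∀ {M N E f g} → N ℚ.≤ M → IsRotation M E f g → IsRotation N E f g
restrict {M} {N} N≤M r = record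
  { bound₁ = λ y h → bound₁ r y (up h)
  ; bound₂ = λ y h → bound₂ r y (up h)
  ; euler₁ = λ u y h k → euler₁ r u y (up h) (up k)
  ; euler₂ = λ u y h k → euler₂ r u y (up h) (up k) }
  where
  up : ∀ {y} → ∣ y ∣ ≼ ⌜ N ⌝ → ∣ y ∣ ≼ ⌜ M ⌝
  up h = ≼-trans h (⌜⌝-mono N≤M)

shift : ∀ {A M E f g} s → ∣ s ∣ ≼ ⌜ A ⌝ → IsRotation (A ℚ.+ M) E f g → IsRotation M E (λ t → f (s + t)) (λ t → g (s + t))
shift {A} {M} {E} {f} {g} s s≼A r = record
  { bound₁ = λ y h → bound₁ r (s + y) (up h)
  ; bound₂ = λ y h → bound₂ r (s + y) (up h)
  ; euler₁ = λ u y h k → ≼-resp (∣∣-cong (+-cong ≋-refl (*-cong (diff u y) ≋-refl)))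
      (*-cong ≋-refl (*-cong (diff u y) (diff u y))) (euler₁ r (s + u) (s + y) (up h) (up k))
  ; euler₂ = λ u y h k → ≼-resp (∣∣-cong (+-cong ≋-refl (neg-cong (*-cong (diff u y) ≋-refl))))
      (*-cong ≋-refl (*-cong (diff u y) (diff u y))) (euler₂ r (s + u) (s + y) (up h) (up k)) }
  where
  up : ∀ {y} → ∣ y ∣ ≼ ⌜ M ⌝ → ∣ s + y ∣ ≼ ⌜ A ℚ.+ M ⌝
  up h = ≼-trans (∣∣-+≼ s≼A h) (≼-reflexive (≋-sym (⌜⌝-+ A M)))
  diff : ∀ u y → s + u - (s + y) ≋ u - y
  diff u y = R.solve 3 (λ s u y → s R.:+ u R.:- (s R.:+ y) R.:= u R.:- y) ≋-refl s u y

cos-cong : ∀ {x y} → x ≋ y → cos x ≋ cos y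
cos-cong {x} {y} e = case archimedean y of λ (M , 0≤M , h) → resp₁ (cos-sin-rotation M 0≤M) h e

sin-cong : ∀ {x y} → x ≋ y → sin x ≋ sin y
sin-cong {x} {y} e = case archimedean y of λ (M , 0≤M , h) → resp₂ (cos-sin-rotation M 0≤M) h e

cosTerm-suc-0 : ∀ k → cosTerm (suc k) 0r ≋ 0r
cosTerm-suc-0 k = ≋-trans (neg-cong (*-cong ≋-refl (zeroˡ _))) (R.solve 1 (λ r → R.:- (r R.:* R.con 0ℚ) R.:= R.con 0ℚ) ≋-refl ⌜ recip k ⌝)

sinTerm-0 : ∀ k → sinTerm k 0r ≋ 0r
sinTerm-0 zero    = ≋-refl
sinTerm-0 (suc k) = ≋-trans (*-cong ≋-refl (zeroˡ _)) (zeroʳ _)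

cos-0 : cos 0r ≋ 1r
cos-0 = conv-unique (conv-suc (cosSum-conv 0r))
  (conv-≋ (λ n → ≋-sym (≋-trans (+-cong ≋-refl (Σ<-zero n (λ k _ → cosTerm-suc-0 k))) (+-identityʳ 1r))) (conv-const 1r))

sin-0 : sin 0r ≋ 0r
sin-0 = conv-unique (sinSum-conv 0r) (conv-≋ (λ n → ≋-sym (Σ<-zero n (λ k _ → sinTerm-0 k))) (conv-const 0r))

at-0 : ∀ {p q c s p′} → p ≋ p′ → c ≋ 1r → s ≋ 0r → p * c + q * s ≋ p′
at-0 {p} {q} {p′ = p′} e ec es = ≋-trans (+-cong (*-cong e ec) (*-cong ≋-refl es))
  (R.solve 2 (λ p q → p R.:* R.con 1ℚ R.:+ q R.:* R.con 0ℚ R.:= p) ≋-refl p′ q)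

module _ (s t : ℝ) where

  private
    A B : ℚ
    A = proj₁ (archimedean s)
    B = proj₁ (archimedean t)
    0≤A : 0ℚ ℚ.≤ A
    0≤A = proj₁ (proj₂ (archimedean s))
    0≤A+B : 0ℚ ℚ.≤ A ℚ.+ B
    0≤A+B = DR.0≤+ {A} {B} 0≤A (proj₁ (proj₂ (archimedean t)))
    full = cos-sin-rotation (A ℚ.+ B) 0≤A+B
    shifted : IsRotation B _ (λ t → cos (s + t)) (λ t → sin (s + t))
    shifted = shift s (proj₂ (proj₂ (archimedean s))) full
    plain : IsRotation B _ cos sin
    plain = restrict (≤-by {B} {A ℚ.+ B} A (ℚₚ.+-comm A B) 0≤A) full
    t≼B : ∣ t ∣ ≼ ⌜ B ⌝
    t≼B = proj₂ (proj₂ (archimedean t))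

  -- The pair shifted by s and the plain pair turn at the same speed, so their inner product keeps
  -- its value at t = 0.
  cos-diff : cos (s + t) * cos t + sin (s + t) * sin t ≋ cos s
  cos-diff = ≋-trans (rotation-invariant shifted plain t t≼B) (at-0 (cos-cong (+-identityʳ s)) cos-0 sin-0)

  -- The same argument after a quarter turn of the shifted pair, which is then (sin, -cos).
  sin-diff : sin (s + t) * cos t + - cos (s + t) * sin t ≋ sin s
  sin-diff = ≋-trans (rotation-invariant (quarter-turn shifted) plain t t≼B) (at-0 (sin-cong (+-identityʳ s)) cos-0 sin-0)

cos²+sin² : ∀ t → cos t * cos t + sin t * sin t ≋ 1r
cos²+sin² t = ≋-trans
  (+-cong (*-cong (cos-cong (≋-sym (+-identityˡ t))) ≋-refl) (*-cong (sin-cong (≋-sym (+-identityˡ t))) ≋-refl))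
  (≋-trans (cos-diff 0r t) cos-0)

-- `cos-diff` and `sin-diff` form a linear system for cos (s + t) and sin (s + t) whose matrix is
-- orthogonal because cos² + sin² = 1; it is solved with the transpose.
cos-+ : ∀ s t → cos (s + t) ≋ cos s * cos t - sin s * sin t
cos-+ s t = ≋-sym (≋-trans
  (+-cong (*-cong (≋-sym (cos-diff s t)) ≋-refl) (neg-cong (*-cong (≋-sym (sin-diff s t)) ≋-refl)))
  (≋-trans (R.solve 4 (λ p q c s → (p R.:* c R.:+ q R.:* s) R.:* c R.:- (q R.:* c R.:+ R.:- p R.:* s) R.:* s R.:=
      p R.:* (c R.:* c R.:+ s R.:* s)) ≋-refl (cos (s + t)) (sin (s + t)) (cos t) (sin t))
    (≋-trans (*-cong ≋-refl (cos²+sin² t)) (*-identityʳ _))))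

sin-+ : ∀ s t → sin (s + t) ≋ sin s * cos t + cos s * sin t
sin-+ s t = ≋-sym (≋-trans
  (+-cong (*-cong (≋-sym (sin-diff s t)) ≋-refl) (*-cong (≋-sym (cos-diff s t)) ≋-refl))
  (≋-trans (R.solve 4 (λ p q c s → (q R.:* c R.:+ R.:- p R.:* s) R.:* c R.:+ (p R.:* c R.:+ q R.:* s) R.:* s R.:=
      q R.:* (c R.:* c R.:+ s R.:* s)) ≋-refl (cos (s + t)) (sin (s + t)) (cos t) (sin t))
    (≋-trans (*-cong ≋-refl (cos²+sin² t)) (*-identityʳ _))))

cos-neg : ∀ t → cos (- t) ≋ cos t
cos-neg t = ≋-trans (≋-sym (cos-diff (- t) t)) (≋-trans
  (+-cong (*-cong (≋-trans (cos-cong (+-inverseˡ t)) cos-0) ≋-refl) (*-cong (≋-trans (sin-cong (+-inverseˡ t)) sin-0) ≋-refl))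
  (R.solve 2 (λ c s → R.con 1ℚ R.:* c R.:+ R.con 0ℚ R.:* s R.:= c) ≋-refl (cos t) (sin t)))

sin-neg : ∀ t → sin (- t) ≋ - sin t
sin-neg t = ≋-trans (≋-sym (sin-diff (- t) t)) (≋-trans
  (+-cong (*-cong (≋-trans (sin-cong (+-inverseˡ t)) sin-0) ≋-refl) (*-cong (neg-cong (≋-trans (cos-cong (+-inverseˡ t)) cos-0)) ≋-refl))
  (R.solve 2 (λ c s → R.con 0ℚ R.:* c R.:+ R.:- R.con 1ℚ R.:* s R.:= R.:- s) ≋-refl (cos t) (sin t)))

-- The value of π

two : ℝ
two = ⌜ ι 2 ⌝

times-one : ∀ {x p} → p ≋ 1r → x ≋ x * p
times-one {x} e = ≋-sym (≋-trans (*-cong ≋-refl e) (*-identityʳ x))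

-- ((1 - x²) A , 2 x A) is the point (1 + ix)/(1 - ix) of the unit circle; as x
-- grows to y it turns by the angle 2 (y - x) A up to second order.
module _ {x y A B : ℝ} (hA : A * (1r + x * x) ≋ 1r) (hB : B * (1r + y * y) ≋ 1r) where

  private
    h : ℝ
    h = y - x

    AA : A * (1r + x * x) * (A * (1r + x * x)) ≋ 1r
    AA = ≋-trans (*-cong hA hA) (*-identityˡ 1r)

    AB′ : A * (1r + x * x) * (B * (1r + y * y)) ≋ 1r
    AB′ = ≋-trans (*-cong hA hB) (*-identityˡ 1r)

  -- Multiplying by factors equal to 1 makes both sides homogeneous in A and B,
  -- after which the claim is a ring identity.
  cayley-re : (1r - y * y) * B - (1r - x * x) * A + two * h * A * (two * x * A)
    ≋ A * A * B * (⌜ ι 6 ⌝ * (x * x) - two + ⌜ ι 4 ⌝ * (x * h)) * (h * h)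
  cayley-re = ≋-trans
    (+-cong (+-cong (times-one AA) (neg-cong (times-one AB′))) (times-one hB))
    (R.solve 4 (λ x y A B → let o = R.con 1ℚ ; t = R.con (ι 2) ; h = y R.:- x
                                p = A R.:* (o R.:+ x R.:* x) ; q = B R.:* (o R.:+ y R.:* y) in
      (o R.:- y R.:* y) R.:* B R.:* (p R.:* p) R.:- (o R.:- x R.:* x) R.:* A R.:* (p R.:* q)
        R.:+ t R.:* h R.:* A R.:* (t R.:* x R.:* A) R.:* q R.:=
      A R.:* A R.:* B R.:* (R.con (ι 6) R.:* (x R.:* x) R.:- t R.:+ R.con (ι 4) R.:* (x R.:* h)) R.:* (h R.:* h))
      ≋-refl x y A B)

  cayley-im : two * y * B - two * x * A - two * h * A * ((1r - x * x) * A)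
    ≋ A * A * B * (- (two * (x * (1r + x * x) + (1r - x * x) * (two * x + h)))) * (h * h)
  cayley-im = ≋-trans
    (+-cong (+-cong (times-one AA) (neg-cong (times-one AB′))) (neg-cong (times-one hB)))
    (R.solve 4 (λ x y A B → let o = R.con 1ℚ ; t = R.con (ι 2) ; h = y R.:- x
                                p = A R.:* (o R.:+ x R.:* x) ; q = B R.:* (o R.:+ y R.:* y) in
      t R.:* y R.:* B R.:* (p R.:* p) R.:- t R.:* x R.:* A R.:* (p R.:* q)
        R.:- t R.:* h R.:* A R.:* ((o R.:- x R.:* x) R.:* A) R.:* q R.:=
      A R.:* A R.:* B R.:* (R.:- (t R.:* (x R.:* (o R.:+ x R.:* x) R.:+ (o R.:- x R.:* x) R.:* (t R.:* x R.:+ h)))) R.:* (h R.:* h))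
      ≋-refl x y A B)

  module _ (∣A∣≼1 : ∣ A ∣ ≼ 1r) (∣B∣≼1 : ∣ B ∣ ≼ 1r) (∣x∣≼1 : ∣ x ∣ ≼ 1r) (∣h∣≼1 : ∣ h ∣ ≼ 1r) where

    private
      ι≼ : ∀ n → ∣ ⌜ ι n ⌝ ∣ ≼ ⌜ ι n ⌝
      ι≼ n = ≼-reflexive (∣∣-nonneg (0≼ι n))
      xx : ∣ x * x ∣ ≼ 1r * 1r
      xx = ∣∣-*≼ ∣x∣≼1 ∣x∣≼1
      finish : ∀ {w v} → ∣ v ∣ ≼ ⌜ ι 16 ⌝ → w ≋ A * A * B * v * (h * h) → ∣ w ∣ ≼ ⌜ ι 16 ⌝ * (h * h)
      finish {w} {v} hv e = ≼-trans (≼-reflexive (∣∣-cong e))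
        (≼-trans (∣∣-*≼ (∣∣-*≼ (∣∣-*≼ (∣∣-*≼ ∣A∣≼1 ∣A∣≼1) ∣B∣≼1) hv) (≼-reflexive (∣∣-nonneg (0≼sq h))))
          (≼-reflexive (*-cong (R.solve 1 (λ v → R.con 1ℚ R.:* R.con 1ℚ R.:* R.con 1ℚ R.:* v R.:= v) ≋-refl ⌜ ι 16 ⌝) ≋-refl)))

    cayley-re-bound : ∣ (1r - y * y) * B - (1r - x * x) * A + two * h * A * (two * x * A) ∣ ≼ ⌜ ι 16 ⌝ * (h * h)
    cayley-re-bound = finish
      (≼-trans (∣∣-+≼ (∣∣-+≼ (∣∣-*≼ (ι≼ 6) xx) (∣∣-neg≼ (ι≼ 2))) (∣∣-*≼ (ι≼ 4) (∣∣-*≼ ∣x∣≼1 ∣h∣≼1)))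
        -- The coefficient is at most 6 + 2 + 4 = 12; the slack 4 lets it share the constant 16 with
        -- the imaginary part.
        (≼-by ⌜ ι 4 ⌝ (R.solve 0 (let o = R.con 1ℚ in R.con (ι 16) R.:=
          R.con (ι 6) R.:* (o R.:* o) R.:+ R.con (ι 2) R.:+ R.con (ι 4) R.:* (o R.:* o) R.:+ R.con (ι 4)) ≋-refl) (0≼ι 4)))
      cayley-re

    cayley-im-bound : ∣ two * y * B - two * x * A - two * h * A * ((1r - x * x) * A) ∣ ≼ ⌜ ι 16 ⌝ * (h * h)
    cayley-im-bound = finish
      (≼-trans (∣∣-neg≼ (∣∣-*≼ (ι≼ 2) (∣∣-+≼ (∣∣-*≼ ∣x∣≼1 (∣∣-+≼ (ι≼ 1) xx))
          (∣∣-*≼ (∣∣-+≼ (ι≼ 1) (∣∣-neg≼ xx)) (∣∣-+≼ (∣∣-*≼ (ι≼ 2) ∣x∣≼1) ∣h∣≼1)))))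
        (≼-reflexive (R.solve 0 (let o = R.con 1ℚ ; t = R.con (ι 2) in
          t R.:* (o R.:* (o R.:+ o R.:* o) R.:+ (o R.:+ o R.:* o) R.:* (t R.:* o R.:+ o)) R.:= R.con (ι 16)) ≋-refl)))
      cayley-im

module ArctanSum (n : ℕ) where

  node : ℕ → ℚ
  node k = ι k ℚ.* recip n

  r : ℝ
  r = ⌜ recip n ⌝

  x A θ : ℕ → ℝ
  x k = ⌜ node k ⌝
  A k = ⌜ RL.arctan′ (node k) ⌝
  θ k = Σ< k (λ j → two * r * A j)

  A-spec : ∀ k → A k * (1r + x k * x k) ≋ 1r
  A-spec k = ≋-trans (*-cong ≋-refl (≋-trans (+-cong ≋-refl (≋-sym (⌜⌝-* _ _))) (≋-sym (⌜⌝-+ _ _))))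
    (≋-trans (≋-sym (⌜⌝-* _ _)) (⌜⌝-cong (RL.arctan′-spec (node k))))

  ∣A∣≼1 : ∀ k → ∣ A k ∣ ≼ 1r
  ∣A∣≼1 k = ≼-trans (≼-reflexive (∣∣-nonneg (0≼⌜⌝ (RL.0≤arctan′ (node k)))))
    (⌜⌝-mono (subst (ℚ._≤ 1ℚ) (ℚₚ.*-identityʳ _) (RL.arctan′*≤1 (node k) 1ℚ (RL.1≤1+sq (node k)))))

  0≼x : ∀ k → 0r ≼ x k
  0≼x k = 0≼⌜⌝ (DR.0≤* {ι k} {recip n} (DR.0≤ι k) (ℚₚ.<⇒≤ (DR.0<recip n)))

  x≼1 : ∀ k → k ℕ.≤ suc n → x k ≼ 1r
  x≼1 k k≤ = ⌜⌝-mono (ℚₚ.≤-trans (ℚₚ.*-monoʳ-≤-nonNeg (recip n) {{ℚ.nonNegative (ℚₚ.<⇒≤ (DR.0<recip n))}} (DR.ι-mono k≤))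
    (ℚₚ.≤-reflexive (DR.ι*recip n)))

  ∣x∣≼1 : ∀ k → k ℕ.≤ suc n → ∣ x k ∣ ≼ 1r
  ∣x∣≼1 k k≤ = ≼-trans (≼-reflexive (∣∣-nonneg (0≼x k))) (x≼1 k k≤)

  x-suc : ∀ k → x (suc k) - x k ≋ r
  x-suc k = ≋-trans (+-cong (≋-trans (⌜⌝-* _ _) (*-cong (ι-+ 1 k) ≋-refl)) (neg-cong (⌜⌝-* _ _)))
    (R.solve 2 (λ i r → (R.con 1ℚ R.:+ i) R.:* r R.:- i R.:* r R.:= r) ≋-refl ⌜ ι k ⌝ r)

  r≼1 : ∣ r ∣ ≼ 1r
  r≼1 = ≼-trans (≼-reflexive (∣∣-nonneg (0≼recip n))) (⌜⌝-mono (DR.recip-anti {0} {n} ℕ.z≤n))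

  ∣2rA∣≼2r : ∀ k → ∣ two * r * A k ∣ ≼ two * r
  ∣2rA∣≼2r k = ≼-trans (∣∣-*≼ (≼-reflexive (∣∣-nonneg (*-nonneg (0≼ι 2) (0≼recip n)))) (∣A∣≼1 k)) (≼-reflexive (*-identityʳ _))

  ∣θ∣≼2 : ∀ k → k ℕ.≤ suc n → ∣ θ k ∣ ≼ two
  ∣θ∣≼2 k k≤ = ≼-trans (sum-abs≼ {k} (λ i → two * r * A (toℕ i)) (two * r) (λ i → ∣2rA∣≼2r (toℕ i)))
    (≼-trans (≼-reflexive (R.solve 3 (λ i t r → i R.:* (t R.:* r) R.:= t R.:* (i R.:* r)) ≋-refl ⌜ ι k ⌝ two r))
      (≼-trans (≼-*ˡ (0≼ι 2) (≼-trans (≼-reflexive (≋-sym (⌜⌝-* _ _))) (x≼1 k k≤))) (≼-reflexive (*-identityʳ two))))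

  θ-suc : ∀ k → θ (suc k) - θ k ≋ two * r * A k
  θ-suc k = ≋-trans (+-cong (Σ<-snoc k (λ j → two * r * A j)) ≋-refl)
    (R.solve 2 (λ a b → a R.:+ b R.:- a R.:= b) ≋-refl (θ k) (two * r * A k))

  c s F : ℕ → ℝ
  c k = (1r - x k * x k) * A k
  s k = two * x k * A k
  F k = cos (θ k) * c k + sin (θ k) * s k

  open Euler (ι 2) (DR.0≤ι 2) using (E; 0≤E)
  rot : IsRotation (ι 2) E cos sin
  rot = cos-sin-rotation (ι 2) (DR.0≤ι 2)
  -- `E′` bounds the coordinates of both points: E for cos and sin, 2 for the Cayley point. `H` r²
  -- bounds all Euler errors: E (2r)² for the angle step and 16 r² for the Cayley step. `K` r² is
  -- then the bound of `rotation-step` with angle at most 2 and squared angle at most 4 r².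
  E′ H K : ℝ
  E′ = ⌜ E ⌝ + two
  H = ⌜ E ⌝ * ⌜ ι 4 ⌝ + ⌜ ι 16 ⌝
  K = (H * E′ + (E′ + two * E′) * H) + (H * E′ + (E′ + two * E′) * H) + ⌜ ι 4 ⌝ * (E′ * E′ + E′ * E′)

  0≼E : 0r ≼ ⌜ E ⌝
  0≼E = 0≼⌜⌝ 0≤E
  rr : ℝ
  rr = r * r
  0≼rr : 0r ≼ rr
  0≼rr = 0≼sq r

  E≼E′ : ⌜ E ⌝ ≼ E′
  E≼E′ = ≼-by two ≋-refl (0≼ι 2)

  two≼E′ : two ≼ E′
  two≼E′ = ≼-by ⌜ E ⌝ (+-comm _ _) 0≼E

  c≼ : ∀ k → k ℕ.≤ suc n → ∣ c k ∣ ≼ E′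
  c≼ k k≤ = ≼-trans (∣∣-*≼ (∣∣-+≼ (≼-reflexive (∣∣-nonneg (0≼ι 1))) (∣∣-neg≼ (∣∣-*≼ (∣x∣≼1 k k≤) (∣x∣≼1 k k≤)))) (∣A∣≼1 k))
    (≼-trans (≼-reflexive (R.solve 0 (let o = R.con 1ℚ in (o R.:+ o R.:* o) R.:* o R.:= R.con (ι 2)) ≋-refl)) two≼E′)

  s≼ : ∀ k → k ℕ.≤ suc n → ∣ s k ∣ ≼ E′
  s≼ k k≤ = ≼-trans (∣∣-*≼ (∣∣-*≼ (≼-reflexive (∣∣-nonneg (0≼ι 2))) (∣x∣≼1 k k≤)) (∣A∣≼1 k))
    (≼-trans (≼-reflexive (R.solve 0 (let o = R.con 1ℚ in R.con (ι 2) R.:* o R.:* o R.:= R.con (ι 2)) ≋-refl)) two≼E′)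

  d² : ∀ k → (θ (suc k) - θ k) * (θ (suc k) - θ k) ≼ ⌜ ι 4 ⌝ * rr
  d² k = ≼-trans (≼-trans (≼-reflexive (≋-trans (*-cong (θ-suc k) (θ-suc k)) (≋-sym (∣∣-sq _))))
      (≼-* (0≼∣∣ _) (*-nonneg (0≼ι 2) (0≼recip n)) (∣2rA∣≼2r k) (∣2rA∣≼2r k)))
    (≼-reflexive (R.solve 1 (λ r → R.con (ι 2) R.:* r R.:* (R.con (ι 2) R.:* r) R.:= R.con (ι 4) R.:* (r R.:* r)) ≋-refl r))

  euler-η : ∀ {k t} → ∣ t ∣ ≼ ⌜ E ⌝ * ((θ (suc k) - θ k) * (θ (suc k) - θ k)) → ∣ t ∣ ≼ H * rr
  euler-η {k} h = ≼-trans h (≼-trans (≼-*ˡ 0≼E (d² k)) (≼-by (⌜ ι 16 ⌝ * rr)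
    (R.solve 2 (λ e q → (e R.:* R.con (ι 4) R.:+ R.con (ι 16)) R.:* q R.:= e R.:* (R.con (ι 4) R.:* q) R.:+ R.con (ι 16) R.:* q) ≋-refl ⌜ E ⌝ rr)
    (*-nonneg (0≼ι 16) 0≼rr)))

  cayley-η : ∀ {k t} → ∣ t ∣ ≼ ⌜ ι 16 ⌝ * ((x (suc k) - x k) * (x (suc k) - x k)) → ∣ t ∣ ≼ H * rr
  cayley-η {k} h = ≼-trans h (≼-trans (≼-reflexive (*-cong ≋-refl (*-cong (x-suc k) (x-suc k)))) (≼-by (⌜ E ⌝ * ⌜ ι 4 ⌝ * rr)
    (R.solve 2 (λ e q → (e R.:* R.con (ι 4) R.:+ R.con (ι 16)) R.:* q R.:= R.con (ι 16) R.:* q R.:+ e R.:* R.con (ι 4) R.:* q) ≋-refl ⌜ E ⌝ rr)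
    (*-nonneg (*-nonneg 0≼E (0≼ι 4)) 0≼rr)))

  angle : ∀ k → two * (x (suc k) - x k) * A k ≋ θ (suc k) - θ k
  angle k = ≋-trans (*-cong (*-cong ≋-refl (x-suc k)) ≋-refl) (≋-sym (θ-suc k))

  step : ∀ k → k ℕ.< suc n → ∣ F (suc k) - F k ∣ ≼ rr * K
  step k k<n = ≼-trans
    (rotation-step {cos (θ k)} {sin (θ k)} {cos (θ (suc k))} {sin (θ (suc k))} {c k} {s k} {c (suc k)} {s (suc k)}
      {θ (suc k) - θ k} {E′} {two} {H * rr} (0≼ι 2)
      (≼-trans (bound₁ rot _ θ≼) E≼E′) (≼-trans (bound₂ rot _ θ≼) E≼E′) (c≼ k k≤) (s≼ k k≤) (c≼ (suc k) k<n) (s≼ (suc k) k<n)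
      (≼-trans (≼-reflexive (∣∣-cong (θ-suc k))) (≼-trans (∣2rA∣≼2r k)
        (≼-trans (≼-*ˡ (0≼ι 2) (∣∣≼⇒≼ r≼1)) (≼-reflexive (*-identityʳ two)))))
      (euler-η {k} (euler₁ rot _ _ θ′≼ θ≼)) (euler-η {k} (euler₂ rot _ _ θ′≼ θ≼))
      (≼-trans (≼-reflexive (∣∣-cong (+-cong ≋-refl (*-cong (≋-sym (angle k)) ≋-refl))))
        (cayley-η {k} (cayley-re-bound (A-spec k) (A-spec (suc k)) (∣A∣≼1 k) (∣A∣≼1 (suc k)) (∣x∣≼1 k k≤) h≼1)))
      (≼-trans (≼-reflexive (∣∣-cong (+-cong ≋-refl (neg-cong (*-cong (≋-sym (angle k)) ≋-refl)))))
        (cayley-η {k} (cayley-im-bound (A-spec k) (A-spec (suc k)) (∣A∣≼1 k) (∣A∣≼1 (suc k)) (∣x∣≼1 k k≤) h≼1))))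
    (≼-trans (≼-mono-+ ≼-refl (≼-* 0≼2E′² (*-nonneg (0≼ι 4) 0≼rr) (d² k) ≼-refl))
      (≼-reflexive (R.solve 4 (λ h e q t → (h R.:* q R.:* e R.:+ (e R.:+ t R.:* e) R.:* (h R.:* q)) R.:+ (h R.:* q R.:* e R.:+ (e R.:+ t R.:* e) R.:* (h R.:* q))
            R.:+ R.con (ι 4) R.:* q R.:* (e R.:* e R.:+ e R.:* e) R.:=
           q R.:* ((h R.:* e R.:+ (e R.:+ t R.:* e) R.:* h) R.:+ (h R.:* e R.:+ (e R.:+ t R.:* e) R.:* h) R.:+ R.con (ι 4) R.:* (e R.:* e R.:+ e R.:* e)))
         ≋-refl H E′ rr two)))
    where
    k≤ : k ℕ.≤ suc n
    k≤ = ℕₚ.<⇒≤ k<n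
    θ≼ : ∣ θ k ∣ ≼ two
    θ≼ = ∣θ∣≼2 k k≤
    θ′≼ : ∣ θ (suc k) ∣ ≼ two
    θ′≼ = ∣θ∣≼2 (suc k) k<n
    h≼1 : ∣ x (suc k) - x k ∣ ≼ 1r
    h≼1 = ≼-trans (≼-reflexive (∣∣-cong (x-suc k))) r≼1
    0≼2E′² : 0r ≼ E′ * E′ + E′ * E′
    0≼2E′² = 0≼+ (0≼sq E′) (0≼sq E′)

  F-start : F 0 ≋ 1r
  F-start = ≋-trans (+-cong (*-cong cos-0 c≋1) (*-cong sin-0 ≋-refl))
    (R.solve 1 (λ s → R.con 1ℚ R.:* R.con 1ℚ R.:+ R.con 0ℚ R.:* s R.:= R.con 1ℚ) ≋-refl (s 0))
    where
    x≋0 : x 0 ≋ 0r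
    x≋0 = ⌜⌝-cong (ℚₚ.*-zeroˡ (recip n))
    c≋1 : c 0 ≋ 1r
    c≋1 = ≋-trans (≋-trans (*-comm _ _) (*-cong ≋-refl (≋-trans (+-cong ≋-refl (neg-cong (≋-trans (*-cong x≋0 x≋0) (zeroˡ _))))
        (≋-trans (R.solve 0 (R.con 1ℚ R.:- R.con 0ℚ R.:= R.con 1ℚ R.:+ R.con 0ℚ R.:* R.con 0ℚ) ≋-refl)
          (+-cong ≋-refl (≋-sym (*-cong x≋0 x≋0))))))) (A-spec 0)

  F-end : F (suc n) ≋ sin (θ (suc n))
  F-end = ≋-trans (+-cong (*-cong ≋-refl (*-cong (≋-trans (+-cong ≋-refl (neg-cong (≋-trans (*-cong x≋1 x≋1) (*-identityˡ 1r)))) (-‿inverseʳ 1r)) ≋-refl))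
      (*-cong ≋-refl s≋1))
    (R.solve 3 (λ c s a → c R.:* (R.con 0ℚ R.:* a) R.:+ s R.:* R.con 1ℚ R.:= s) ≋-refl (cos (θ (suc n))) (sin (θ (suc n))) (A (suc n)))
    where
    x≋1 : x (suc n) ≋ 1r
    x≋1 = ⌜⌝-cong (DR.ι*recip n)
    s≋1 : s (suc n) ≋ 1r
    s≋1 = ≋-trans (*-cong (*-cong ≋-refl x≋1) ≋-refl)
      (≋-trans (R.solve 1 (λ a → R.con (ι 2) R.:* R.con 1ℚ R.:* a R.:= a R.:* (R.con 1ℚ R.:+ R.con 1ℚ R.:* R.con 1ℚ)) ≋-refl (A (suc n)))
        (≋-trans (*-cong ≋-refl (+-cong ≋-refl (≋-sym (*-cong x≋1 x≋1)))) (A-spec (suc n))))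

  -- Both points start at 1, so `F` starts at 1. At node 1 the Cayley point is i, so `F` ends at sin
  -- θ. Between them lie n + 1 steps that change `F` by at most K r² each, and (n + 1) r = 1.
  sin-θ-end : ∣ sin (θ (suc n)) - 1r ∣ ≼ K * r
  sin-θ-end = ≼-resp (∣∣-cong (+-cong F-end (neg-cong F-start)))
    (≋-trans (R.solve 3 (λ i r k → i R.:* (r R.:* r R.:* k) R.:= i R.:* r R.:* (k R.:* r)) ≋-refl ⌜ ι (suc n) ⌝ r K)
      (≋-trans (*-cong (ι*recip n) ≋-refl) (*-identityˡ _)))
    (drift (suc n) F (rr * K) step)

  rational-sum : ∀ m (f : ℕ → ℚ) → ⌜ RL.Σ< m f ⌝ ≋ Σ< m (λ k → ⌜ f k ⌝)
  rational-sum zero    f = ≋-refl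
  rational-sum (suc m) f = ≋-trans (⌜⌝-+ _ _) (+-cong ≋-refl (rational-sum m (λ k → f (suc k))))

  θ-end : θ (suc n) ≋ ⌜ ι 2 ℚ.* RL.leftSum RL.arctan′ n ⌝
  θ-end = ≋-trans (Σ<-scale (suc n) (two * r) A) (≋-trans (*-assoc _ _ _)
    (≋-sym (≋-trans (⌜⌝-* _ _) (*-cong ≋-refl (≋-trans (⌜⌝-* _ _) (*-cong ≋-refl (rational-sum (suc n) (λ k → RL.arctan′ (node k)))))))))

half-π : ℝ
half-π = ⌜ ½ ⌝ * D.π

private
  seq-half-π : ∀ n → ⌜ ½ ⌝ * ⌜ seq D.π n ⌝ ≋ ArctanSum.θ n (suc n)
  seq-half-π n = ≋-trans (≋-sym (⌜⌝-* _ _)) (≋-trans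
    (⌜⌝-cong (trans (sym (ℚₚ.*-assoc ½ (ι 4) (RL.leftSum RL.arctan′ n))) refl))
    (≋-sym (ArctanSum.θ-end n)))

-- Two limits of one sequence: θₙ is half the n-th approximation of π, so its sine tends to sin
-- (π/2) by continuity, and to 1 by the comparison with the Cayley point.
sin-half-π : sin half-π ≋ 1r
sin-half-π = conv-unique {λ n → sin (θₙ n)} to-sin to-one
  where
  θₙ : ℕ → ℝ
  θₙ n = ArctanSum.θ n (suc n)
  to-one : Conv (λ n → sin (θₙ n)) 1r
  -- `K` is built from constants that do not involve n, so its instance at 0 serves every n.
  to-one ε 0<ε = case small (ArctanSum.K 0) ε 0<ε of λ (N , h) →
    N , λ n n≥ → ≼-trans (ArctanSum.sin-θ-end n) (h n n≥)
  B : ℚ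
  B = proj₁ (archimedean half-π)
  M : ℚ
  M = B ℚ.+ ι 2
  0≤B : 0ℚ ℚ.≤ B
  0≤B = proj₁ (proj₂ (archimedean half-π))
  0≤M : 0ℚ ℚ.≤ M
  0≤M = DR.0≤+ {B} {ι 2} 0≤B (DR.0≤ι 2)
  rot : IsRotation M _ cos sin
  rot = cos-sin-rotation M 0≤M
  θ-conv : Conv θₙ half-π
  θ-conv = conv-≋ (λ n → seq-half-π n) (conv-scale ⌜ ½ ⌝ {λ n → ⌜ seq D.π n ⌝} λ ε 0<ε →
    ev-map (λ n h → ≼-trans (≼-reflexive (∣∣-swap _ _)) h) (approx D.π ε 0<ε))
  lip : ∀ n → ∣ sin (θₙ n) - sin half-π ∣ ≼ L rot * ∣ θₙ n - half-π ∣
  lip n = lipschitz₂ rot (θₙ n) half-π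
    (≼-trans (ArctanSum.∣θ∣≼2 n (suc n) ℕₚ.≤-refl) (⌜⌝-mono (≤-by {ι 2} {M} B (ℚₚ.+-comm B (ι 2)) 0≤B)))
    (≼-trans (proj₂ (proj₂ (archimedean half-π))) (⌜⌝-mono (≤-by {B} {M} (ι 2) refl (DR.0≤ι 2))))
  to-sin : Conv (λ n → sin (θₙ n)) (sin half-π)
  to-sin = conv-lipschitz (L rot) θ-conv lip

-- Here cos² = 1 - sin² = 0, and comparing squares turns this into a bound of 0 for |cos|.
cos-half-π : cos half-π ≋ 0r
cos-half-π = ≋-of-zero (≼-trans (≼-reflexive (∣∣-cong (R.solve 1 (λ a → a R.:- R.con 0ℚ R.:= a) ≋-refl c)))
  (sq-cancel ≼-refl (≼-reflexive (≋-trans (∣∣-sq c) (≋-trans c²≋0 (≋-sym (zeroˡ 0r)))))))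
  where
  c : ℝ
  c = cos half-π
  c²≋0 : c * c ≋ 0r
  c²≋0 = ≋-trans (R.solve 2 (λ c s → c R.:* c R.:= c R.:* c R.:+ s R.:* s R.:- s R.:* s) ≋-refl c (sin half-π))
    (≋-trans (+-cong (cos²+sin² half-π) (neg-cong (≋-trans (*-cong sin-half-π sin-half-π) (*-identityˡ 1r)))) (-‿inverseʳ 1r))

private
  π-halves : half-π + half-π ≋ D.π
  π-halves = R.solve 1 (λ p → R.con ½ R.:* p R.:+ R.con ½ R.:* p R.:= p) ≋-refl D.π

cos-π : cos D.π ≋ - 1r
cos-π = ≋-trans (cos-cong (≋-sym π-halves)) (≋-trans (cos-+ half-π half-π)
  (≋-trans (+-cong (*-cong cos-half-π ≋-refl) (neg-cong (*-cong sin-half-π sin-half-π)))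
    (R.solve 1 (λ c → R.con 0ℚ R.:* c R.:- R.con 1ℚ R.:* R.con 1ℚ R.:= R.:- R.con 1ℚ) ≋-refl (cos half-π))))

sin-π : sin D.π ≋ 0r
sin-π = ≋-trans (sin-cong (≋-sym π-halves)) (≋-trans (sin-+ half-π half-π)
  (≋-trans (+-cong (*-cong ≋-refl cos-half-π) (*-cong cos-half-π ≋-refl))
    (R.solve 1 (λ s → s R.:* R.con 0ℚ R.:+ R.con 0ℚ R.:* s R.:= R.con 0ℚ) ≋-refl (sin half-π))))

-- Riemann integrals of Lipschitz functions

gridPoint : ℕ → ℕ → ℝ
gridPoint n k = ⌜ ι k ℚ.* recip n ⌝

InUnit : ℝ → Set
InUnit x = 0r ≼ x × x ≼ 1r

Tagged : ∀ n → (Fin (suc n) → ℝ) → Set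
Tagged n ξ = ∀ k → gridPoint n (toℕ k) ≼ ξ k × ξ k ≼ gridPoint n (suc (toℕ k))

tagSum : ∀ n → (ℝ → ℝ) → (Fin (suc n) → ℝ) → ℝ
tagSum n g ξ = ⌜ recip n ⌝ * sum (λ k → g (ξ k))

average : ℕ → (ℝ → ℝ) → ℝ
average n g = ⌜ recip n ⌝ * Σ< (suc n) (λ k → g (gridPoint n k))

-- Stronger than the integral of the definitions: the error has the explicit rate L/(n+1), valid for
-- every n.
IsIntegral : (ℝ → ℝ) → ℝ → Set
IsIntegral g I = ∃[ L ] (∀ n ξ → Tagged n ξ → ∣ tagSum n g ξ - I ∣ ≼ L * ⌜ recip n ⌝)

opaque
  unfolding _+_

  ∫-intro : ∀ g I → (∀ ε → 0ℚ ℚ.< ε → ∃[ N ] (∀ n → N ℕ.≤ n → ∀ ξ → Tagged n ξ → ∣ tagSum n g ξ - I ∣ ≼ ⌜ ε ⌝)) → D.∫₀¹ g ≐ I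
  ∫-intro g I h = h

  cauchy-intro : ∀ (X : ℕ → ℝ) → (∀ ε → 0ℚ ℚ.< ε → ∃[ N ] (∀ m n → N ℕ.≤ m → N ℕ.≤ n → ∣ X m - X n ∣ ≼ ⌜ ε ⌝)) → D.IsCauchyℝ X
  cauchy-intro X h = h

integral : ∀ {g I} → IsIntegral g I → D.∫₀¹ g ≐ I
integral {g} {I} (L , h) = ∫-intro g I λ ε 0<ε →
  case small L ε 0<ε of λ (N , k) → N , λ n n≥ ξ t → ≼-trans (h n ξ t) (k n n≥)

0≼gridPoint : ∀ n k → 0r ≼ gridPoint n k
0≼gridPoint n k = 0≼⌜⌝ (DR.0≤* {ι k} {recip n} (DR.0≤ι k) (ℚₚ.<⇒≤ (DR.0<recip n)))

gridPoint-mono : ∀ n {j k} → j ℕ.≤ k → gridPoint n j ≼ gridPoint n k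
gridPoint-mono n j≤k = ⌜⌝-mono (ℚₚ.*-monoʳ-≤-nonNeg (recip n) {{ℚ.nonNegative (ℚₚ.<⇒≤ (DR.0<recip n))}} (DR.ι-mono j≤k))

gridPoint-end : ∀ n → gridPoint n (suc n) ≋ 1r
gridPoint-end n = ⌜⌝-cong (DR.ι*recip n)

gridPoint-* : ∀ n k → gridPoint n k ≋ ⌜ ι k ⌝ * ⌜ recip n ⌝
gridPoint-* n k = ⌜⌝-* _ _

gridPoint-suc : ∀ n k → gridPoint n (suc k) - gridPoint n k ≋ ⌜ recip n ⌝
gridPoint-suc n k = ≋-trans (+-cong (≋-trans (gridPoint-* n (suc k)) (*-cong (ι-+ 1 k) ≋-refl)) (neg-cong (gridPoint-* n k)))
  (R.solve 2 (λ i r → (R.con 1ℚ R.:+ i) R.:* r R.:- i R.:* r R.:= r) ≋-refl ⌜ ι k ⌝ ⌜ recip n ⌝)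

gridPoint-unit : ∀ n k → k ℕ.≤ suc n → InUnit (gridPoint n k)
gridPoint-unit n k k≤ = 0≼gridPoint n k , ≼-trans (gridPoint-mono n k≤) (≼-reflexive (gridPoint-end n))

tag-unit : ∀ {n ξ} → Tagged n ξ → ∀ k → InUnit (ξ k)
tag-unit {n} t k = ≼-trans (0≼gridPoint n (toℕ k)) (proj₁ (t k)) ,
  ≼-trans (proj₂ (t k)) (proj₂ (gridPoint-unit n (suc (toℕ k)) (Finₚ.toℕ<n k)))

recip-absorb-ι : ∀ n c → ⌜ recip n ⌝ * (⌜ ι (suc n) ⌝ * c) ≋ c
recip-absorb-ι n c = ≋-trans (R.solve 3 (λ r i c → r R.:* (i R.:* c) R.:= i R.:* r R.:* c) ≋-refl ⌜ recip n ⌝ ⌜ ι (suc n) ⌝ c)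
  (≋-trans (*-cong (ι*recip n) ≋-refl) (*-identityˡ c))

mean-close : ∀ n (f g : Fin (suc n) → ℝ) c → (∀ i → ∣ f i - g i ∣ ≼ c) →
  ∣ ⌜ recip n ⌝ * sum f - ⌜ recip n ⌝ * sum g ∣ ≼ c
mean-close n f g c h = ≼-resp
  (∣∣-cong (R.solve 3 (λ r a b → r R.:* (a R.:- b) R.:= r R.:* a R.:- r R.:* b) ≋-refl ⌜ recip n ⌝ (sum f) (sum g)))
  (recip-absorb-ι n c)
  (∣∣-*≼ (≼-reflexive (∣∣-nonneg (0≼recip n))) (sum-close f g c h))

module _ {g : ℝ → ℝ} {L : ℝ} (0≼L : 0r ≼ L)
  (lip : ∀ x y → InUnit x → InUnit y → ∣ g x - g y ∣ ≼ L * ∣ x - y ∣) where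

  private
    left : ℕ → ℝ
    left n = average n g

    tag-close : ∀ n ξ → Tagged n ξ → ∣ tagSum n g ξ - left n ∣ ≼ L * ⌜ recip n ⌝
    tag-close n ξ t = mean-close n (λ k → g (ξ k)) (λ k → g (gridPoint n (toℕ k))) _ λ k →
      ≼-trans (lip (ξ k) (gridPoint n (toℕ k)) (tag-unit t k) (gridPoint-unit n (toℕ k) (ℕₚ.<⇒≤ (Finₚ.toℕ<n k))))
        (≼-*ˡ 0≼L (≼-trans (≼-reflexive (∣∣-nonneg (≼⇒0≼- (proj₁ (t k)))))
          (≼-trans (≼-mono-+ (proj₂ (t k)) ≼-refl) (≼-reflexive (gridPoint-suc n (toℕ k))))))

    -- `m + n * suc m` plus one is (n+1)(m+1): the fine grid cuts every coarse cell into m + 1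
    -- parts, and across one cell g varies by at most L/(n+1). Any two grids are later compared
    -- through this common refinement.
    refine : ∀ n m → ∣ left (m ℕ.+ n ℕ.* suc m) - left n ∣ ≼ L * ⌜ recip n ⌝
    refine n m = ≼-resp (∣∣-cong (+-cong (≋-sym fine) ≋-refl)) ≋-refl
      (mean-close n (λ j → ⌜ recip m ⌝ * Σ< (suc m) (λ i → g (point (toℕ j) i))) (λ j → g (gridPoint n (toℕ j))) _ λ j →
        ≼-resp (∣∣-cong (+-cong ≋-refl (neg-cong (≋-trans (*-cong ≋-refl (sum-const (suc m) _)) (recip-absorb-ι m _))))) ≋-refl
          (mean-close m (λ i → g (point (toℕ j) (toℕ i))) (λ _ → g (gridPoint n (toℕ j))) _ λ i → near (toℕ j) (toℕ i) (Finₚ.toℕ<n j) (Finₚ.toℕ<n i)))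
      where
      n′ : ℕ
      n′ = m ℕ.+ n ℕ.* suc m
      point : ℕ → ℕ → ℝ
      point j i = gridPoint n′ (j ℕ.* suc m ℕ.+ i)
      recip-* : ⌜ recip n′ ⌝ ≋ ⌜ recip n ⌝ * ⌜ recip m ⌝
      recip-* = ≋-trans (⌜⌝-cong (RL.recip-* n m)) (⌜⌝-* _ _)
      fine : left n′ ≋ ⌜ recip n ⌝ * sum {suc n} (λ j → ⌜ recip m ⌝ * Σ< (suc m) (λ i → g (point (toℕ j) i)))
      fine = ≋-trans (*-cong recip-* (Σ<-* (suc n) (suc m) (λ k → g (gridPoint n′ k))))
        (≋-trans (*-assoc _ _ _) (*-cong ≋-refl (≋-sym (Σ<-scale (suc n) ⌜ recip m ⌝ (λ j → Σ< (suc m) (λ i → g (point j i)))))))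
      block : ∀ j → point j 0 ≋ gridPoint n j
      block j = ≋-trans (gridPoint-* n′ (j ℕ.* suc m ℕ.+ 0)) (≋-trans
        (*-cong (≋-trans (⌜⌝-cong (cong ι (ℕₚ.+-identityʳ (j ℕ.* suc m)))) (ι-* j (suc m))) recip-*)
        (≋-trans (R.solve 4 (λ j s a b → j R.:* s R.:* (a R.:* b) R.:= s R.:* b R.:* (j R.:* a)) ≋-refl ⌜ ι j ⌝ ⌜ ι (suc m) ⌝ ⌜ recip n ⌝ ⌜ recip m ⌝)
          (≋-trans (*-cong (ι*recip m) ≋-refl) (≋-trans (*-identityˡ _) (≋-sym (gridPoint-* n j))))))
      lower : ∀ j i → gridPoint n j ≼ point j i
      lower j i = ≼-trans (≼-reflexive (≋-sym (block j))) (gridPoint-mono n′ (ℕₚ.+-monoʳ-≤ (j ℕ.* suc m) ℕ.z≤n))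
      upper : ∀ j i → i ℕ.< suc m → point j i ≼ gridPoint n (suc j)
      upper j i i< = ≼-trans (gridPoint-mono n′ (ℕₚ.≤-trans (ℕₚ.+-monoʳ-≤ (j ℕ.* suc m) (ℕₚ.<⇒≤ i<))
        (ℕₚ.≤-reflexive (trans (ℕₚ.+-comm (j ℕ.* suc m) (suc m)) (sym (ℕₚ.+-identityʳ _)))))) (≼-reflexive (block (suc j)))
      near : ∀ j i → j ℕ.< suc n → i ℕ.< suc m → ∣ g (point j i) - g (gridPoint n j) ∣ ≼ L * ⌜ recip n ⌝
      near j i j< i< = ≼-trans
        (lip (point j i) (gridPoint n j)
          (0≼gridPoint n′ (j ℕ.* suc m ℕ.+ i) , ≼-trans (upper j i i<) (proj₂ (gridPoint-unit n (suc j) j<))) (gridPoint-unit n j (ℕₚ.<⇒≤ j<)))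
        (≼-*ˡ 0≼L (≼-trans (≼-reflexive (∣∣-nonneg (≼⇒0≼- (lower j i))))
          (≼-trans (≼-mono-+ (upper j i i<) ≼-refl) (≼-reflexive (gridPoint-suc n j)))))

    left-close : ∀ m n → ∣ left m - left n ∣ ≼ L * ⌜ recip m ⌝ + L * ⌜ recip n ⌝
    left-close m n = ≼-trans (∣∣-triangle (left m) (left (n ℕ.+ m ℕ.* suc n)) (left n))
      (≼-mono-+ (≼-trans (≼-reflexive (∣∣-swap _ _)) (refine m n))
        (subst (λ k → ∣ left k - left n ∣ ≼ L * ⌜ recip n ⌝) (ℕₚ.suc-injective (ℕₚ.*-comm (suc n) (suc m))) (refine n m)))

    left-cauchy : D.IsCauchyℝ left
    left-cauchy = cauchy-intro left λ ε 0<ε → case small L (ε ℚ.* ½) (DR.0<half 0<ε) of λ (N , h) →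
      N , λ m n m≥ n≥ → ≼-trans (left-close m n) (≼-trans (≼-mono-+ (h m m≥) (h n n≥))
        (≼-reflexive (≋-trans (≋-sym (⌜⌝-+ _ _)) (⌜⌝-cong (DR.half+half ε)))))

  opaque
    ∫ : ℝ
    ∫ = D.lim left left-cauchy

    ∫-conv : Conv left ∫
    ∫-conv = lim-conv left left-cauchy

  ∫-average : ∀ n → ∣ average n g - ∫ ∣ ≼ L * ⌜ recip n ⌝
  ∫-average n = ≼-limit λ ε 0<ε →
    case small L (ε ℚ.* ½) (DR.0<half 0<ε) of λ (N , h) →
    case ∫-conv (ε ℚ.* ½) (DR.0<half 0<ε) of λ (P , k) →
    let m = N ℕ.⊔ P in
    ≼-trans (∣∣-triangle (left n) (left m) ∫)
      (≼-trans (≼-mono-+ (left-close n m) (k m (ℕₚ.m≤n⊔m N P)))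
        (≼-trans (≼-mono-+ (≼-mono-+ ≼-refl (h m (ℕₚ.m≤m⊔n N P))) ≼-refl)
          (≼-reflexive (≋-trans (+-assoc _ _ _) (+-cong ≋-refl (≋-trans (≋-sym (⌜⌝-+ _ _)) (⌜⌝-cong (DR.half+half ε))))))))

  ∫-isIntegral : IsIntegral g ∫
  ∫-isIntegral = L + L , λ n ξ t → ≼-trans (∣∣-triangle (tagSum n g ξ) (left n) ∫)
    (≼-trans (≼-mono-+ (tag-close n ξ t) (∫-average n))
      (≼-reflexive (R.solve 2 (λ l r → l R.:* r R.:+ l R.:* r R.:= (l R.:+ l) R.:* r) ≋-refl L ⌜ recip n ⌝)))

  -- The averages converge, so a bound along some unbounded set of n is enough. This is what allows
  -- n to be chosen for its divisors.
  ∫-lower : ∀ {v} → (∀ N → ∃[ n ] (N ℕ.≤ n × v ≼ average n g)) → v ≼ ∫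
  ∫-lower {v} often = ≼-limit λ ε 0<ε → case small L ε 0<ε of λ (N , h) →
    case often N of λ (n , n≥ , v≼) →
    ≼-trans v≼ (≼-resp (R.solve 2 (λ a b → b R.:+ (a R.:- b) R.:= a) ≋-refl (left n) ∫) ≋-refl
      (≼-mono-+ {∫} ≼-refl (≼-trans (∣∣≼⇒≼ (∫-average n)) (h n n≥))))

  ∫-upper : ∀ {v} → (∀ N → ∃[ n ] (N ℕ.≤ n × average n g ≼ v)) → ∫ ≼ v
  ∫-upper {v} often = ≼-limit λ ε 0<ε → case small L ε 0<ε of λ (N , h) →
    case often N of λ (n , n≥ , ≼v) →
    ≼-resp (R.solve 2 (λ a b → a R.:+ R.:- (a R.:- b) R.:= b) ≋-refl (left n) ∫) ≋-refl
      (≼-mono-+ ≼v (≼-trans (∣∣≼⇒-≼ (∫-average n)) (h n n≥)))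

isIntegral-cong : ∀ {g I J} → I ≋ J → IsIntegral g I → IsIntegral g J
isIntegral-cong e (L , h) = L , λ n ξ t → ≼-resp (∣∣-cong (+-cong ≋-refl (neg-cong e))) ≋-refl (h n ξ t)

-- Orthogonality on equally spaced points

opaque
  τ : ℝ
  τ = ⌜ ι 2 ⌝ * D.π

  τ≋2π : τ ≋ ⌜ ι 2 ⌝ * D.π
  τ≋2π = ≋-refl

phase : ℕ → ℝ → ℝ
phase p x = - (τ * ⌜ ι p ⌝ * x)

phase-+ : ∀ p q x → phase (p ℕ.+ q) x ≋ phase p x + phase q x
phase-+ p q x = ≋-trans (neg-cong (*-cong (*-cong ≋-refl (ι-+ p q)) ≋-refl))
  (R.solve 4 (λ t p q x → R.:- (t R.:* (p R.:+ q) R.:* x) R.:= R.:- (t R.:* p R.:* x) R.:+ R.:- (t R.:* q R.:* x)) ≋-refl τ ⌜ ι p ⌝ ⌜ ι q ⌝ x)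

cos-minus-π : ∀ s → cos (s + - D.π) ≋ - cos s
cos-minus-π s = ≋-trans (cos-+ s (- D.π))
  (≋-trans (+-cong (*-cong ≋-refl (≋-trans (cos-neg D.π) cos-π)) (neg-cong (*-cong ≋-refl (≋-trans (sin-neg D.π) (neg-cong sin-π)))))
    (R.solve 2 (λ c s → c R.:* R.:- R.con 1ℚ R.:- s R.:* R.:- R.con 0ℚ R.:= R.:- c) ≋-refl (cos s) (sin s)))

-- On n + 1 = p · 2q points the phase of frequency p falls by π every q points,
-- so its cosine is antiperiodic and sums to 0 exactly.
phase-shift : ∀ n p q k → suc n ≡ p ℕ.* (q ℕ.+ q) →
  phase p (gridPoint n (k ℕ.+ q)) ≋ phase p (gridPoint n k) + - D.π
phase-shift n p q k eq = ≋-trans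
  (neg-cong (*-cong (*-cong τ≋2π ≋-refl) (≋-trans (gridPoint-* n (k ℕ.+ q)) (*-cong (ι-+ k q) ≋-refl))))
  (≋-trans (R.solve 5 (λ π p k q r → R.:- (R.con (ι 2) R.:* π R.:* p R.:* ((k R.:+ q) R.:* r)) R.:=
      R.:- (R.con (ι 2) R.:* π R.:* p R.:* (k R.:* r)) R.:+ R.:- (p R.:* (q R.:+ q) R.:* r R.:* π)) ≋-refl D.π ⌜ ι p ⌝ ⌜ ι k ⌝ ⌜ ι q ⌝ ⌜ recip n ⌝)
    (+-cong (neg-cong (*-cong (*-cong (≋-sym τ≋2π) ≋-refl) (≋-sym (gridPoint-* n k))))
      (neg-cong (≋-trans (*-cong period ≋-refl) (*-identityˡ D.π)))))
  where
  period : ⌜ ι p ⌝ * (⌜ ι q ⌝ + ⌜ ι q ⌝) * ⌜ recip n ⌝ ≋ 1r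
  period = ≋-trans (*-cong (≋-trans (*-cong ≋-refl (≋-sym (ι-+ q q))) (≋-trans (≋-sym (ι-* p (q ℕ.+ q)))
    (⌜⌝-cong (cong ι (sym eq))))) ≋-refl) (ι*recip n)

antiperiodic-sum : ∀ p q (f : ℕ → ℝ) → (∀ k → f (k ℕ.+ q) ≋ - f k) → Σ< (p ℕ.* (q ℕ.+ q)) f ≋ 0r
antiperiodic-sum p q f h = ≋-trans (Σ<-* p (q ℕ.+ q) f) (Σ<-zero p λ j _ →
  ≋-trans (Σ<-++ q q (λ i → f (j ℕ.* (q ℕ.+ q) ℕ.+ i))) (≋-trans
    (≋-sym (Σ<-+ q (λ i → f (j ℕ.* (q ℕ.+ q) ℕ.+ i)) (λ i → f (j ℕ.* (q ℕ.+ q) ℕ.+ (q ℕ.+ i)))))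
    (Σ<-zero q λ i _ → ≋-trans (+-cong ≋-refl (≋-trans
      (≡⇒≋ (cong f (trans (cong (j ℕ.* (q ℕ.+ q) ℕ.+_) (ℕₚ.+-comm q i)) (sym (ℕₚ.+-assoc (j ℕ.* (q ℕ.+ q)) i q)))))
      (h (j ℕ.* (q ℕ.+ q) ℕ.+ i)))) (-‿inverseʳ _))))

average-cong : ∀ n {f g : ℝ → ℝ} → (∀ x → f x ≋ g x) → average n f ≋ average n g
average-cong n {f} {g} h = *-cong ≋-refl
  (Σ<-cong (suc n) {λ k → f (gridPoint n k)} {λ k → g (gridPoint n k)} λ k _ → h (gridPoint n k))

average-mono : ∀ n {f g : ℝ → ℝ} → (∀ x → f x ≼ g x) → average n f ≼ average n g
average-mono n {f} {g} h = ≼-*ˡ (0≼recip n)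
  (Σ<-mono (suc n) {λ k → f (gridPoint n k)} {λ k → g (gridPoint n k)} λ k _ → h (gridPoint n k))

average-const : ∀ n c → average n (λ _ → c) ≋ c
average-const n c = ≋-trans (*-cong ≋-refl (sum-const (suc n) c)) (recip-absorb-ι n c)

average-scale : ∀ n c f → average n (λ x → c * f x) ≋ c * average n f
average-scale n c f = ≋-trans (*-cong ≋-refl (Σ<-scale (suc n) c (λ k → f (gridPoint n k))))
  (R.solve 3 (λ r c s → r R.:* (c R.:* s) R.:= c R.:* (r R.:* s)) ≋-refl ⌜ recip n ⌝ c (Σ< (suc n) (λ k → f (gridPoint n k))))

average-Σ : ∀ n m (f : ℕ → ℝ → ℝ) → average n (λ x → Σ< m (λ i → f i x)) ≋ Σ< m (λ i → average n (f i))
average-Σ n m f = ≋-trans (*-cong ≋-refl (Σ<-comm (suc n) m (λ k i → f i (gridPoint n k))))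
  (≋-sym (Σ<-scale m ⌜ recip n ⌝ (λ i → Σ< (suc n) (λ k → f i (gridPoint n k)))))

-- The real part of e(-ix) times the conjugate of e(-jx), which depends only on the difference of
-- the frequencies.
kernel : ℕ → ℕ → ℝ → ℝ
kernel i j x = cos (phase i x) * cos (phase j x) + sin (phase i x) * sin (phase j x)

-- Asks for 2p, not only p, to divide n + 1: half a period of each frequency up to L must be a whole
-- number q of grid steps.
Admissible : ℕ → ℕ → Set
Admissible L n = ∀ p → 1 ℕ.≤ p → p ℕ.≤ L → ∃[ q ] suc n ≡ p ℕ.* (q ℕ.+ q)

kernel-diff : ∀ p j x → kernel (p ℕ.+ j) j x ≋ cos (phase p x)
kernel-diff p j x = ≋-trans (+-cong (*-cong (cos-cong (phase-+ p j x)) ≋-refl) (*-cong (sin-cong (phase-+ p j x)) ≋-refl))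
  (cos-diff (phase p x) (phase j x))

kernel-sym : ∀ i j x → kernel i j x ≋ kernel j i x
kernel-sym i j x = +-cong (*-comm _ _) (*-comm _ _)

average-kernel-diff : ∀ {L n} → Admissible L n → ∀ p j → 1 ℕ.≤ p → p ℕ.≤ L → average n (kernel (p ℕ.+ j) j) ≋ 0r
average-kernel-diff {L} {n} adm p j 1≤p p≤L = case adm p 1≤p p≤L of λ (q , eq) →
  ≋-trans (average-cong n (kernel-diff p j)) (≋-trans (*-cong ≋-refl
    (subst (λ N → Σ< N (λ k → cos (phase p (gridPoint n k))) ≋ 0r) (sym eq)
      (antiperiodic-sum p q (λ k → cos (phase p (gridPoint n k))) λ k →
        ≋-trans (cos-cong (phase-shift n p q k eq)) (cos-minus-π _)))) (zeroʳ _))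

average-kernel-same : ∀ n j → average n (kernel j j) ≋ 1r
average-kernel-same n j = ≋-trans (average-cong n (λ x → cos²+sin² (phase j x))) (average-const n 1r)

average-kernel-distinct : ∀ {L n} → Admissible L n → ∀ i j → i ℕ.≤ L → j ℕ.≤ L → i ≢ j → average n (kernel i j) ≋ 0r
average-kernel-distinct {L} {n} adm i j i≤L j≤L i≢j = compare (ℕₚ.<-cmp i j)
  where
  larger : ∀ i j → j ℕ.< i → i ℕ.≤ L → average n (kernel i j) ≋ 0r
  larger i j j<i i≤L = subst (λ k → average n (kernel k j) ≋ 0r) (ℕₚ.m∸n+n≡m (ℕₚ.<⇒≤ j<i))
    (average-kernel-diff adm (i ℕ.∸ j) j (ℕₚ.m<n⇒0<n∸m j<i) (ℕₚ.≤-trans (ℕₚ.m∸n≤m i j) i≤L))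
  compare : Tri (i ℕ.< j) (i ≡ j) (j ℕ.< i) → average n (kernel i j) ≋ 0r
  compare (tri≈ _ i≡j _) = contradiction i≡j i≢j
  compare (tri> _ _ j<i) = larger i j j<i i≤L
  compare (tri< i<j _ _) = ≋-trans (average-cong n (kernel-sym i j)) (larger j i i<j j≤L)

Re Im : (ℕ → ℝ) → ℕ → ℝ → ℝ
Re a m x = Σ< m (λ i → a i * cos (phase (suc i) x))
Im a m x = Σ< m (λ i → a i * sin (phase (suc i) x))

-- The real part of A times the conjugate of B, for the trigonometric polynomials with real
-- coefficients a and b; index i carries the frequency i + 1.
pairing : (ℕ → ℝ) → ℕ → (ℕ → ℝ) → ℕ → ℝ → ℝ
pairing a m b l x = Re a m x * Re b l x + Im a m x * Im b l x

pairing-kernel : ∀ a m b l x → pairing a m b l x ≋ Σ< m (λ i → Σ< l (λ j → a i * b j * kernel (suc i) (suc j) x))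
pairing-kernel a m b l x = ≋-trans (+-cong (Σ<-prod m l ac bc) (Σ<-prod m l as bs))
  (≋-trans (≋-sym (Σ<-+ m (λ i → Σ< l (λ j → ac i * bc j)) (λ i → Σ< l (λ j → as i * bs j))))
    (Σ<-cong m λ i _ → ≋-trans (≋-sym (Σ<-+ l (λ j → ac i * bc j) (λ j → as i * bs j))) (Σ<-cong l λ j _ →
      R.solve 6 (λ a b c d s t → a R.:* c R.:* (b R.:* d) R.:+ a R.:* s R.:* (b R.:* t) R.:= a R.:* b R.:* (c R.:* d R.:+ s R.:* t)) ≋-refl
        (a i) (b j) (cos (phase (suc i) x)) (cos (phase (suc j) x)) (sin (phase (suc i) x)) (sin (phase (suc j) x)))))
  where
  ac as bc bs : ℕ → ℝ
  ac i = a i * cos (phase (suc i) x)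
  as i = a i * sin (phase (suc i) x)
  bc i = b i * cos (phase (suc i) x)
  bs i = b i * sin (phase (suc i) x)

Σ<-single : ∀ l i (f : ℕ → ℝ) → i ℕ.< l → (∀ j → j ℕ.< l → j ≢ i → f j ≋ 0r) → Σ< l f ≋ f i
Σ<-single (suc l) zero    f _ h = ≋-trans (+-cong ≋-refl (Σ<-zero l λ k k<l → h (suc k) (ℕ.s≤s k<l) λ ())) (+-identityʳ _)
Σ<-single (suc l) (suc i) f (ℕ.s≤s i<l) h = ≋-trans
  (+-cong (h 0 (ℕ.s≤s ℕ.z≤n) λ ()) (Σ<-single l i (λ k → f (suc k)) i<l λ j j<l j≢i → h (suc j) (ℕ.s≤s j<l) λ e → j≢i (ℕₚ.suc-injective e)))
  (+-identityˡ _)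

-- After expansion into kernels only equal frequencies survive the averaging, and m ≤ l guarantees
-- that each i has its partner j = i in the inner sum.
average-pairing : ∀ {n} a m b l → m ℕ.≤ l → Admissible l n → average n (pairing a m b l) ≋ Σ< m (λ i → a i * b i)
average-pairing {n} a m b l m≤l adm = ≋-trans (average-cong n (pairing-kernel a m b l))
  (≋-trans (average-Σ n m (λ i x → Σ< l (λ j → a i * b j * kernel (suc i) (suc j) x)))
    (Σ<-cong m λ i i<m → ≋-trans (average-Σ n l (λ j x → a i * b j * kernel (suc i) (suc j) x))
      (≋-trans (Σ<-cong l (λ j _ → average-scale n (a i * b j) (kernel (suc i) (suc j))))
        (≋-trans (Σ<-single l i (λ j → a i * b j * average n (kernel (suc i) (suc j))) (ℕₚ.<-≤-trans i<m m≤l)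
            λ j j<l j≢i → ≋-trans (*-cong ≋-refl (average-kernel-distinct adm (suc i) (suc j)
              (ℕₚ.<-≤-trans i<m m≤l) j<l (λ e → j≢i (sym (ℕₚ.suc-injective e))))) (zeroʳ _))
          (≋-trans (*-cong ≋-refl (average-kernel-same n (suc i))) (*-identityʳ _))))))

-- The grid has 2 L! (N+1) points: every p ≤ L divides L!, the factor 2 makes room for the half
-- period, and N + 1 makes n large.
admissible-exists : ∀ L N → ∃[ n ] (N ℕ.≤ n × Admissible L n)
admissible-exists L N = from (L ℕ.! ℕ.* suc N) refl
  where
  from : ∀ T → L ℕ.! ℕ.* suc N ≡ T → ∃[ n ] (N ℕ.≤ n × Admissible L n)
  from zero    eq = contradiction eq (ℕₚ.m<n⇒n≢0 (ℕₚ.*-mono-≤ (ℕₚ.1≤n! L) (ℕ.s≤s (ℕ.z≤n {N}))))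
  from (suc T) eq = T ℕ.+ suc T ,
    ℕₚ.≤-trans (ℕₚ.≤-pred (ℕₚ.≤-trans (ℕₚ.m≤n*m (suc N) (L ℕ.!) {{ℕₚ._!≢0 L}}) (ℕₚ.≤-reflexive eq))) (ℕₚ.m≤m+n T (suc T)) ,
    λ p 1≤p p≤L → quotient p 1≤p (∣-trans (p∣p! p 1≤p) (m≤n⇒m!∣n! p≤L))
    where
    p∣p! : ∀ p → 1 ℕ.≤ p → p ∣ p ℕ.!
    p∣p! (suc p) _ = m∣m*n (p ℕ.!)
    quotient : ∀ p → 1 ℕ.≤ p → p ∣ L ℕ.! → ∃[ q ] suc (T ℕ.+ suc T) ≡ p ℕ.* (q ℕ.+ q)
    quotient p _ (divides u e) = u ℕ.* suc N , trans (cong₂ ℕ._+_ half half) (sym (ℕₚ.*-distribˡ-+ p _ _))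
      where
      half : suc T ≡ p ℕ.* (u ℕ.* suc N)
      half = trans (sym eq) (trans (cong (ℕ._* suc N) (trans e (ℕₚ.*-comm u p))) (ℕₚ.*-assoc p u (suc N)))

-- The Rudin–Shapiro polynomials

splice : ∀ {A : Set} → ℕ → (ℕ → A) → (ℕ → A) → ℕ → A
splice zero    f g i       = g i
splice (suc m) f g zero    = f zero
splice (suc m) f g (suc i) = splice m (λ j → f (suc j)) g i

splice-left : ∀ {A : Set} m (f g : ℕ → A) i → i ℕ.< m → splice m f g i ≡ f i
splice-left (suc m) f g zero    _         = refl
splice-left (suc m) f g (suc i) (ℕ.s≤s h) = splice-left m (λ j → f (suc j)) g i h

splice-right : ∀ {A : Set} m (f g : ℕ → A) i → splice m f g (m ℕ.+ i) ≡ g i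
splice-right zero    f g i = refl
splice-right (suc m) f g i = splice-right m (λ j → f (suc j)) g i

-- The first 2^k values are the coefficients of the k-th pair of polynomials; each step appends as
-- many again, which shifts the second polynomial by the frequency 2^k.
rsP rsQ : ℕ → ℕ → Sign
rsP zero    _ = Sign.+
rsP (suc k) = splice (2 ℕ.^ k) (rsP k) (rsQ k)
rsQ zero    _ = Sign.+
rsQ (suc k) = splice (2 ℕ.^ k) (rsP k) (λ i → opposite (rsQ k i))

signℝ : Sign → ℝ
signℝ Sign.+ = 1r
signℝ Sign.- = - 1r

signℝ-opposite : ∀ s → signℝ (opposite s) ≋ - signℝ s
signℝ-opposite Sign.+ = ≋-refl
signℝ-opposite Sign.- = ≋-sym (neg-neg 1r)

signℝ-sq : ∀ s → signℝ s * signℝ s ≋ 1r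
signℝ-sq Sign.+ = *-identityˡ 1r
signℝ-sq Sign.- = R.solve 0 (R.:- R.con 1ℚ R.:* R.:- R.con 1ℚ R.:= R.con 1ℚ) ≋-refl

module _ (x : ℝ) where

  Re± Im± : (ℕ → Sign) → ℕ → ℝ
  Re± a m = Re (λ i → signℝ (a i)) m x
  Im± a m = Im (λ i → signℝ (a i)) m x

  private
    module _ (φ : ℝ → ℝ) where

      S : (ℕ → Sign) → ℕ → ℝ
      S a m = Σ< m (λ i → signℝ (a i) * φ (phase (suc i) x))

      S-opposite : ∀ (b : ℕ → Sign) m → Σ< m (λ i → signℝ (opposite (b i)) * φ (phase (m ℕ.+ suc i) x))
                         ≋ - Σ< m (λ i → signℝ (b i) * φ (phase (m ℕ.+ suc i) x))
      S-opposite b m = ≋-trans (Σ<-cong m {g = λ i → - (signℝ (b i) * φ (phase (m ℕ.+ suc i) x))} λ i _ → ≋-trans (*-cong (signℝ-opposite (b i)) ≋-refl)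
          (R.solve 2 (λ a c → R.:- a R.:* c R.:= R.:- (a R.:* c)) ≋-refl (signℝ (b i)) (φ (phase (m ℕ.+ suc i) x))))
        (sum-neg {m} (λ i → signℝ (b (toℕ i)) * φ (phase (m ℕ.+ suc (toℕ i)) x)))

      S-splice : ∀ k a b → S (splice (2 ℕ.^ k) a b) (2 ℕ.^ suc k)
        ≋ S a (2 ℕ.^ k) + Σ< (2 ℕ.^ k) (λ i → signℝ (b i) * φ (phase (2 ℕ.^ k ℕ.+ suc i) x))
      S-splice k a b = subst (λ l → Σ< (m ℕ.+ l) f ≋ S a m + g) (sym (ℕₚ.+-identityʳ m))
        (≋-trans (Σ<-++ m m f) (+-cong
          (Σ<-cong m λ i i<m → ≡⇒≋ (cong (λ s → signℝ s * φ (phase (suc i) x)) (splice-left m a b i i<m)))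
          (Σ<-cong m λ i _ → ≡⇒≋ (cong₂ (λ s p → signℝ s * φ (phase p x)) (splice-right m a b i) (sym (ℕₚ.+-suc m i))))))
        where
        m : ℕ
        m = 2 ℕ.^ k
        f : ℕ → ℝ
        f i = signℝ (splice m a b i) * φ (phase (suc i) x)
        g : ℝ
        g = Σ< m (λ i → signℝ (b i) * φ (phase (m ℕ.+ suc i) x))

    module _ (b : ℕ → Sign) (m : ℕ) where

      shifted-Re shifted-Im : ℝ
      shifted-Re = Σ< m (λ i → signℝ (b i) * cos (phase (m ℕ.+ suc i) x))
      shifted-Im = Σ< m (λ i → signℝ (b i) * sin (phase (m ℕ.+ suc i) x))

      private
        C S′ : ℝ
        C = cos (phase m x)
        S′ = sin (phase m x)
        u v : ℕ → ℝ
        u i = signℝ (b i) * cos (phase (suc i) x)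
        v i = signℝ (b i) * sin (phase (suc i) x)

      shifted-Re-rotate : shifted-Re ≋ C * Re± b m + - S′ * Im± b m
      shifted-Re-rotate = ≋-trans
        (Σ<-cong m λ i _ → ≋-trans (*-cong ≋-refl (≋-trans (cos-cong (phase-+ m (suc i) x)) (cos-+ _ _)))
          (R.solve 5 (λ a c s u v → a R.:* (c R.:* u R.:- s R.:* v) R.:= c R.:* (a R.:* u) R.:+ R.:- s R.:* (a R.:* v)) ≋-refl
            (signℝ (b i)) C S′ (cos (phase (suc i) x)) (sin (phase (suc i) x))))
        (≋-trans (Σ<-+ m (λ i → C * (signℝ (b i) * cos (phase (suc i) x))) (λ i → - S′ * (signℝ (b i) * sin (phase (suc i) x))))
          (+-cong (Σ<-scale m C u) (Σ<-scale m (- S′) v)))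

      shifted-Im-rotate : shifted-Im ≋ S′ * Re± b m + C * Im± b m
      shifted-Im-rotate = ≋-trans
        (Σ<-cong m λ i _ → ≋-trans (*-cong ≋-refl (≋-trans (sin-cong (phase-+ m (suc i) x)) (sin-+ _ _)))
          (R.solve 5 (λ a c s u v → a R.:* (s R.:* u R.:+ c R.:* v) R.:= s R.:* (a R.:* u) R.:+ c R.:* (a R.:* v)) ≋-refl
            (signℝ (b i)) C S′ (cos (phase (suc i) x)) (sin (phase (suc i) x))))
        (≋-trans (Σ<-+ m (λ i → S′ * (signℝ (b i) * cos (phase (suc i) x))) (λ i → C * (signℝ (b i) * sin (phase (suc i) x))))
          (+-cong (Σ<-scale m S′ u) (Σ<-scale m C v)))

      -- Raising all frequencies by m multiplies the polynomial by e(-mx), a number of modulus 1.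
      shifted-modulus : shifted-Re * shifted-Re + shifted-Im * shifted-Im ≋ Re± b m * Re± b m + Im± b m * Im± b m
      shifted-modulus = ≋-trans
        (+-cong (*-cong shifted-Re-rotate shifted-Re-rotate) (*-cong shifted-Im-rotate shifted-Im-rotate))
        (≋-trans (R.solve 4 (λ c s u v →
            (c R.:* u R.:+ R.:- s R.:* v) R.:* (c R.:* u R.:+ R.:- s R.:* v) R.:+ (s R.:* u R.:+ c R.:* v) R.:* (s R.:* u R.:+ c R.:* v) R.:=
            (c R.:* c R.:+ s R.:* s) R.:* (u R.:* u R.:+ v R.:* v)) ≋-refl C S′ (Re± b m) (Im± b m))
          (≋-trans (*-cong (cos²+sin² (phase m x)) ≋-refl) (*-identityˡ _)))

  ∣P∣² ∣Q∣² : ℕ → ℝ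
  ∣P∣² k = Re± (rsP k) (2 ℕ.^ k) * Re± (rsP k) (2 ℕ.^ k) + Im± (rsP k) (2 ℕ.^ k) * Im± (rsP k) (2 ℕ.^ k)
  ∣Q∣² k = Re± (rsQ k) (2 ℕ.^ k) * Re± (rsQ k) (2 ℕ.^ k) + Im± (rsQ k) (2 ℕ.^ k) * Im± (rsQ k) (2 ℕ.^ k)

  -- P′ = P + e Q and Q′ = P - e Q with ∣e∣ = 1, so this is the parallelogram law.
  rudin-shapiro : ∀ k → ∣P∣² k + ∣Q∣² k ≋ ⌜ ι (2 ℕ.^ suc k) ⌝
  rudin-shapiro zero    = ≋-trans
    (R.solve 2 (λ c s → let o = R.con 1ℚ ; z = R.con 0ℚ ; u = o R.:* c R.:+ z ; v = o R.:* s R.:+ z in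
        u R.:* u R.:+ v R.:* v R.:+ (u R.:* u R.:+ v R.:* v) R.:= R.con (ι 2) R.:* (c R.:* c R.:+ s R.:* s)) ≋-refl
      (cos (phase 1 x)) (sin (phase 1 x)))
    (≋-trans (*-cong ≋-refl (cos²+sin² (phase 1 x))) (*-identityʳ _))
  rudin-shapiro (suc k) = ≋-trans
    (+-cong (+-cong (*-cong P-re P-re) (*-cong P-im P-im)) (+-cong (*-cong Q-re Q-re) (*-cong Q-im Q-im)))
    (≋-trans (R.solve 4 (λ p q t u → (p R.:+ t) R.:* (p R.:+ t) R.:+ (q R.:+ u) R.:* (q R.:+ u) R.:+
          ((p R.:+ R.:- t) R.:* (p R.:+ R.:- t) R.:+ (q R.:+ R.:- u) R.:* (q R.:+ R.:- u)) R.:=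
          R.con (ι 2) R.:* (p R.:* p R.:+ q R.:* q R.:+ (t R.:* t R.:+ u R.:* u))) ≋-refl
        (Re± (rsP k) m) (Im± (rsP k) m) T-re T-im)
      (≋-trans (*-cong ≋-refl (≋-trans (+-cong ≋-refl (shifted-modulus (rsQ k) m)) (rudin-shapiro k)))
        (≋-sym (ι-* 2 (2 ℕ.^ suc k)))))
    where
    m : ℕ
    m = 2 ℕ.^ k
    T-re T-im : ℝ
    T-re = shifted-Re (rsQ k) m
    T-im = shifted-Im (rsQ k) m
    P-re : Re± (rsP (suc k)) (2 ℕ.^ suc k) ≋ Re± (rsP k) m + T-re
    P-re = S-splice cos k (rsP k) (rsQ k)
    P-im : Im± (rsP (suc k)) (2 ℕ.^ suc k) ≋ Im± (rsP k) m + T-im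
    P-im = S-splice sin k (rsP k) (rsQ k)
    Q-re : Re± (rsQ (suc k)) (2 ℕ.^ suc k) ≋ Re± (rsP k) m + - T-re
    Q-re = ≋-trans (S-splice cos k (rsP k) (λ i → opposite (rsQ k i))) (+-cong ≋-refl (S-opposite cos (rsQ k) m))
    Q-im : Im± (rsQ (suc k)) (2 ℕ.^ suc k) ≋ Im± (rsP k) m + - T-im
    Q-im = ≋-trans (S-splice sin k (rsP k) (λ i → opposite (rsQ k i))) (+-cong ≋-refl (S-opposite sin (rsQ k) m))

  rudin-shapiro-bound : ∀ k → ∣P∣² k ≼ ⌜ ι (2 ℕ.^ suc k) ⌝
  rudin-shapiro-bound k = ≼-by (∣Q∣² k) (≋-sym (rudin-shapiro k)) (0≼+ (0≼sq _) (0≼sq _))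

-- The density of the squarefree numbers

bit : Bool → ℕ
bit true  = 1
bit false = 0

count< : ℕ → (ℕ → Bool) → ℕ
count< zero    p = 0
count< (suc n) p = bit (p 0) ℕ.+ count< n (λ k → p (suc k))

size-tabulate : ∀ n p → size (tabulate {n = n} (λ i → p (toℕ i))) ≡ count< n p
size-tabulate zero    p = refl
size-tabulate (suc n) p with p 0
... | true  = cong suc (size-tabulate n (λ k → p (suc k)))
... | false = size-tabulate n (λ k → p (suc k))

count<-≤ : ∀ n p → count< n p ℕ.≤ n
count<-≤ zero    p = ℕ.z≤n
count<-≤ (suc n) p with p 0
... | true  = ℕ.s≤s (count<-≤ n _)
... | false = ℕₚ.m≤n⇒m≤1+n (count<-≤ n _)

count<-none : ∀ n p → (∀ k → p k ≡ false) → count< n p ≡ 0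
count<-none zero    p h = refl
count<-none (suc n) p h rewrite h 0 = count<-none n _ (λ k → h (suc k))

count<-restrict : ∀ m n p → m ℕ.≤ n → count< n (λ k → p k ∧ (k ℕ.<ᵇ m)) ≡ count< m p
count<-restrict zero    n       p _ = count<-none n _ (λ k → ∧-false (p k))
  where
  ∧-false : ∀ b → b ∧ false ≡ false
  ∧-false true  = refl
  ∧-false false = refl
count<-restrict (suc m) (suc n) p (ℕ.s≤s m≤n) = cong₂ ℕ._+_ (cong bit (∧-true (p 0))) (count<-restrict m n (λ k → p (suc k)) m≤n)
  where
  ∧-true : ∀ b → b ∧ true ≡ b
  ∧-true true  = refl
  ∧-true false = refl

count<-snoc : ∀ n p → count< (suc n) p ≡ count< n p ℕ.+ bit (p n)
count<-snoc zero    p = ℕₚ.+-comm (bit (p 0)) 0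
count<-snoc (suc n) p = trans (cong (bit (p 0) ℕ.+_) (count<-snoc n (λ k → p (suc k)))) (sym (ℕₚ.+-assoc (bit (p 0)) _ _))

indicator : Bool → ℝ
indicator b = ⌜ ι (bit b) ⌝

Σ<-indicator : ∀ n p → Σ< n (λ k → indicator (p k)) ≋ ⌜ ι (count< n p) ⌝
Σ<-indicator zero    p = ≋-refl
Σ<-indicator (suc n) p = ≋-trans (+-cong ≋-refl (Σ<-indicator n (λ k → p (suc k)))) (≋-sym (ι-+ (bit (p 0)) _))

multiple : ℕ → ℕ → Bool
multiple d m = does (d ∣? suc m)

-- By induction: at a multiple n + 1 = q d the previous count c satisfies c d ≤ n < q d, so c + 1 ≤
-- q.
count-multiples : ∀ d n → count< n (multiple d) ℕ.* d ℕ.≤ n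
count-multiples d zero    = ℕ.z≤n
count-multiples d (suc n) rewrite count<-snoc n (multiple d) with d ∣? suc n
... | no _ rewrite ℕₚ.+-identityʳ (count< n (multiple d)) = ℕₚ.m≤n⇒m≤1+n (count-multiples d n)
... | yes (divides q 1+n≡qd) = subst₂ ℕ._≤_ (cong (ℕ._* d) (ℕₚ.+-comm 1 c)) (sym 1+n≡qd)
    (ℕₚ.*-monoˡ-≤ d (ℕₚ.*-cancelʳ-< d c q (ℕₚ.≤-<-trans (count-multiples d n) (ℕₚ.≤-reflexive 1+n≡qd))))
  where
  c : ℕ
  c = count< n (multiple d)

-- Offset by two, so that the index d = 0 is the first relevant square, 4.
square : ℕ → ℕ
square d = suc (suc d) ℕ.* suc (suc d)

isSquarefree : ℕ → Bool
isSquarefree m = does (squarefree? (suc m))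

count<-zero⇒ : ∀ n p → count< n p ≡ 0 → ∀ k → k ℕ.< n → p k ≡ false
count<-zero⇒ (suc n) p eq zero    _         with p 0
... | false = refl
count<-zero⇒ (suc n) p eq (suc k) (ℕ.s≤s h) = count<-zero⇒ n _ (ℕₚ.m+n≡0⇒n≡0 (bit (p 0)) eq) k h

-- If (d+2)² divides m + 1, then d < (d+2)² ≤ m + 1 ≤ n, so the n candidates counted are all there
-- are. The dichotomy is put as an inequality of counts so that it can be summed over m.
squarefree-or-square : ∀ n m → m ℕ.< n → 1 ℕ.≤ bit (isSquarefree m) ℕ.+ count< n (λ d → multiple (square d) m)
squarefree-or-square n m m<n = by-count (count< n (λ d → multiple (square d) m)) refl
  where
  module _ (none : count< n (λ d → multiple (square d) m) ≡ 0) where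
    no-square : ∀ d → multiple (square d) m ≡ false → ¬ (square d ∣ suc m)
    no-square d e d² = contradiction (trans (sym (dec-true (square d ∣? suc m) d²)) e) λ ()
    squarefree : Squarefree (suc m)
    squarefree zero          h = contradiction (0∣⇒≡0 h) λ ()
    squarefree (suc zero)    h = refl
    squarefree (suc (suc d)) h = contradiction h (no-square d (count<-zero⇒ n _ none d
      (ℕₚ.≤-trans (ℕₚ.≤-trans (ℕₚ.n≤1+n (suc d)) (ℕₚ.m≤m*n (suc (suc d)) (suc (suc d)))) (ℕₚ.≤-trans (∣⇒≤ h) m<n))))
  by-count : ∀ c → count< n (λ d → multiple (square d) m) ≡ c → 1 ℕ.≤ bit (isSquarefree m) ℕ.+ c
  by-count (suc c) _    = ℕₚ.m≤n⇒m≤o+n (bit (isSquarefree m)) (ℕ.s≤s ℕ.z≤n)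
  by-count zero    none = subst (λ b → 1 ℕ.≤ bit b ℕ.+ 0) (sym (dec-true (squarefree? (suc m)) (squarefree none))) (ℕ.s≤s ℕ.z≤n)

squarefreeCount : ℕ → ℕ
squarefreeCount n = count< n isSquarefree

module _ (n : ℕ) where

  private
    c : ℕ → ℕ
    c d = count< n (multiple (square d))

    U : ℕ → ℝ
    U D = Σ< D (λ d → ⌜ ι (c d) ⌝)

    ν : ℝ
    ν = ⌜ ι n ⌝

    -- A union bound over the squares: `squarefree-or-square` is summed over m and the order of
    -- summation exchanged.
    union : ν ≼ ⌜ ι (squarefreeCount n) ⌝ + U n
    union = ≼-resp (≋-trans (sum-const n 1r) (*-identityʳ ν))
      (≋-trans (Σ<-+ n (λ m → indicator (isSquarefree m)) (λ m → Σ< n (λ d → indicator (multiple (square d) m)))) (+-cong (Σ<-indicator n isSquarefree)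
        (≋-trans (Σ<-comm n n (λ m d → indicator (multiple (square d) m))) (Σ<-cong n λ d _ → Σ<-indicator n (multiple (square d))))))
      (Σ<-mono n {λ _ → 1r} {λ m → indicator (isSquarefree m) + Σ< n (λ d → indicator (multiple (square d) m))} λ m m<n →
        ≼-trans (⌜⌝-mono (DR.ι-mono (squarefree-or-square n m m<n)))
          (≼-reflexive (≋-trans (ι-+ (bit (isSquarefree m)) _) (+-cong ≋-refl (≋-sym (Σ<-indicator n (λ d → multiple (square d) m)))))))

    term : ∀ d → ⌜ ι (c d) ⌝ ≼ ν * (⌜ recip (suc d) ⌝ * ⌜ recip (suc d) ⌝)
    term d = ≼-trans (≼-reflexive (≋-trans (≋-sym (*-identityʳ q)) (≋-trans (*-cong ≋-refl (≋-sym (≋-trans (*-cong unit unit) (*-identityˡ 1r))))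
        (≋-trans (R.solve 3 (λ q k r → q R.:* (k R.:* r R.:* (k R.:* r)) R.:= r R.:* r R.:* (q R.:* (k R.:* k))) ≋-refl q k r)
          (*-cong ≋-refl (≋-sym (≋-trans (ι-* (c d) (square d)) (*-cong ≋-refl (ι-* (suc (suc d)) (suc (suc d)))))))))))
      (≼-trans (≼-*ˡ (0≼sq r) (⌜⌝-mono (DR.ι-mono (count-multiples (square d) n)))) (≼-reflexive (*-comm _ _)))
      where
      q k r : ℝ
      q = ⌜ ι (c d) ⌝
      k = ⌜ ι (suc (suc d)) ⌝
      r = ⌜ recip (suc d) ⌝
      unit : k * r ≋ 1r
      unit = ι*recip (suc d)

    -- Replacing one factor 1/(d+2) by 1/(d+1) gives a difference that telescopes.
    recip-gap : ∀ d → ⌜ recip (suc d) ⌝ * ⌜ recip (suc d) ⌝ ≼ ⌜ recip d ⌝ - ⌜ recip (suc d) ⌝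
    recip-gap d = ≼-trans (≼-* (0≼recip (suc d)) (0≼recip d) (⌜⌝-mono (DR.recip-anti (ℕₚ.n≤1+n d))) ≼-refl)
      (≼-reflexive (≋-trans
        (R.solve 3 (λ s r k → s R.:* r R.:= s R.:* ((R.con 1ℚ R.:+ k) R.:* r) R.:- k R.:* s R.:* r) ≋-refl ⌜ recip d ⌝ ⌜ recip (suc d) ⌝ ⌜ ι (suc d) ⌝)
        (+-cong (≋-trans (*-cong ≋-refl (≋-trans (*-cong (≋-sym (ι-+ 1 (suc d))) ≋-refl) (ι*recip (suc d)))) (*-identityʳ _))
          (neg-cong (≋-trans (*-cong (ι*recip d) ≋-refl) (*-identityˡ _))))))

    -- 1/4 is kept exact for the first square, and 1/2 bounds the rest by telescoping. Telescoping
    -- from the first square on would give 1 and leave no positive density.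
    ¾ : ℚ
    ¾ = ½ ℚ.+ ½ ℚ.* ½

    -- 1/4 + 1/9 + … + 1/(D+2)² ≤ 1/4 + (1/2 - 1/(D+2)).
    U-bound : ∀ D → U (suc D) ≼ ν * (⌜ ¾ ⌝ - ⌜ recip (suc D) ⌝)
    U-bound zero    = ≼-trans (≼-reflexive (+-identityʳ _)) (≼-trans (term 0)
      (≼-reflexive (*-cong ≋-refl (R.solve 0 (R.con ½ R.:* R.con ½ R.:= R.con ¾ R.:- R.con ½) ≋-refl))))
    U-bound (suc D) = ≼-trans (≼-reflexive (Σ<-snoc (suc D) (λ d → ⌜ ι (c d) ⌝)))
      (≼-trans (≼-mono-+ (U-bound D) (≼-trans (term (suc D)) (≼-*ˡ (0≼ι n) (recip-gap (suc D)))))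
        (≼-reflexive (R.solve 4 (λ ν t a b → ν R.:* (t R.:- a) R.:+ ν R.:* (a R.:- b) R.:= ν R.:* (t R.:- b)) ≋-refl
          ν ⌜ ¾ ⌝ ⌜ recip (suc D) ⌝ ⌜ recip (suc (suc D)) ⌝)))

    U-total : ∀ D → U D ≼ ν * ⌜ ¾ ⌝
    U-total zero    = *-nonneg (0≼ι n) (⌜⌝-mono (DR.0≤+ {½} {½ ℚ.* ½} (ℚₚ.<⇒≤ DR.0<½) (ℚₚ.<⇒≤ (DR.0<half DR.0<½))))
    U-total (suc D) = ≼-trans (U-bound D) (≼-*ˡ (0≼ι n) (≼-by ⌜ recip (suc D) ⌝
      (R.solve 2 (λ t a → t R.:= t R.:- a R.:+ a) ≋-refl ⌜ ¾ ⌝ ⌜ recip (suc D) ⌝) (0≼recip (suc D))))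

  squarefree-density : ν * ⌜ ½ ℚ.* ½ ⌝ ≼ ⌜ ι (squarefreeCount n) ⌝
  squarefree-density = ≼-resp
    (R.solve 1 (λ v → v R.:+ R.:- (v R.:* R.con ¾) R.:= v R.:* R.con (½ ℚ.* ½)) ≋-refl ν)
    (R.solve 2 (λ a u → a R.:+ u R.:+ R.:- u R.:= a) ≋-refl ⌜ ι (squarefreeCount n) ⌝ (U n))
    (≼-mono-+ union (≼-neg (U-total n)))

-- The modulus of a trigonometric polynomial

Lipschitz : (ℝ → ℝ) → Set
Lipschitz f = ∃[ L ] (0r ≼ L × (∀ x y → InUnit x → InUnit y → ∣ f x - f y ∣ ≼ L * ∣ x - y ∣))

lip-const : ∀ c → Lipschitz (λ _ → c)
lip-const c = 0r , ≼-refl , λ x y _ _ → ≼-reflexive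
  (≋-trans (∣∣-cong (-‿inverseʳ c)) (≋-trans (∣∣-nonneg ≼-refl) (≋-sym (zeroˡ _))))

lip-+ : ∀ {f g} → Lipschitz f → Lipschitz g → Lipschitz (λ x → f x + g x)
lip-+ {f} {g} (L , 0≼L , h) (M , 0≼M , k) = L + M , 0≼+ 0≼L 0≼M , λ x y x∈ y∈ →
  ≼-resp (∣∣-cong (R.solve 4 (λ a b c d → (a R.:- b) R.:+ (c R.:- d) R.:= a R.:+ c R.:- (b R.:+ d)) ≋-refl (f x) (f y) (g x) (g y)))
    (R.solve 3 (λ l m d → l R.:* d R.:+ m R.:* d R.:= (l R.:+ m) R.:* d) ≋-refl L M ∣ x - y ∣)
    (∣∣-+≼ (h x y x∈ y∈) (k x y x∈ y∈))

lip-scale : ∀ c {f} → Lipschitz f → Lipschitz (λ x → c * f x)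
lip-scale c {f} (L , 0≼L , h) = ∣ c ∣ * L , *-nonneg (0≼∣∣ c) 0≼L , λ x y x∈ y∈ →
  ≼-resp (∣∣-cong (R.solve 3 (λ c a b → c R.:* (a R.:- b) R.:= c R.:* a R.:- c R.:* b) ≋-refl c (f x) (f y)))
    (≋-sym (*-assoc _ _ _)) (∣∣-*≼ (≼-refl {∣ c ∣}) (h x y x∈ y∈))

lip-Σ : ∀ n {f : ℕ → ℝ → ℝ} → (∀ i → Lipschitz (f i)) → Lipschitz (λ x → Σ< n (λ i → f i x))
lip-Σ zero    h = lip-const 0r
lip-Σ (suc n) {f} h = lip-+ {f 0} {λ x → Σ< n (λ i → f (suc i) x)} (h 0) (lip-Σ n {λ i → f (suc i)} (λ i → h (suc i)))

lip-bounded : ∀ {f} → Lipschitz f → ∃[ B ] (∀ x → InUnit x → ∣ f x ∣ ≼ B)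
lip-bounded {f} (L , 0≼L , h) = L + ∣ f 0r ∣ , λ x (0≼x , x≼1) →
  ≼-resp (∣∣-cong (R.solve 2 (λ a b → a R.:- b R.:+ b R.:= a) ≋-refl (f x) (f 0r))) ≋-refl
    (∣∣-+≼ (≼-trans (h x 0r (0≼x , x≼1) (≼-refl , 0≼ι 1)) (≼-trans (≼-*ˡ 0≼L (≼-trans
        (≼-reflexive (≋-trans (∣∣-cong (R.solve 1 (λ a → a R.:- R.con 0ℚ R.:= a) ≋-refl x)) (∣∣-nonneg 0≼x))) x≼1))
        (≼-reflexive (*-identityʳ L)))) ≼-refl)

lip-* : ∀ {f g} → Lipschitz f → Lipschitz g → Lipschitz (λ x → f x * g x)
lip-* {f} {g} lf@(L , 0≼L , h) lg@(M , 0≼M , k) =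
  case lip-bounded {f} lf of λ (A , hA) →
  case lip-bounded {g} lg of λ (B , hB) →
  A * M + B * L ,
  0≼+ (*-nonneg (≼-trans (0≼∣∣ _) (hA 0r (≼-refl , 0≼ι 1))) 0≼M) (*-nonneg (≼-trans (0≼∣∣ _) (hB 0r (≼-refl , 0≼ι 1))) 0≼L) ,
  λ x y x∈ y∈ → ≼-resp
    (∣∣-cong (R.solve 4 (λ a b c d → a R.:* (c R.:- d) R.:+ d R.:* (a R.:- b) R.:= a R.:* c R.:- b R.:* d) ≋-refl (f x) (f y) (g x) (g y)))
    (R.solve 5 (λ a m b l d → a R.:* (m R.:* d) R.:+ b R.:* (l R.:* d) R.:= (a R.:* m R.:+ b R.:* l) R.:* d) ≋-refl A M B L ∣ x - y ∣)
    (∣∣-+≼ (∣∣-*≼ (hA x x∈) (k x y x∈ y∈)) (∣∣-*≼ (hB y y∈) (h x y x∈ y∈)))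

module _ (p : ℕ) where

  private
    ω : ℝ
    ω = τ * ⌜ ι p ⌝

    M : ℚ
    M = proj₁ (archimedean ω)

    rot : IsRotation M _ cos sin
    rot = cos-sin-rotation M (proj₁ (proj₂ (archimedean ω)))

    phase≼ : ∀ x → InUnit x → ∣ phase p x ∣ ≼ ⌜ M ⌝
    phase≼ x (0≼x , x≼1) = ∣∣-neg≼ (≼-trans (∣∣-*≼ (proj₂ (proj₂ (archimedean ω))) (≼-trans (≼-reflexive (∣∣-nonneg 0≼x)) x≼1))
      (≼-reflexive (*-identityʳ _)))

    phase-diff : ∀ x y → ∣ phase p x - phase p y ∣ ≋ ∣ ω ∣ * ∣ x - y ∣
    phase-diff x y = ≋-trans (≋-trans (≋-sym (∣∣-neg _)) (∣∣-cong
      (R.solve 3 (λ w x y → R.:- (R.:- (w R.:* x) R.:- (R.:- (w R.:* y))) R.:= w R.:* (x R.:- y)) ≋-refl ω x y))) (∣∣-* _ _)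

    0≼L : 0r ≼ IsRotation.L rot
    0≼L = 0≼+ 0≼E (*-nonneg 0≼E (0≼+ 0≼M 0≼M))
      where
      0≼E : 0r ≼ ⌜ _ ⌝
      0≼E = ≼-trans (0≼∣∣ _) (IsRotation.bound₁ rot (phase p 0r) (phase≼ 0r (≼-refl , 0≼ι 1)))
      0≼M : 0r ≼ ⌜ M ⌝
      0≼M = 0≼⌜⌝ (proj₁ (proj₂ (archimedean ω)))

  lip-cos-phase : Lipschitz (λ x → cos (phase p x))
  lip-cos-phase = IsRotation.L rot * ∣ ω ∣ , *-nonneg 0≼L (0≼∣∣ ω) , λ x y x∈ y∈ →
    ≼-trans (IsRotation.lipschitz₁ rot (phase p x) (phase p y) (phase≼ x x∈) (phase≼ y y∈))
      (≼-reflexive (≋-trans (*-cong ≋-refl (phase-diff x y)) (≋-sym (*-assoc _ _ _))))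

  lip-sin-phase : Lipschitz (λ x → sin (phase p x))
  lip-sin-phase = IsRotation.L rot * ∣ ω ∣ , *-nonneg 0≼L (0≼∣∣ ω) , λ x y x∈ y∈ →
    ≼-trans (IsRotation.lipschitz₂ rot (phase p x) (phase p y) (phase≼ x x∈) (phase≼ y y∈))
      (≼-reflexive (≋-trans (*-cong ≋-refl (phase-diff x y)) (≋-sym (*-assoc _ _ _))))

lip-Re : ∀ a m → Lipschitz (Re a m)
lip-Re a m = lip-Σ m {λ i x → a i * cos (phase (suc i) x)} λ i → lip-scale (a i) {λ x → cos (phase (suc i) x)} (lip-cos-phase (suc i))

lip-Im : ∀ a m → Lipschitz (Im a m)
lip-Im a m = lip-Σ m {λ i x → a i * sin (phase (suc i) x)} λ i → lip-scale (a i) {λ x → sin (phase (suc i) x)} (lip-sin-phase (suc i))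

modulus : ℝ → ℝ → ℝ
modulus p q = √ (p * p + q * q)

modulus-nonneg : ∀ p q → 0r ≼ modulus p q
modulus-nonneg p q = √-nonneg _

modulus-sq : ∀ p q → modulus p q * modulus p q ≋ p * p + q * q
modulus-sq p q = ≋-trans (√-sq _) (∣∣-nonneg (0≼+ (0≼sq p) (0≼sq q)))

∣re∣≼modulus : ∀ p q → ∣ p ∣ ≼ modulus p q
∣re∣≼modulus p q = sq-cancel (modulus-nonneg p q) (≼-resp (≋-sym (∣∣-sq p)) (≋-sym (modulus-sq p q)) (≼-by (q * q) ≋-refl (0≼sq q)))

∣im∣≼modulus : ∀ p q → ∣ q ∣ ≼ modulus p q
∣im∣≼modulus p q = sq-cancel (modulus-nonneg p q) (≼-resp (≋-sym (∣∣-sq q)) (≋-sym (modulus-sq p q)) (≼-by (p * p) (+-comm _ _) (0≼sq p)))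

-- The square of the left side is m² + 2 (p′ e + q′ f) + e² + f², with m the modulus on the right.
-- The cross term is at most 2 m (|e| + |f|) since |p′|, |q′| ≤ m, and the square of the right side
-- has 2 |e| |f| to spare.
modulus-step : ∀ p q p′ q′ → modulus p q ≼ modulus p′ q′ + (∣ p - p′ ∣ + ∣ q - q′ ∣)
modulus-step p q p′ q′ = sq-cancel (0≼+ (modulus-nonneg p′ q′) (0≼+ (0≼∣∣ _) (0≼∣∣ _)))
  (≼-resp (≋-sym (modulus-sq p q)) ≋-refl (≼-trans (≼-reflexive expand) (≼-trans
    (≼-mono-+ (≼-mono-+ ≼-refl (≼-mono-+ cross cross)) (≼-reflexive (+-cong (≋-sym (∣∣-sq e)) (≋-sym (∣∣-sq f)))))
    (≼-by (∣ e ∣ * ∣ f ∣ + ∣ e ∣ * ∣ f ∣)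
      (≋-trans (R.solve 3 (λ m a b → (m R.:+ (a R.:+ b)) R.:* (m R.:+ (a R.:+ b)) R.:=
          m R.:* m R.:+ (m R.:* (a R.:+ b) R.:+ m R.:* (a R.:+ b)) R.:+ (a R.:* a R.:+ b R.:* b) R.:+ (a R.:* b R.:+ a R.:* b)) ≋-refl m ∣ e ∣ ∣ f ∣)
        (+-cong (+-cong (+-cong (modulus-sq p′ q′) ≋-refl) ≋-refl) ≋-refl))
      (0≼+ (*-nonneg (0≼∣∣ e) (0≼∣∣ f)) (*-nonneg (0≼∣∣ e) (0≼∣∣ f)))))))
  where
  e f m : ℝ
  e = p - p′
  f = q - q′
  m = modulus p′ q′
  expand : p * p + q * q ≋ (p′ * p′ + q′ * q′) + ((p′ * e + q′ * f) + (p′ * e + q′ * f)) + (e * e + f * f)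
  expand = R.solve 4 (λ p q p′ q′ → let e = p R.:- p′ ; f = q R.:- q′ in
    p R.:* p R.:+ q R.:* q R.:= (p′ R.:* p′ R.:+ q′ R.:* q′) R.:+ ((p′ R.:* e R.:+ q′ R.:* f) R.:+ (p′ R.:* e R.:+ q′ R.:* f)) R.:+ (e R.:* e R.:+ f R.:* f))
    ≋-refl p q p′ q′
  cross : p′ * e + q′ * f ≼ m * (∣ e ∣ + ∣ f ∣)
  cross = ≼-trans (≼-mono-+ (∣∣≼⇒≼ (∣∣-*≼ (∣re∣≼modulus p′ q′) (≼-refl {∣ e ∣}))) (∣∣≼⇒≼ (∣∣-*≼ (∣im∣≼modulus p′ q′) (≼-refl {∣ f ∣}))))
    (≼-reflexive (≋-sym (*-distribˡ m ∣ e ∣ ∣ f ∣)))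

modulus-diff : ∀ p q p′ q′ → ∣ modulus p q - modulus p′ q′ ∣ ≼ ∣ p - p′ ∣ + ∣ q - q′ ∣
modulus-diff p q p′ q′ = ∣∣≼
  (≼-resp ≋-refl (R.solve 2 (λ m d → m R.:+ d R.:- m R.:= d) ≋-refl (modulus p′ q′) _) (≼-mono-+ (modulus-step p q p′ q′) ≼-refl))
  (≼-resp (R.solve 2 (λ m n → n R.:- m R.:= R.:- (m R.:- n)) ≋-refl (modulus p q) (modulus p′ q′))
    (≋-trans (R.solve 2 (λ m d → m R.:+ d R.:- m R.:= d) ≋-refl (modulus p q) _) (+-cong (∣∣-swap p′ p) (∣∣-swap q′ q)))
    (≼-mono-+ (modulus-step p′ q′ p q) ≼-refl))

lip-modulus : ∀ {f g} → Lipschitz f → Lipschitz g → Lipschitz (λ x → modulus (f x) (g x))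
lip-modulus {f} {g} (L , 0≼L , h) (M , 0≼M , k) = L + M , 0≼+ 0≼L 0≼M , λ x y x∈ y∈ →
  ≼-trans (modulus-diff (f x) (g x) (f y) (g y)) (≼-trans (≼-mono-+ (h x y x∈ y∈) (k x y x∈ y∈))
    (≼-reflexive (R.solve 3 (λ l m d → l R.:* d R.:+ m R.:* d R.:= (l R.:+ m) R.:* d) ≋-refl L M ∣ x - y ∣)))

-- Lagrange's identity: (p u + q v)² + (p v - q u)² = (p² + q²)(u² + v²).
cauchy-schwarz : ∀ p q u v {B} → 0r ≼ B → u * u + v * v ≼ B * B → p * u + q * v ≼ B * modulus p q
cauchy-schwarz p q u v {B} 0≼B h = sq-cancel (*-nonneg 0≼B (modulus-nonneg p q))
  (≼-trans (≼-by ((p * v - q * u) * (p * v - q * u))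
      (R.solve 4 (λ p q u v → (p R.:* p R.:+ q R.:* q) R.:* (u R.:* u R.:+ v R.:* v) R.:=
        (p R.:* u R.:+ q R.:* v) R.:* (p R.:* u R.:+ q R.:* v) R.:+ (p R.:* v R.:- q R.:* u) R.:* (p R.:* v R.:- q R.:* u)) ≋-refl p q u v)
      (0≼sq _))
    (≼-trans (≼-*ˡ (0≼+ (0≼sq p) (0≼sq q)) h)
      (≼-reflexive (≋-trans (*-cong (≋-sym (modulus-sq p q)) ≋-refl)
        (R.solve 2 (λ m b → m R.:* m R.:* (b R.:* b) R.:= b R.:* m R.:* (b R.:* m)) ≋-refl (modulus p q) B)))))

-- The transform of a sign function as a trigonometric polynomial

opaque
  unfolding _+_

  re-∑ℂ : ∀ {n} (g : Fin n → D.ℂ) → D.re (D.∑ℂ g) ≡ sum (λ k → D.re (g k))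
  re-∑ℂ g = refl

  im-∑ℂ : ∀ {n} (g : Fin n → D.ℂ) → D.im (D.∑ℂ g) ≡ sum (λ k → D.im (g k))
  im-∑ℂ g = refl

  re-scale : ∀ q z → D.re (fromℚ q D.·ℂ z) ≋ ⌜ q ⌝ * D.re z
  re-scale q z = pointwise {D.re (fromℚ q D.·ℂ z)} {⌜ q ⌝ * D.re z} λ _ → refl

  im-scale : ∀ q z → D.im (fromℚ q D.·ℂ z) ≋ ⌜ q ⌝ * D.im z
  im-scale q z = pointwise {D.im (fromℚ q D.·ℂ z)} {⌜ q ⌝ * D.im z} λ _ → refl

  angle-unfold : ∀ p m x → D.neg (fromℕ 2 D.* p D.* fromℕ m D.* x) ≋ - (⌜ ι 2 ⌝ * p * ⌜ ι m ⌝ * x)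
  angle-unfold p m x = pointwise {D.neg (fromℕ 2 D.* p D.* fromℕ m D.* x)} { - (⌜ ι 2 ⌝ * p * ⌜ ι m ⌝ * x)} λ _ → refl

opaque
  unfolding cos

  re-exp : ∀ y → D.re (D.exp (0ℝ D.+i y)) ≡ cos y
  re-exp y = refl

  im-exp : ∀ y → D.im (D.exp (0ℝ D.+i y)) ≡ sin y
  im-exp y = refl

angle : ∀ m x → D.neg (fromℕ 2 D.* D.π D.* fromℕ m D.* x) ≋ phase m x
angle m x = ≋-trans (angle-unfold D.π m x) (neg-cong (*-cong (*-cong (≋-sym τ≋2π) ≋-refl) ≋-refl))

wave : ℚ → ℝ → D.ℂ
wave q y = fromℚ q D.·ℂ D.exp (0ℝ D.+i y)

re-wave : ∀ q y → D.re (wave q y) ≋ ⌜ q ⌝ * cos y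
re-wave q y = ≋-trans (re-scale q (D.exp (0ℝ D.+i y))) (*-cong ≋-refl (≡⇒≋ (re-exp y)))

im-wave : ∀ q y → D.im (wave q y) ≋ ⌜ q ⌝ * sin y
im-wave q y = ≋-trans (im-scale q (D.exp (0ℝ D.+i y))) (*-cong ≋-refl (≡⇒≋ (im-exp y)))

re-waves : ∀ {n} (c : Fin n → ℚ) (y : Fin n → ℝ) → D.re (D.∑ℂ (λ k → wave (c k) (y k))) ≋ sum (λ k → ⌜ c k ⌝ * cos (y k))
re-waves c y = ≋-trans (≡⇒≋ (re-∑ℂ (λ k → wave (c k) (y k)))) (sum-cong-≋ (λ k → re-wave (c k) (y k)))

im-waves : ∀ {n} (c : Fin n → ℚ) (y : Fin n → ℝ) → D.im (D.∑ℂ (λ k → wave (c k) (y k))) ≋ sum (λ k → ⌜ c k ⌝ * sin (y k))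
im-waves c y = ≋-trans (≡⇒≋ (im-∑ℂ (λ k → wave (c k) (y k)))) (sum-cong-≋ (λ k → im-wave (c k) (y k)))

module _ {R} (f : SignFunction (X′ R)) (x : ℝ) where

  private
    transform-unfold : (f D.^) x ≡ D.∑ℂ (λ n → wave (extend f n ℚ./ 1) (D.neg (fromℕ 2 D.* D.π D.* fromℕ (D.int n) D.* x)))
    transform-unfold = refl

  re-transform : D.re ((f D.^) x) ≋ sum (λ n → ⌜ extend f n ℚ./ 1 ⌝ * cos (phase (suc (toℕ n)) x))
  re-transform = ≋-trans (≡⇒≋ (cong D.re transform-unfold))
    (≋-trans (re-waves (λ n → extend f n ℚ./ 1) (λ n → D.neg (fromℕ 2 D.* D.π D.* fromℕ (D.int n) D.* x)))
      (sum-cong-≋ λ n → *-cong (≋-refl {⌜ extend f n ℚ./ 1 ⌝}) (cos-cong (angle (D.int n) x))))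

  im-transform : D.im ((f D.^) x) ≋ sum (λ n → ⌜ extend f n ℚ./ 1 ⌝ * sin (phase (suc (toℕ n)) x))
  im-transform = ≋-trans (≡⇒≋ (cong D.im transform-unfold))
    (≋-trans (im-waves (λ n → extend f n ℚ./ 1) (λ n → D.neg (fromℕ 2 D.* D.π D.* fromℕ (D.int n) D.* x)))
      (sum-cong-≋ λ n → *-cong (≋-refl {⌜ extend f n ℚ./ 1 ⌝}) (sin-cong (angle (D.int n) x))))

opaque
  unfolding _+_

  modulus-unfold : ∀ z → D.∣ z ∣ℂ ≋ modulus (D.re z) (D.im z)
  modulus-unfold z = pointwise {D.∣ z ∣ℂ} {modulus (D.re z) (D.im z)} λ _ → refl

  square-unfold : ∀ (g : ℝ → ℝ) N → D.∫₀¹ (λ x → g x * g x) ≐ N → D.∫₀¹ (λ x → g x D.* g x) ≐ N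
  square-unfold g N h = h

  0<-intro : ∀ x → 1r ≼ x → 0ℝ < x
  0<-intro x h = ½ , DR.0<½ , ev-map (λ n le → lower (D.seq x n) le) (h ½ DR.0<½)
    where
    lower : ∀ q → 1ℚ ℚ.≤ q ℚ.+ ½ → 0ℚ ℚ.+ ½ ℚ.≤ q
    lower q le = subst (0ℚ ℚ.+ ½ ℚ.≤_)
      (trans (ℚₚ.+-assoc q ½ (ℚ.- ½)) (ℚₚ.+-identityʳ q)) (ℚₚ.+-monoˡ-≤ (ℚ.- ½) le)

  0<recip : ∀ n → 0ℝ < ⌜ recip n ⌝
  0<recip n = recip n , DR.0<recip n , 0 , λ _ _ → ℚₚ.≤-reflexive (ℚₚ.+-identityˡ (recip n))

  InClass : ∀ R → ℝ → SignFunction (X′ R) → Set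
  InClass = ℋ

  inClass⇒ℋ : ∀ {R c₀} (f : SignFunction (X′ R)) → InClass R c₀ f → ℋ R c₀ f
  inClass⇒ℋ f h = h

  ℋ-intro : ∀ {R} (f : SignFunction (X′ R)) {I₁ N ρ c₀} →
    D.∫₀¹ (λ x → D.∣ (f D.^) x ∣ℂ) ≐ I₁ →
    D.∫₀¹ (λ x → D.∣ (f D.^) x ∣ℂ * D.∣ (f D.^) x ∣ℂ) ≐ N →
    0ℝ < √ N → ρ * √ N ≋ I₁ → c₀ ≼ ρ → InClass R c₀ f
  ℋ-intro f {I₁} {N} {ρ} L¹ L² 0<√N ρ√N c₀≼ρ =
    ρ , (I₁ , √ N , L¹ , (N , square-unfold (λ x → D.∣ (f D.^) x ∣ℂ) N L² , ≋-refl {√ N}) , 0<√N , ρ√N) , c₀≼ρ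

  ≤-intro : ∀ c {m n} → c * ⌜ ι m ⌝ ≼ ⌜ ι n ⌝ → c D.* fromℕ m D.≤ fromℕ n
  ≤-intro c h = h

extendℕ : ∀ {n} → (Fin n → ℝ) → ℕ → ℝ
extendℕ {zero}  v k       = 0r
extendℕ {suc n} v zero    = v zero
extendℕ {suc n} v (suc k) = extendℕ (λ i → v (suc i)) k

extendℕ-toℕ : ∀ {n} (v : Fin n → ℝ) i → extendℕ v (toℕ i) ≡ v i
extendℕ-toℕ {suc n} v zero    = refl
extendℕ-toℕ {suc n} v (suc i) = extendℕ-toℕ (λ i → v (suc i)) i

modulus-cong : ∀ {p q p′ q′} → p ≋ p′ → q ≋ q′ → modulus p q ≋ modulus p′ q′
modulus-cong {p} {q} {p′} {q′} e f = ≋-of-zero (≼-trans (modulus-diff p q p′ q′)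
  (≼-reflexive (≋-trans (+-cong (vanish e) (vanish f)) (+-identityˡ 0r))))
  where
  vanish : ∀ {a b} → a ≋ b → ∣ a - b ∣ ≋ 0r
  vanish {a} {b} e = ≋-trans (∣∣-cong (≋-trans (+-cong e ≋-refl) (-‿inverseʳ b))) (∣∣-nonneg ≼-refl)

isIntegral-≋ : ∀ {g h I} → (∀ x → g x ≋ h x) → IsIntegral g I → IsIntegral h I
isIntegral-≋ e (L , b) = L , λ n ξ t →
  ≼-resp (∣∣-cong (+-cong (*-cong ≋-refl (sum-cong-≋ (λ k → e (ξ k)))) ≋-refl)) ≋-refl (b n ξ t)

-- The norms of the transform and its Fourier Ratio

module Transform {R : ℕ} (f : SignFunction (X′ R)) where

  coeff : Fin R → ℝ
  coeff i = ⌜ extend f i ℚ./ 1 ⌝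

  a : ℕ → ℝ
  a = extendℕ coeff

  re≋ : ∀ x → Re a R x ≋ D.re ((f D.^) x)
  re≋ x = ≋-trans (sum-cong-≋ (λ i → *-cong (≡⇒≋ (extendℕ-toℕ coeff i)) ≋-refl)) (≋-sym (re-transform f x))

  im≋ : ∀ x → Im a R x ≋ D.im ((f D.^) x)
  im≋ x = ≋-trans (sum-cong-≋ (λ i → *-cong (≡⇒≋ (extendℕ-toℕ coeff i)) ≋-refl)) (≋-sym (im-transform f x))

  ∣F∣ : ℝ → ℝ
  ∣F∣ x = modulus (Re a R x) (Im a R x)

  ∣F∣≋ : ∀ x → ∣F∣ x ≋ D.∣ (f D.^) x ∣ℂ
  ∣F∣≋ x = ≋-trans (modulus-cong (re≋ x) (im≋ x)) (≋-sym (modulus-unfold ((f D.^) x)))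

  lip-∣F∣ : Lipschitz ∣F∣
  lip-∣F∣ = lip-modulus {Re a R} {Im a R} (lip-Re a R) (lip-Im a R)

  lip-∣F∣² : Lipschitz (λ x → ∣F∣ x * ∣F∣ x)
  lip-∣F∣² = lip-* {∣F∣} {∣F∣} lip-∣F∣ lip-∣F∣

  ‖F‖₁ : ℝ
  ‖F‖₁ = ∫ {∣F∣} (proj₁ (proj₂ lip-∣F∣)) (proj₂ (proj₂ lip-∣F∣))

  -- Pairing F with a polynomial bounded by b bounds ‖F‖₁ from below.
  ‖F‖₁-lower : ∀ k b → R ℕ.≤ 2 ℕ.^ k → 2 ℕ.^ suc k ≡ suc b ℕ.* suc b →
    ⌜ recip b ⌝ * Σ< R (λ i → a i * signℝ (rsP k i)) ≼ ‖F‖₁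
  ‖F‖₁-lower k b R≤ sq = ∫-lower {∣F∣} (proj₁ (proj₂ lip-∣F∣)) (proj₂ (proj₂ lip-∣F∣)) λ N →
    case admissible-exists (2 ℕ.^ k) N of λ (n , n≥ , adm) → n , n≥ ,
      ≼-resp (*-cong ≋-refl (average-pairing a R r (2 ℕ.^ k) R≤ adm))
        (≋-trans (*-cong ≋-refl (average-scale n B ∣F∣)) (≋-trans (≋-sym (*-assoc _ _ _))
          (≋-trans (*-cong (≋-trans (*-comm _ _) (ι*recip b)) ≋-refl) (*-identityˡ _))))
        (≼-*ˡ (0≼recip b) (average-mono n {pairing a R r (2 ℕ.^ k)} {λ x → B * ∣F∣ x} λ x →
          cauchy-schwarz (Re a R x) (Im a R x) (Re r (2 ℕ.^ k) x) (Im r (2 ℕ.^ k) x) (0≼ι (suc b))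
            (≼-trans (rudin-shapiro-bound x k) (≼-reflexive (≋-trans (⌜⌝-cong (cong ι sq)) (ι-* (suc b) (suc b)))))))
    where
    r : ℕ → ℝ
    r i = signℝ (rsP k i)
    B : ℝ
    B = ⌜ ι (suc b) ⌝

  -- On admissible grids the average of |F|², the pairing of F with itself, equals the sum of
  -- squares exactly; such grids are arbitrarily fine, so this value bounds the integral from both
  -- sides.
  parseval : IsIntegral (λ x → ∣F∣ x * ∣F∣ x) (Σ< R (λ i → a i * a i))
  parseval = isIntegral-cong {∣F∣²}
    (≼-antisym (∫-upper {∣F∣²} 0≼L lip λ N → value N (λ n e → ≼-reflexive e)) (∫-lower {∣F∣²} 0≼L lip λ N → value N (λ n e → ≼-reflexive (≋-sym e))))
    (∫-isIntegral {∣F∣²} 0≼L lip)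
    where
    ∣F∣² : ℝ → ℝ
    ∣F∣² x = ∣F∣ x * ∣F∣ x
    0≼L = proj₁ (proj₂ lip-∣F∣²)
    lip = proj₂ (proj₂ lip-∣F∣²)
    value : ∀ {P : ℕ → Set} N → (∀ n → average n (λ x → ∣F∣ x * ∣F∣ x) ≋ Σ< R (λ i → a i * a i) → P n) → ∃[ n ] (N ℕ.≤ n × P n)
    value N k = case admissible-exists R N of λ (n , n≥ , adm) → n , n≥ , k n
      (≋-trans (average-cong n {λ x → ∣F∣ x * ∣F∣ x} {pairing a R a R} (λ x → modulus-sq (Re a R x) (Im a R x))) (average-pairing a R a R ℕₚ.≤-refl adm))

  -- With ν = N + 1 and B = b + 1, pairing gives ‖F‖₁ ≥ ν/(2B), and ‖F‖₂ = √ν by Parseval, so the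
  -- ratio is at least √ν/(2B). From B² ≤ 36 ν follows B ≤ 6 √ν, hence 1/12.
  ratio : ∀ N k b → R ℕ.≤ 2 ℕ.^ k → 2 ℕ.^ suc k ≡ suc b ℕ.* suc b →
    Σ< R (λ i → a i * a i) ≋ ⌜ ι (suc N) ⌝ →
    ⌜ ½ ⌝ * ⌜ ι (suc N) ⌝ ≼ Σ< R (λ i → a i * signℝ (rsP k i)) →
    ⌜ ι (suc b ℕ.* suc b) ⌝ ≼ ⌜ ι 36 ⌝ * ⌜ ι (suc N) ⌝ →
    InClass R ⌜ recip 11 ⌝ f
  ratio N k b R≤ sq energy correlation b²≼ = ℋ-intro f {‖F‖₁} {ν} {ρ} {⌜ recip 11 ⌝}
    (integral {λ x → D.∣ (f D.^) x ∣ℂ} (isIntegral-≋ {∣F∣} {λ x → D.∣ (f D.^) x ∣ℂ} ∣F∣≋ (∫-isIntegral {∣F∣} (proj₁ (proj₂ lip-∣F∣)) (proj₂ (proj₂ lip-∣F∣)))))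
    (integral {λ x → D.∣ (f D.^) x ∣ℂ * D.∣ (f D.^) x ∣ℂ}
      (isIntegral-≋ {λ x → ∣F∣ x * ∣F∣ x} {λ x → D.∣ (f D.^) x ∣ℂ * D.∣ (f D.^) x ∣ℂ} (λ x → *-cong (∣F∣≋ x) (∣F∣≋ x))
        (isIntegral-cong {λ x → ∣F∣ x * ∣F∣ x} energy parseval)))
    (0<-intro s (sq-cancel (√-nonneg ν) (≼-resp (≋-sym (*-identityˡ 1r)) (≋-sym s²) (⌜⌝-mono (DR.ι-mono (ℕ.s≤s (ℕ.z≤n {N})))))))
    (≋-trans (R.solve 3 (λ i s r → i R.:* s R.:* r R.:* s R.:= i R.:* (s R.:* s R.:* r)) ≋-refl ‖F‖₁ s ⌜ recip N ⌝)
      (≋-trans (*-cong ≋-refl (≋-trans (*-cong s² ≋-refl) (ι*recip N))) (*-identityʳ _)))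
    bound
    where
    ν s ρ β B : ℝ
    ν = ⌜ ι (suc N) ⌝
    s = √ ν
    -- The quotient ‖F‖₁/s, with 1/s written as s/ν so that only the rational ν is inverted.
    ρ = ‖F‖₁ * s * ⌜ recip N ⌝
    β = ⌜ recip b ⌝
    B = ⌜ ι (suc b) ⌝
    s² : s * s ≋ ν
    s² = ≋-trans (√-sq ν) (∣∣-nonneg (0≼ι (suc N)))
    B≼6s : B ≼ ⌜ ι 6 ⌝ * s
    B≼6s = sq-cancel (*-nonneg (0≼ι 6) (√-nonneg ν)) (≼-resp (ι-* (suc b) (suc b))
      (≋-trans (*-cong ≋-refl (≋-sym s²)) (R.solve 1 (λ s → R.con (ι 36) R.:* (s R.:* s) R.:= R.con (ι 6) R.:* s R.:* (R.con (ι 6) R.:* s)) ≋-refl s)) b²≼)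
    1≼6βs : 1r ≼ β * (⌜ ι 6 ⌝ * s)
    1≼6βs = ≼-trans (≼-reflexive (≋-sym (≋-trans (*-comm β B) (ι*recip b)))) (≼-*ˡ (0≼recip b) B≼6s)
    bound : ⌜ recip 11 ⌝ ≼ ρ
    bound = begin
      ⌜ recip 11 ⌝
        ≈⟨ *-identityʳ _ ⟨
      ⌜ recip 11 ⌝ * 1r
        ≲⟨ ≼-*ˡ (0≼recip 11) 1≼6βs ⟩
      ⌜ recip 11 ⌝ * (β * (⌜ ι 6 ⌝ * s))
        ≈⟨ R.solve 2 (λ b s → R.con (recip 11) R.:* (b R.:* (R.con (ι 6) R.:* s)) R.:= b R.:* R.con ½ R.:* s) ≋-refl β s ⟩
      β * ⌜ ½ ⌝ * s
        ≈⟨ *-identityʳ _ ⟨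
      β * ⌜ ½ ⌝ * s * 1r
        ≈⟨ *-cong ≋-refl (ι*recip N) ⟨
      β * ⌜ ½ ⌝ * s * (ν * ⌜ recip N ⌝)
        ≈⟨ R.solve 5 (λ b h s n r → b R.:* h R.:* s R.:* (n R.:* r) R.:= s R.:* r R.:* (b R.:* (h R.:* n))) ≋-refl β ⌜ ½ ⌝ s ν ⌜ recip N ⌝ ⟩
      s * ⌜ recip N ⌝ * (β * (⌜ ½ ⌝ * ν))
        ≲⟨ ≼-*ˡ (*-nonneg (√-nonneg ν) (0≼recip N)) (≼-trans (≼-*ˡ (0≼recip b) correlation) (‖F‖₁-lower k b R≤ sq)) ⟩
      s * ⌜ recip N ⌝ * ‖F‖₁
        ≈⟨ R.solve 3 (λ s r i → s R.:* r R.:* i R.:= i R.:* s R.:* r) ≋-refl s ⌜ recip N ⌝ ‖F‖₁ ⟩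
      ρ ∎
      where open ≼R

-- The shattered set

∈-tabulate : ∀ {n} (p : ℕ → Bool) {i : Fin n} → i ∈ tabulate (λ i → p (toℕ i)) → p (toℕ i) ≡ true
∈-tabulate p {i} h = trans (sym (lookup∘tabulate (λ i → p (toℕ i)) i)) ([]=⇒lookup h)

tabulate-∈ : ∀ {n} (p : ℕ → Bool) {i : Fin n} → p (toℕ i) ≡ true → i ∈ tabulate (λ i → p (toℕ i))
tabulate-∈ p {i} h = lookup⇒[]= i _ (trans (lookup∘tabulate (λ i → p (toℕ i)) i) h)

∧-left : ∀ {a b} → a ∧ b ≡ true → a ≡ true
∧-left {true} _ = refl

module _ {R : ℕ} (f : SignFunction (X′ R)) (i : Fin R) where

  extend-∈ : (i∈ : i ∈ X′ R) → extend f i ≡ f i i∈ ℤ.◃ 1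
  extend-∈ i∈ with i ∈? X′ R
  ... | yes i∈′ = cong (λ z → f i z ℤ.◃ 1) ([]=-irrelevant i∈′ i∈)
  ... | no  i∉  = contradiction i∈ i∉

  extend-∉ : ¬ (i ∈ X′ R) → extend f i ≡ + 0
  extend-∉ i∉ with i ∈? X′ R
  ... | yes i∈ = contradiction i∈ i∉
  ... | no  _  = refl

sign-value : ∀ s → ⌜ (s ℤ.◃ 1) ℚ./ 1 ⌝ ≋ signℝ s
sign-value Sign.+ = ≋-refl
sign-value Sign.- = ⌜⌝-neg 1ℚ

signℝ-≽ : ∀ s t → - 1r ≼ signℝ s * signℝ t
signℝ-≽ Sign.+ Sign.+ = ≼-by ⌜ ι 2 ⌝ (R.solve 0 (R.con 1ℚ R.:* R.con 1ℚ R.:= R.:- R.con 1ℚ R.:+ R.con (ι 2)) ≋-refl) (0≼ι 2)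
signℝ-≽ Sign.+ Sign.- = ≼-reflexive (≋-sym (*-identityˡ _))
signℝ-≽ Sign.- Sign.+ = ≼-reflexive (≋-sym (*-identityʳ _))
signℝ-≽ Sign.- Sign.- = ≼-by ⌜ ι 2 ⌝ (R.solve 0 (R.:- R.con 1ℚ R.:* R.:- R.con 1ℚ R.:= R.:- R.con 1ℚ R.:+ R.con (ι 2)) ≋-refl) (0≼ι 2)

module Extension (R k m : ℕ) where

  inS : ℕ → Bool
  inS n = isSquarefree n ∧ (n ℕ.<ᵇ m)

  S : Subset R
  S = tabulate (λ i → inS (toℕ i))

  S⊆X′ : S ⊆ X′ R
  S⊆X′ i∈S = tabulate-∈ isSquarefree (∧-left (∈-tabulate inS i∈S))

  module _ (σ : SignFunction S) where

    choose : (i : Fin R) → Dec (i ∈ S) → Sign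
    choose i (yes i∈S) = σ i i∈S
    choose i (no _)    = rsP k (toℕ i)

    f : SignFunction (X′ R)
    f i _ = choose i (i ∈? S)

    f-extends : ∀ i (i∈S : i ∈ S) → f i (S⊆X′ i∈S) ≡ σ i i∈S
    f-extends i i∈S = go (i ∈? S)
      where
      go : (d : Dec (i ∈ S)) → choose i d ≡ σ i i∈S
      go (yes i∈S′) = cong (σ i) ([]=-irrelevant i∈S′ i∈S)
      go (no i∉S)   = contradiction i∈S i∉S

    open Transform f

    coeff-∈ : ∀ i → isSquarefree (toℕ i) ≡ true → coeff i ≋ signℝ (choose i (i ∈? S))
    coeff-∈ i sf = ≋-trans (⌜⌝-cong (cong (ℚ._/ 1) (extend-∈ f i (tabulate-∈ isSquarefree sf)))) (sign-value (choose i (i ∈? S)))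

    coeff-∉ : ∀ i → isSquarefree (toℕ i) ≡ false → coeff i ≋ 0r
    coeff-∉ i nsf = ⌜⌝-cong (cong (ℚ._/ 1) (extend-∉ f i λ i∈ →
      contradiction (trans (sym (∈-tabulate isSquarefree i∈)) nsf) λ ()))

    by-squarefree : ∀ {P : Bool → Set} n → (isSquarefree n ≡ true → P true) → (isSquarefree n ≡ false → P false) → P (isSquarefree n)
    by-squarefree n t e with isSquarefree n
    ... | true  = t refl
    ... | false = e refl

    energy : Σ< R (λ i → a i * a i) ≋ ⌜ ι (squarefreeCount R) ⌝
    energy = ≋-trans (sum-cong-≋ {R} λ i → ≋-trans
        (*-cong (≡⇒≋ (extendℕ-toℕ coeff i)) (≡⇒≋ (extendℕ-toℕ coeff i)))
        (by-squarefree {λ b → coeff i * coeff i ≋ indicator b} (toℕ i)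
          (λ sf → ≋-trans (*-cong (coeff-∈ i sf) (coeff-∈ i sf)) (signℝ-sq (choose i (i ∈? S))))
          (λ nsf → ≋-trans (*-cong (coeff-∉ i nsf) ≋-refl) (zeroˡ _))))
      (Σ<-indicator R isSquarefree)

    -- Term by term: a squarefree index off S contributes exactly 1, one in S contributes at least
    -- -1 = 1 - 2, and the remaining indices contribute 0.
    correlation : ⌜ ι (squarefreeCount R) ⌝ - ⌜ ι 2 ⌝ * ⌜ ι (count< R inS) ⌝ ≼ Σ< R (λ i → a i * signℝ (rsP k i))
    correlation = ≼-trans (≼-reflexive (≋-trans
        (+-cong (≋-sym (Σ<-indicator R isSquarefree))
          (≋-trans (R.solve 2 (λ t c → R.:- (t R.:* c) R.:= R.:- t R.:* c) ≋-refl ⌜ ι 2 ⌝ ⌜ ι (count< R inS) ⌝)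
            (≋-trans (*-cong ≋-refl (≋-sym (Σ<-indicator R inS))) (≋-sym (Σ<-scale R (- ⌜ ι 2 ⌝) (λ i → indicator (inS i)))))))
        (≋-sym (Σ<-+ R (λ i → indicator (isSquarefree i)) (λ i → - ⌜ ι 2 ⌝ * indicator (inS i))))))
      (sum-mono {R} λ i → ≼-trans (pointwise-bound i)
        (≼-reflexive (*-cong (≋-sym (≡⇒≋ (extendℕ-toℕ coeff i))) ≋-refl)))
      where
      r : Fin R → ℝ
      r i = signℝ (rsP k (toℕ i))
      bound : Bool → Bool → ℝ
      bound b c = indicator b + - ⌜ ι 2 ⌝ * indicator c
      inside : ∀ i → (d : Dec (i ∈ S)) → bound true (inS (toℕ i)) ≼ signℝ (choose i d) * r i
      inside i (yes i∈S) = subst (λ c → bound true c ≼ signℝ (σ i i∈S) * r i) (sym (∈-tabulate inS i∈S))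
        (≼-trans (≼-reflexive (R.solve 0 (R.con 1ℚ R.:+ R.:- R.con (ι 2) R.:* R.con 1ℚ R.:= R.:- R.con 1ℚ) ≋-refl)) (signℝ-≽ (σ i i∈S) (rsP k (toℕ i))))
      inside i (no i∉S) = ≼-trans (drop (inS (toℕ i))) (≼-reflexive (≋-sym (signℝ-sq (rsP k (toℕ i)))))
        where
        drop : ∀ c → bound true c ≼ 1r
        drop c = ≼-by (⌜ ι 2 ⌝ * indicator c) (R.solve 2 (λ t c → R.con 1ℚ R.:= R.con 1ℚ R.:+ R.:- t R.:* c R.:+ t R.:* c) ≋-refl ⌜ ι 2 ⌝ (indicator c))
          (*-nonneg (0≼ι 2) (0≼ι (bit c)))
      pointwise-bound : ∀ i → bound (isSquarefree (toℕ i)) (inS (toℕ i)) ≼ coeff i * r i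
      pointwise-bound i = by-squarefree {λ b → bound b (inS (toℕ i)) ≼ coeff i * r i} (toℕ i)
        (λ sf → ≼-trans (inside i (i ∈? S)) (≼-reflexive (*-cong (≋-sym (coeff-∈ i sf)) ≋-refl)))
        (λ nsf → ≼-trans
          (≼-by (⌜ ι 2 ⌝ * indicator (inS (toℕ i)))
            (R.solve 2 (λ t c → R.con 0ℚ R.:= R.con 0ℚ R.:+ R.:- t R.:* c R.:+ t R.:* c) ≋-refl ⌜ ι 2 ⌝ (indicator (inS (toℕ i))))
            (*-nonneg (0≼ι 2) (0≼ι (bit (inS (toℕ i))))))
          (≼-reflexive (≋-sym (≋-trans (*-cong (coeff-∉ i nsf) ≋-refl) (zeroˡ _)))))

dyadic : ∀ R → 1 ℕ.≤ R → ∃[ j ] (R ℕ.≤ 2 ℕ.^ suc (j ℕ.+ j) × 2 ℕ.^ (j ℕ.+ j) ℕ.≤ 2 ℕ.* R)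
dyadic (suc zero)    _ = 0 , ℕₚ.n≤1+n 1 , ℕₚ.n≤1+n 1
dyadic (suc (suc R)) _ = case dyadic (suc R) (ℕ.s≤s ℕ.z≤n) of λ (j , upper , lower) →
  next j upper lower (ℕₚ.m≤n⇒m<n∨m≡n upper)
  where
  next : ∀ j → suc R ℕ.≤ 2 ℕ.^ suc (j ℕ.+ j) → 2 ℕ.^ (j ℕ.+ j) ℕ.≤ 2 ℕ.* suc R →
    (suc R ℕ.< 2 ℕ.^ suc (j ℕ.+ j)) ⊎ (suc R ≡ 2 ℕ.^ suc (j ℕ.+ j)) →
    ∃[ j ] (suc (suc R) ℕ.≤ 2 ℕ.^ suc (j ℕ.+ j) × 2 ℕ.^ (j ℕ.+ j) ℕ.≤ 2 ℕ.* suc (suc R))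
  next j upper lower (inj₁ lt) = j , lt , ℕₚ.≤-trans lower (ℕₚ.*-monoʳ-≤ 2 (ℕₚ.n≤1+n (suc R)))
  next j upper lower (inj₂ eq) = suc j ,
    subst (λ l → suc (suc R) ℕ.≤ 2 ℕ.^ suc l) (sym (ℕₚ.+-suc (suc j) j))
      (ℕₚ.≤-trans (ℕₚ.+-monoˡ-≤ (suc R) (ℕ.s≤s (ℕ.z≤n {R}))) (ℕₚ.≤-trans double quadruple)) ,
    subst (λ l → 2 ℕ.^ l ℕ.≤ 2 ℕ.* suc (suc R)) (sym (ℕₚ.+-suc (suc j) j))
      (ℕₚ.*-monoʳ-≤ 2 (ℕₚ.≤-trans (ℕₚ.≤-reflexive (sym eq)) (ℕₚ.n≤1+n (suc R))))
    where
    double : suc R ℕ.+ suc R ℕ.≤ 2 ℕ.* 2 ℕ.^ suc (j ℕ.+ j)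
    double = ℕₚ.≤-trans (ℕₚ.≤-reflexive (cong (suc R ℕ.+_) (sym (ℕₚ.+-identityʳ (suc R))))) (ℕₚ.*-monoʳ-≤ 2 upper)
    quadruple : 2 ℕ.* 2 ℕ.^ suc (j ℕ.+ j) ℕ.≤ 2 ℕ.^ suc (suc (suc (j ℕ.+ j)))
    quadruple = ℕₚ.m≤m+n _ _

-- With k = 2j + 1 and b + 1 = 2^(j+1), the square (b+1)² is 4 · 2^(2j), at most 4 · 2R.
scale : ∀ R → 1 ℕ.≤ R → ∃[ k ] ∃[ b ] (R ℕ.≤ 2 ℕ.^ k × 2 ℕ.^ suc k ≡ suc b ℕ.* suc b × suc b ℕ.* suc b ℕ.≤ 8 ℕ.* R)
scale R 1≤R = case dyadic R 1≤R of λ (j , upper , lower) → from j upper lower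
  where
  from : ∀ j → R ℕ.≤ 2 ℕ.^ suc (j ℕ.+ j) → 2 ℕ.^ (j ℕ.+ j) ℕ.≤ 2 ℕ.* R →
    ∃[ k ] ∃[ b ] (R ℕ.≤ 2 ℕ.^ k × 2 ℕ.^ suc k ≡ suc b ℕ.* suc b × suc b ℕ.* suc b ℕ.≤ 8 ℕ.* R)
  from j upper lower = suc (j ℕ.+ j) , b , upper , b² ,
    ℕₚ.≤-trans (ℕₚ.≤-reflexive (trans (sym b²) (sym (ℕₚ.*-assoc 2 2 (2 ℕ.^ (j ℕ.+ j))))))
      (ℕₚ.≤-trans (ℕₚ.*-monoʳ-≤ 4 lower) (ℕₚ.≤-reflexive (sym (ℕₚ.*-assoc 4 2 R))))
    where
    b : ℕ
    b = ℕ.pred (2 ℕ.^ suc j)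
    suc-b : suc b ≡ 2 ℕ.^ suc j
    suc-b = ℕₚ.suc-pred (2 ℕ.^ suc j) {{ℕₚ.m^n≢0 2 (suc j)}}
    b² : 2 ℕ.^ suc (suc (j ℕ.+ j)) ≡ suc b ℕ.* suc b
    b² = trans (cong (λ l → 2 ℕ.^ suc l) (sym (ℕₚ.+-suc j j)))
      (trans (ℕₚ.^-distribˡ-+-* 2 (suc j) (suc j)) (sym (cong₂ ℕ._*_ suc-b suc-b)))

-- The numerical estimates

module Construction (R : ℕ) (16≤R : 16 ℕ.≤ R) where

  R₁ : ℕ
  R₁ = R ℕ./ 16

  1≤R : 1 ℕ.≤ R
  1≤R = ℕₚ.≤-trans (ℕ.s≤s ℕ.z≤n) 16≤R

  module _ (k b : ℕ) (R≤2^k : R ℕ.≤ 2 ℕ.^ k) (b²-eq : 2 ℕ.^ suc k ≡ suc b ℕ.* suc b)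
           (b²≤8R : suc b ℕ.* suc b ℕ.≤ 8 ℕ.* R) where

    open Extension R k R₁

    ν ρ ρ₁ s : ℝ
    ν = ⌜ ι (squarefreeCount R) ⌝
    ρ = ⌜ ι R ⌝
    ρ₁ = ⌜ ι R₁ ⌝
    s = ⌜ ι (size S) ⌝

    size-S : size S ≡ squarefreeCount R₁
    size-S = trans (size-tabulate R inS) (count<-restrict R₁ R isSquarefree (m/n≤m R 16))

    ¼ : ℚ
    ¼ = ½ ℚ.* ½

    0≼ν-ρ/4 : 0r ≼ ν - ρ * ⌜ ¼ ⌝
    0≼ν-ρ/4 = ≼⇒0≼- (squarefree-density R)

    0≼ρ-16ρ₁ : 0r ≼ ρ - ρ₁ * ⌜ ι 16 ⌝
    0≼ρ-16ρ₁ = ≼⇒0≼- (≼-trans (≼-reflexive (≋-sym (ι-* R₁ 16))) (⌜⌝-mono (DR.ι-mono (m/n*n≤m R 16))))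

    0≼ρ₁-s : 0r ≼ ρ₁ - s
    0≼ρ₁-s = ≼⇒0≼- (⌜⌝-mono (DR.ι-mono (ℕₚ.≤-trans (ℕₚ.≤-reflexive size-S) (count<-≤ R₁ isSquarefree))))

    -- The chain ν/2 ≥ ρ/8 ≥ 2ρ₁ ≥ 2s, written as one nonnegative combination of its three links;
    -- the cutoff R/16 is what makes the middle link hold.
    half-correlation : ⌜ ½ ⌝ * ν ≼ ν - ⌜ ι 2 ⌝ * s
    half-correlation = ≼-by (⌜ ½ ⌝ * (ν - ρ * ⌜ ¼ ⌝) + ⌜ ½ ℚ.* ¼ ⌝ * (ρ - ρ₁ * ⌜ ι 16 ⌝) + ⌜ ι 2 ⌝ * (ρ₁ - s))
      (R.solve 4 (λ n r q s → n R.:- R.con (ι 2) R.:* s R.:= R.con ½ R.:* n R.:+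
          (R.con ½ R.:* (n R.:- r R.:* R.con ¼) R.:+ R.con (½ ℚ.* ¼) R.:* (r R.:- q R.:* R.con (ι 16)) R.:+ R.con (ι 2) R.:* (q R.:- s))) ≋-refl ν ρ ρ₁ s)
      (0≼+ (0≼+ (*-nonneg (0≼recip 1) 0≼ν-ρ/4) (*-nonneg (0≼recip 7) 0≼ρ-16ρ₁)) (*-nonneg (0≼ι 2) 0≼ρ₁-s))

    -- The density gives 8ρ ≤ 32ν, and 36 is the next square.
    b²≼36ν : ⌜ ι (suc b ℕ.* suc b) ⌝ ≼ ⌜ ι 36 ⌝ * ν
    b²≼36ν = ≼-trans (≼-trans (⌜⌝-mono (DR.ι-mono b²≤8R)) (≼-reflexive (ι-* 8 R)))
      (≼-by (⌜ ι 32 ⌝ * (ν - ρ * ⌜ ¼ ⌝) + ⌜ ι 4 ⌝ * ν)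
        (R.solve 2 (λ n r → R.con (ι 36) R.:* n R.:= R.con (ι 8) R.:* r R.:+ (R.con (ι 32) R.:* (n R.:- r R.:* R.con ¼) R.:+ R.con (ι 4) R.:* n)) ≋-refl ν ρ)
        (0≼+ (*-nonneg (0≼ι 32) 0≼ν-ρ/4) (*-nonneg (0≼ι 4) (0≼ι (squarefreeCount R)))))

    -- The density at R₁ gives s ≥ ρ₁/4. Division with remainder gives ρ ≤ 16ρ₁ + 15, and ρ₁ ≥ 1,
    -- which is where R ≥ 16 enters, absorbs the 15: ρ ≤ 31ρ₁ ≤ 32ρ₁.
    large : ⌜ recip 127 ⌝ * ρ ≼ s
    large = ≼-by ((s - ρ₁ * ⌜ ¼ ⌝) + ⌜ recip 127 ⌝ * (⌜ ι 15 ⌝ + ρ₁ * ⌜ ι 16 ⌝ - ρ) + ⌜ ι 15 ℚ.* recip 127 ⌝ * (ρ₁ - 1r) + ⌜ recip 127 ⌝ * ρ₁)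
      (R.solve 3 (λ r q s → s R.:= R.con (recip 127) R.:* r R.:+
        ((s R.:- q R.:* R.con ¼) R.:+ R.con (recip 127) R.:* (R.con (ι 15) R.:+ q R.:* R.con (ι 16) R.:- r)
          R.:+ R.con (ι 15 ℚ.* recip 127) R.:* (q R.:- R.con 1ℚ) R.:+ R.con (recip 127) R.:* q)) ≋-refl ρ ρ₁ s)
      (0≼+ (0≼+ (0≼+ (≼⇒0≼- (≼-trans (squarefree-density R₁) (≼-reflexive (⌜⌝-cong (cong ι (sym size-S))))))
          (*-nonneg (0≼recip 127) (≼⇒0≼- (≼-trans (⌜⌝-mono (DR.ι-mono R≤)) (≼-reflexive (≋-trans (ι-+ 15 (R₁ ℕ.* 16)) (+-cong ≋-refl (ι-* R₁ 16))))))))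
        (*-nonneg (0≼⌜⌝ (DR.0≤* {ι 15} {recip 127} (DR.0≤ι 15) (ℚₚ.<⇒≤ (DR.0<recip 127)))) (≼⇒0≼- (⌜⌝-mono (DR.ι-mono 1≤R₁)))))
        (*-nonneg (0≼recip 127) (0≼ι R₁)))
      where
      R≤ : R ℕ.≤ 15 ℕ.+ R₁ ℕ.* 16
      R≤ = ℕₚ.≤-trans (ℕₚ.≤-reflexive (m≡m%n+[m/n]*n R 16)) (ℕₚ.+-monoˡ-≤ (R₁ ℕ.* 16) (ℕₚ.≤-pred (m%n<n R 16)))
      1≤R₁ : 1 ℕ.≤ R₁
      1≤R₁ = m≥n⇒m/n>0 16≤R

    module _ (σ : SignFunction S) where

      open Transform (f σ) using (a; ratio)

      half≼correlation : ⌜ ½ ⌝ * ν ≼ Σ< R (λ i → a i * signℝ (rsP k i))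
      half≼correlation = ≼-trans half-correlation (≼-trans
        (≼-reflexive (+-cong (≋-refl {ν}) (neg-cong (*-cong (≋-refl {⌜ ι 2 ⌝}) (⌜⌝-cong (cong ι (size-tabulate R inS)))))))
        (correlation σ))

      in-class : ∀ N → squarefreeCount R ≡ suc N → InClass R ⌜ recip 11 ⌝ (f σ)
      in-class N eq = ratio N k b R≤2^k b²-eq
        (≋-trans (energy σ) e)
        (≼-resp (*-cong ≋-refl e) ≋-refl half≼correlation)
        (≼-resp ≋-refl (*-cong ≋-refl e) b²≼36ν)
        where
        e : ν ≋ ⌜ ι (suc N) ⌝
        e = ⌜⌝-cong (cong ι eq)

    shatters : (N : ℕ) → squarefreeCount R ≡ suc N → Shatters (ℋ R ⌜ recip 11 ⌝) S
    shatters N eq = S⊆X′ , λ σ → f σ , inClass⇒ℋ {R} {⌜ recip 11 ⌝} (f σ) (in-class σ N eq) , f-extends σ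

    VC-bound : (N : ℕ) → squarefreeCount R ≡ suc N → VC[ ℋ R ⌜ recip 11 ⌝ ]≥ (⌜ recip 127 ⌝ D.* fromℕ R)
    VC-bound N eq = S , shatters N eq , ≤-intro ⌜ recip 127 ⌝ {R} {size S} large

-- The integer 1 is found squarefree by computation, so the count reduces to a successor.
squarefreeCount-pos : ∀ R → 1 ℕ.≤ R → ∃[ N ] squarefreeCount R ≡ suc N
squarefreeCount-pos (suc R) _ = _ , refl

-- recip n is 1/(n+1), so c₀ = 1/12 and c = 1/128.
theorem1p6 : ∃[ c₀ ] 0ℝ < c₀ × (∃[ c ] 0ℝ < c × (∃[ R₀ ] (∀ R → R₀ ℕ.≤ R → VC[ ℋ R c₀ ]≥ (c D.* fromℕ R))))
theorem1p6 = ⌜ recip 11 ⌝ , 0<recip 11 , ⌜ recip 127 ⌝ , 0<recip 127 , 16 , λ R 16≤R →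
  let open Construction R 16≤R in
  case scale R 1≤R of λ (k , b , R≤2^k , b² , b²≤8R) →
  case squarefreeCount-pos R 1≤R of λ (N , eq) →
  VC-bound k b R≤2^k b² b²≤8R N eq
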